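{- Let $\mathcal{L}\in\{\mathcal{EL}_\bot,\mathcal{ELI}_\bot\}$. The consistent $\mathcal{L}$-ontology fitting problem, i.e. the problem to decide, given a collection $E=(E^+,E^-)$ of labeled ABox examples, whether there is an $\mathcal{L}$-ontology $\mathcal{O}$ such that every $\mathcal{A}\in E^+$ is consistent with $\mathcal{O}$ and every $\mathcal{A}\in E^-$ is inconsistent with $\mathcal{O}$, is in $\mathrm{PTime}$.
   Context: Let $\mathsf{N_C},\mathsf{N_R},\mathsf{N_I}$ be countably infinite sets of concept names, role names and individual names. A role is a role name $r$ or an inverse role $r^-$. $\mathcal{ELI}_\bot$-concepts are built by $C,D::=\top\mid\bot\mid A\mid C\sqcap D\mid\exists r.C$ with $A\in\mathsf{N_C}$ and $r$ a role; $\mathcal{EL}_\bot$-concepts are those without inverse roles. An $\mathcal{L}$-ontology is a finite set of concept inclusions $C\sqsubseteq D$ with $C,D$ $\mathcal{L}$-concepts. An ABox is a finite nonempty set of assertions $A(a)$, $r(a,b)$ with $A\in\mathsf{N_C}$, $r\in\mathsf{N_R}$, $a,b\in\mathsf{N_I}$. Interpretations have non-empty domain and the usual description-logic semantics; $\mathcal{I}$ satisfies $C\sqsubseteq D$ if $C^{\mathcal I}\subseteq D^{\mathcal I}$, $A(a)$ if $a\in A^{\mathcal I}$, and $r(a,b)$ if $(a,b)\in r^{\mathcal I}$ (standard names assumption). A model of an ontology or ABox satisfies all its members; an ABox $\mathcal{A}$ is consistent with $\mathcal{O}$ if they have a common model. A collection of labeled ABox examples is a pair $(E^+,E^-)$ of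 finite sets of ABoxes, assumed to have pairwise disjoint sets of individual names. Input size is the length of an encoding as a word over a suitable alphabet. -}

module Defs where

open import Data.Bool using (Bool; true)
open import Data.Fin using (Fin)
open import Data.List using (List; []; _∷_; _++_; [_]; map; concatMap; foldr; length)
open import Data.List.NonEmpty using (List⁺; toList)
open import Data.List.Relation.Binary.Disjoint.Propositional using (Disjoint)
open import Data.List.Relation.Unary.All using (All)
open import Data.List.Relation.Unary.AllPairs using (AllPairs)
open import Data.Maybe using (Maybe; just; nothing)
open import Data.Nat using (ℕ; zero; suc; _+_; _*_)
open import Data.Nat.Binary using (ℕᵇ; zero; 2[1+_]; 1+[2_]; fromℕ)
open import Data.Product using (∃; ∃-syntax; _×_; _,_)
open import Data.Sum using (_⊎_; inj₁; inj₂)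
open import Data.Vec using (Vec; _∷_; replicate; zipWith)
import Data.Vec as Vec
open import Function using (flip)
open import Function.Bundles using (_↔_; _↣_; _⇔_; Injection)
open import Level using (Level; _⊔_) renaming (suc to lsuc; zero to 0ℓ)
open import Relation.Binary.Core using (Rel)
open import Relation.Binary.PropositionalEquality using (_≡_; _≢_)
open import Relation.Nullary using (¬_)
open import Relation.Unary using (Pred; ∅; _∩_; _⊆_; Satisfiable)

N-C N-R N-I : Set
N-C = ℕ
N-R = ℕ
N-I = ℕ

data DL : Set where
  EL⊥ ELI⊥ : DL

data Role : DL → Set where
  name : ∀ {𝓛} → N-R → Role 𝓛
  inv  : N-R → Role ELI⊥

infixr 7 _⊓_
infix  4 _⊑_

data Concept (𝓛 : DL) : Set where
  top bot : Concept 𝓛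
  atom    : N-C → Concept 𝓛
  _⊓_     : Concept 𝓛 → Concept 𝓛 → Concept 𝓛
  ex      : Role 𝓛 → Concept 𝓛 → Concept 𝓛

data Inclusion (𝓛 : DL) : Set where
  _⊑_ : Concept 𝓛 → Concept 𝓛 → Inclusion 𝓛

-- Finite sets are represented by lists.
Ontology : DL → Set
Ontology 𝓛 = List (Inclusion 𝓛)

data Assertion : Set where
  conceptA : N-C → N-I → Assertion
  roleA    : N-R → N-I → N-I → Assertion

ABox : Set
ABox = List⁺ Assertion

individualsOf : Assertion → List N-I
individualsOf (conceptA A a) = a ∷ []
individualsOf (roleA r a b)  = a ∷ b ∷ []

individuals : ABox → List N-I
individuals 𝒜 = concatMap individualsOf (toList 𝒜)

-- Standard names: the domain is a subset of N-I ⊎ Other, so that an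
-- individual name that belongs to the domain denotes itself, and the
-- domain need not contain all individual names.
record Interpretation : Set₁ where
  field
    Other : Set

  Element : Set
  Element = N-I ⊎ Other

  field
    Δ        : Pred Element 0ℓ
    nonempty : Satisfiable Δ
    concept  : N-C → Pred Element 0ℓ
    role     : N-R → Rel Element 0ℓ
    concept⊆ : ∀ A {x} → concept A x → Δ x
    role⊆    : ∀ r {x y} → role r x y → Δ x × Δ y

module _ (ℐ : Interpretation) where
  open Interpretation ℐ

  roleExt : ∀ {𝓛} → Role 𝓛 → Rel Element 0ℓ
  roleExt (name r) = role r
  roleExt (inv r)  = flip (role r)

  conceptExt : ∀ {𝓛} → Concept 𝓛 → Pred Element 0ℓ
  conceptExt top      = Δ
  conceptExt bot      = ∅
  conceptExt (atom A) = concept A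
  conceptExt (C ⊓ D)  = conceptExt C ∩ conceptExt D
  conceptExt (ex r C) = λ x → ∃[ y ] (roleExt r x y × conceptExt C y)

  SatisfiesInclusion : ∀ {𝓛} → Inclusion 𝓛 → Set
  SatisfiesInclusion (C ⊑ D) = conceptExt C ⊆ conceptExt D

  SatisfiesAssertion : Assertion → Set
  SatisfiesAssertion (conceptA A a) = concept A (inj₁ a)
  SatisfiesAssertion (roleA r a b)  = role r (inj₁ a) (inj₁ b)

  ModelOfOntology : ∀ {𝓛} → Ontology 𝓛 → Set
  ModelOfOntology 𝒪 = All SatisfiesInclusion 𝒪

  ModelOfABox : ABox → Set
  ModelOfABox 𝒜 = All SatisfiesAssertion (toList 𝒜)

Consistent : ∀ {𝓛} → Ontology 𝓛 → ABox → Set₁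
Consistent 𝒪 𝒜 = ∃[ ℐ ] (ModelOfOntology ℐ 𝒪 × ModelOfABox ℐ 𝒜)

record Examples : Set where
  field
    positive negative : List ABox
    disjoint : AllPairs (λ 𝒜 ℬ → Disjoint (individuals 𝒜) (individuals ℬ))
                        (positive ++ negative)

Fits : ∀ {𝓛} → Ontology 𝓛 → Examples → Set₁
Fits 𝒪 E = All (Consistent 𝒪) positive × All (λ 𝒜 → ¬ Consistent 𝒪 𝒜) negative
  where open Examples E

data Symbol : Set where
  one two endName conceptTag roleTag positiveTag negativeTag : Symbol

-- Bijective base-2 numeral, least significant digit first; the number 0
-- is the empty numeral.
digits : ℕᵇ → List Symbol
digits zero     = []
digits 1+[2 n ] = one ∷ digits n
digits 2[1+ n ] = two ∷ digits n

encodeName : ℕ → List Symbol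
encodeName n = digits (fromℕ n) ++ [ endName ]

encodeAssertion : Assertion → List Symbol
encodeAssertion (conceptA A a) = conceptTag ∷ encodeName A ++ encodeName a
encodeAssertion (roleA r a b)  = roleTag ∷ encodeName r ++ encodeName a ++ encodeName b

encodeABox : ABox → List Symbol
encodeABox 𝒜 = concatMap encodeAssertion (toList 𝒜)

encode : Examples → List Symbol
encode E = concatMap (λ 𝒜 → positiveTag ∷ encodeABox 𝒜) positive
        ++ concatMap (λ 𝒜 → negativeTag ∷ encodeABox 𝒜) negative
  where open Examples E

Finite : Set → Set
Finite A = ∃[ n ] (A ↔ Fin n)

data Move : Set where
  left stay right : Move

-- Two-way infinite tape: both lists start next to the head, and all cells
-- beyond them are blank.
record Tape (Γ : Set) : Set where
  constructor tape
  field
    before : List Γ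
    head   : Γ
    after  : List Γ

record TuringMachine (A : Set) : Set₁ where
  field
    State         : Set
    finite-State  : Finite State
    start         : State
    Γ             : Set
    finite-Γ      : Finite Γ
    blank         : Γ
    symbol        : A ↣ Γ
    symbol≢blank  : ∀ a → Injection.to symbol a ≢ blank
    -- There is the input tape and this number of additional work tapes.
    workTapes     : ℕ

  tapes : ℕ
  tapes = suc workTapes

  field
    -- inj₁ b: halt, accepting if b is true and rejecting otherwise.
    δ : State → Vec Γ tapes → Bool ⊎ (State × Vec (Γ × Move) tapes)

module _ {A : Set} (M : TuringMachine A) where
  open TuringMachine M

  Configuration : Set
  Configuration = State × Vec (Tape Γ) tapes

  focus : List Γ → List Γ → Tape Γ
  focus xs []       = tape xs blank []
  focus xs (y ∷ ys) = tape xs y ys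

  act : Γ × Move → Tape Γ → Tape Γ
  act (g , stay)  (tape xs _ ys)       = tape xs g ys
  act (g , right) (tape xs _ ys)       = focus (g ∷ xs) ys
  act (g , left)  (tape [] _ ys)       = tape [] blank (g ∷ ys)
  act (g , left)  (tape (x ∷ xs) _ ys) = tape xs x (g ∷ ys)

  initial : List A → Configuration
  initial w = start , focus [] (map (Injection.to symbol) w)
                    ∷ replicate workTapes (focus [] [])

  -- The answer given when started in the configuration, if the machine
  -- halts after at most the given number of transitions.
  runFrom : ℕ → Configuration → Maybe Bool
  runFrom t (q , ts) with δ q (Vec.map Tape.head ts) | t
  ... | inj₁ b          | _      = just b
  ... | inj₂ _          | zero   = nothing
  ... | inj₂ (q′ , act′) | suc t′ = runFrom t′ (q′ , zipWith act act′ ts)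

  run : ℕ → List A → Maybe Bool
  run t w = runFrom t (initial w)

Language : Set → (ℓ : Level) → Set (lsuc ℓ)
Language A ℓ = Pred (List A) ℓ

DecidesInTime : ∀ {A ℓ} → TuringMachine A → (ℕ → ℕ) → Language A ℓ → Set ℓ
DecidesInTime M f L =
  ∀ w → ∃[ b ] (run M (f (length w)) w ≡ just b × (b ≡ true ⇔ L w))

-- The polynomial with the given coefficients, constant term first.
polynomial : List ℕ → ℕ → ℕ
polynomial cs n = foldr (λ c v → c + n * v) 0 cs

PTime : {A : Set} {ℓ : Level} → Language A ℓ → Set (lsuc 0ℓ ⊔ ℓ)
PTime L = ∃[ M ] ∃[ cs ] DecidesInTime M (polynomial cs) L

-- Words that do not encode a collection of examples are not in the language.
ConsistentFitting : DL → Language Symbol (lsuc 0ℓ)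
ConsistentFitting 𝓛 w =
  ∃[ E ] (encode E ≡ w × ∃[ 𝒪 ] Fits {𝓛} 𝒪 E)

-- Call b simulated by a if every concept name of b is one of a and every
-- edge at b is matched by an edge at a between simulated ends, where EL⊥
-- looks at outgoing edges only.  The examples can be fitted iff every
-- negative ABox has an individual b that no individual of a positive ABox
-- simulates.  Given such b, each failure of simulation is witnessed by a
-- concept, and forbidding the conjunction of the witnesses for b excludes
-- the negative ABox while the positive facts themselves form a model.
-- Conversely, if all individuals of a negative ABox are simulated, models of
-- the positive ABoxes combine into one of the negative ABox by a power
-- construction.
--
-- The largest simulation is computed on a table indexed by pairs of input
-- positions: starting from the full table, an entry whose condition fails is
-- cleared as long as there is one.  Every test involved quantifies over
-- finitely many positions, so it runs in polynomial time on a machine with a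
-- copy of the input for each position variable.

module Submission where

open import Data.Bool using (Bool; true; false; if_then_else_; not; _∧_; _∨_)
open import Data.Empty using (⊥; ⊥-elim)
open import Data.Fin.Patterns
open import Data.Fin.Properties using (+↔⊎; toℕ-injective; toℕ-fromℕ<)
import Data.List as List
open import Data.List using (List; []; _∷_; _++_; [_]; _ʳ++_; length; reverse; concatMap; map)
open import Data.List.Membership.Propositional using (_∈_; _∉_; lose; find)
open import Data.List.Membership.Propositional.Properties using (∈-concatMap⁺; ∈-concatMap⁻; ∈-++⁺ˡ; ∈-++⁺ʳ; ∈-++⁻; ∈-map⁻; ∈-map⁺)
open import Data.List.NonEmpty using (toList; _∷_)
open import Data.List.Properties using (ʳ++-defn; reverse-involutive; length-reverse; length-ʳ++; ++-ʳ++; ++-identityʳ; length-++; ++-assoc; concatMap-++; ∷-injectiveʳ; map-++; map-∘; map-id; concatMap-map; ʳ++-ʳ++)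
import Data.List.Relation.Unary.All as All
open import Data.List.Relation.Unary.All using (All; []; _∷_)
open import Data.List.Relation.Unary.AllPairs using ([]; _∷_; AllPairs)
open import Data.List.Relation.Unary.Any using (here; there)
open import Data.Maybe using (Maybe; just; nothing; is-just)
open import Data.Nat using (ℕ; zero; suc; _+_; _≤_; s≤s; _*_; _<_; _≤?_; z≤n)
open import Data.Nat.Tactic.RingSolver using (solve-∀)
open import Data.Product using (_×_; _,_; proj₁; proj₂; map₁; ∃-syntax; Σ)
open import Data.Sum using (_⊎_; inj₁; inj₂)
open import Data.Vec.Properties using (lookup∘updateAt; lookup∘updateAt′; lookup-map; lookup-replicate)
open import Function using (_∘_; const; case_of_)
open import Relation.Binary.PropositionalEquality hiding ([_])
open import Relation.Nullary using (yes; no; does; contradiction; ¬_; Dec)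
open import Relation.Nullary.Decidable using (True; toWitness; from-yes)

open import Defs

-- The argument is constructive, so a failed simulation must come with its witness. The refinement
-- maintains that every cleared entry has a finite derivation `Distinguished`, from which a concept
-- can be extracted; at the fixpoint the uncleared entries yield a simulation. One run thus provides
-- either the ontology or the obstruction to it. Indexing by positions avoids numbering the names on
-- the machine, but an individual then owns several rows, which may differ. This does no harm:
-- clearing is justified for whatever names begin at the two positions, and in the other direction
-- two individuals count as related as soon as one pair of their occurrences is uncleared. Standard
-- names shape the power construction: the individuals of the negative ABox must themselves be
-- elements. Two of them have different index sets, so an asserted edge between them cannot be
-- defined pointwise; it is added by hand, and the simulation makes it behave like an edge in every
-- component. For input length n there are (n+1)(n+1) entries and each round clears one; a round
-- consists of searches nested to a fixed depth.

module Machines where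

  open import Data.Fin using (Fin; zero; suc)
  open import Data.Nat.Properties using (+-assoc; +-monoˡ-≤; +-identityʳ)
  open import Data.Sum.Function.Propositional using (_⊎-↔_)
  import Data.Vec as Vec
  open import Data.Vec using (Vec; []; _∷_; updateAt; zipWith; replicate)
  open import Function.Bundles using (mk↔ₛ′; mk↣)
  open import Function.Construct.Composition using (_↔-∘_)
  open import Function.Construct.Identity using (↔-id)
  open import Function.Construct.Symmetry using (↔-sym)

  -- Structured programs and their compilation into Turing machines

  Cell : Set
  Cell = Maybe Symbol

  -- `focus` and `act` take a machine as parameter. Copies without that parameter let executions be
  -- described before any machine has been built.
  refocus : List Cell → List Cell → Tape Cell
  refocus xs []       = tape xs nothing []
  refocus xs (y ∷ ys) = tape xs y ys

  apply : Cell × Move → Tape Cell → Tape Cell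
  apply (g , stay)  (tape xs _ ys)       = tape xs g ys
  apply (g , right) (tape xs _ ys)       = refocus (g ∷ xs) ys
  apply (g , left)  (tape [] _ ys)       = tape [] nothing (g ∷ ys)
  apply (g , left)  (tape (x ∷ xs) _ ys) = tape xs x (g ∷ ys)

  Action : Set
  Action = Cell × Move

  finite-Cell : Finite Cell
  finite-Cell = 8 , mk↔ₛ′ to from to∘from from∘to
    where
    to : Cell → Fin 8
    to nothing            = 0F
    to (just one)         = 1F
    to (just two)         = 2F
    to (just endName)     = 3F
    to (just conceptTag)  = 4F
    to (just roleTag)     = 5F
    to (just positiveTag) = 6F
    to (just negativeTag) = 7F
    from : Fin 8 → Cell
    from 0F = nothing
    from 1F = just one
    from 2F = just two
    from 3F = just endName
    from 4F = just conceptTag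
    from 5F = just roleTag
    from 6F = just positiveTag
    from 7F = just negativeTag
    to∘from : ∀ i → to (from i) ≡ i
    to∘from 0F = refl
    to∘from 1F = refl
    to∘from 2F = refl
    to∘from 3F = refl
    to∘from 4F = refl
    to∘from 5F = refl
    to∘from 6F = refl
    to∘from 7F = refl
    from∘to : ∀ c → from (to c) ≡ c
    from∘to nothing            = refl
    from∘to (just one)         = refl
    from∘to (just two)         = refl
    from∘to (just endName)     = refl
    from∘to (just conceptTag)  = refl
    from∘to (just roleTag)     = refl
    from∘to (just positiveTag) = refl
    from∘to (just negativeTag) = refl

  module Programs (m : ℕ) where

    t : ℕ
    t = suc m

    Heads Tapes : Set
    Heads = Vec Cell t
    Tapes = Vec (Tape Cell) t

    heads : Tapes → Heads
    heads = Vec.map Tape.head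

    -- Every program ends with a Boolean answer; `loop p` repeats p as long
    -- as the answer is true.
    data Prog : Set where
      op   : Fin t → (Heads → Bool × Action) → Prog
      ite  : Prog → Prog → Prog → Prog
      loop : Prog → Prog

    -- A relation, because loops need not terminate. Only `op` takes time by itself, and `weaken`
    -- turns exact counts into upper bounds.
    data Exec : Prog → Tapes → ℕ → Bool → Tapes → Set where
      op     : ∀ {j f ts} →
               Exec (op j f) ts 1 (proj₁ (f (heads ts)))
                    (updateAt ts j (apply (proj₂ (f (heads ts)))))
      then′  : ∀ {p q r ts ts′ ts″ k l b} →
               Exec p ts k true ts′ → Exec q ts′ l b ts″ → Exec (ite p q r) ts (k + l) b ts″
      else′  : ∀ {p q r ts ts′ ts″ k l b} →
               Exec p ts k false ts′ → Exec r ts′ l b ts″ → Exec (ite p q r) ts (k + l) b ts″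
      again  : ∀ {p ts ts′ ts″ k l b} →
               Exec p ts k true ts′ → Exec (loop p) ts′ l b ts″ → Exec (loop p) ts (k + l) b ts″
      leave  : ∀ {p ts ts′ k} → Exec p ts k false ts′ → Exec (loop p) ts k false ts′
      weaken : ∀ {p ts ts′ k l b} → k ≤ l → Exec p ts k b ts′ → Exec p ts l b ts′

    -- Only occurrences of operations become states: branching and repeating are decided within the
    -- transition that performs an operation, which is why they are free in `Exec`.
    Control : Prog → Set
    Control (op _ _)    = Fin 1
    Control (ite p q r) = Control p ⊎ (Control q ⊎ Control r)
    Control (loop p)    = Control p

    entry : ∀ p → Control p
    entry (op _ _)    = 0F
    entry (ite p _ _) = inj₁ (entry p)
    entry (loop p)    = entry p

    finite-⊎ : ∀ {A B} → Finite A → Finite B → Finite (A ⊎ B)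
    finite-⊎ (k , f) (l , g) = k + l , (↔-sym (+↔⊎ {k} {l}) ↔-∘ (f ⊎-↔ g))

    finite-Control : ∀ p → Finite (Control p)
    finite-Control (op _ _)    = 1 , ↔-id _
    finite-Control (ite p q r) =
      finite-⊎ (finite-Control p) (finite-⊎ (finite-Control q) (finite-Control r))
    finite-Control (loop p)    = finite-Control p

    finite-Bool : Finite Bool
    finite-Bool = 2 , mk↔ₛ′ (λ { true → 0F ; false → 1F }) (λ { 0F → true ; 1F → false })
                            (λ { 0F → refl ; 1F → refl }) (λ { true → refl ; false → refl })

    Point : Prog → Set
    Point p = Control p ⊎ Bool

    fromTest : ∀ p q r → Point p → Point (ite p q r)
    fromTest p q r (inj₁ s)     = inj₁ (inj₁ s)
    fromTest p q r (inj₂ true)  = inj₁ (inj₂ (inj₁ (entry q)))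
    fromTest p q r (inj₂ false) = inj₁ (inj₂ (inj₂ (entry r)))

    fromThen : ∀ p q r → Point q → Point (ite p q r)
    fromThen p q r (inj₁ s) = inj₁ (inj₂ (inj₁ s))
    fromThen p q r (inj₂ b) = inj₂ b

    fromElse : ∀ p q r → Point r → Point (ite p q r)
    fromElse p q r (inj₁ s) = inj₁ (inj₂ (inj₂ s))
    fromElse p q r (inj₂ b) = inj₂ b

    fromBody : ∀ p → Point p → Point (loop p)
    fromBody p (inj₁ s)     = inj₁ s
    fromBody p (inj₂ true)  = inj₁ (entry p)
    fromBody p (inj₂ false) = inj₂ false

    only : Fin t → Action → Heads → Vec Action t
    only j a hs = updateAt (Vec.map (_, stay) hs) j (λ _ → a)

    step : ∀ p → Control p → Heads → Point p × Vec Action t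
    step (op j f)    _               hs = inj₂ (proj₁ (f hs)) , only j (proj₂ (f hs)) hs
    step (ite p q r) (inj₁ s)        hs = map₁ (fromTest p q r) (step p s hs)
    step (ite p q r) (inj₂ (inj₁ s)) hs = map₁ (fromThen p q r) (step q s hs)
    step (ite p q r) (inj₂ (inj₂ s)) hs = map₁ (fromElse p q r) (step r s hs)
    step (loop p)    s               hs = map₁ (fromBody p) (step p s hs)

    machine : Prog → TuringMachine Symbol
    machine p = record
      { State        = Point p
      ; finite-State = finite-⊎ (finite-Control p) finite-Bool
      ; start        = inj₁ (entry p)
      ; Γ            = Cell
      ; finite-Γ     = finite-Cell
      ; blank        = nothing
      ; symbol       = mk↣ {to = just} (λ { refl → refl })
      ; symbol≢blank = λ _ ()
      ; workTapes    = m
      ; δ            = λ { (inj₁ s) hs → inj₂ (step p s hs) ; (inj₂ b) _ → inj₁ b }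
      }

    -- A machine acts on all tapes at once; a tape not addressed by the operation rewrites its own
    -- head symbol and stays. The function `f` will be `act` of the machine under construction.
    zipWith-stay : (f : Action → Tape Cell → Tape Cell) (f≗apply : ∀ a x → f a x ≡ apply a x) →
                   ∀ {k} (ts : Vec (Tape Cell) k) →
                   zipWith f (Vec.map (_, stay) (Vec.map Tape.head ts)) ts ≡ ts
    zipWith-stay f e []       = refl
    zipWith-stay f e (x ∷ ts) = cong₂ _∷_ (e _ x) (zipWith-stay f e ts)

    zipWith-only : (f : Action → Tape Cell → Tape Cell) (f≗apply : ∀ a x → f a x ≡ apply a x) →
                   ∀ {k} (j : Fin k) a (ts : Vec (Tape Cell) k) →
                   zipWith f (updateAt (Vec.map (_, stay) (Vec.map Tape.head ts)) j (λ _ → a)) ts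
                   ≡ updateAt ts j (apply a)
    zipWith-only f e zero    a (x ∷ ts) = cong₂ _∷_ (e a x) (zipWith-stay f e ts)
    zipWith-only f e (suc j) a (x ∷ ts) = cong₂ _∷_ (e _ x) (zipWith-only f e j a ts)

    module _ (P : Prog) where
      private
        M = machine P
      open TuringMachine M using (State; δ)

      act≗apply : ∀ a x → act M a x ≡ apply a x
      act≗apply (g , stay)  (tape xs _ ys)       = refl
      act≗apply (g , right) (tape xs _ [])       = refl
      act≗apply (g , right) (tape xs _ (_ ∷ _))  = refl
      act≗apply (g , left)  (tape [] _ ys)       = refl
      act≗apply (g , left)  (tape (x ∷ xs) _ ys) = refl

      runFrom-step : ∀ k q ts {q′ as} → δ q (heads ts) ≡ inj₂ (q′ , as) →
                     runFrom M (suc k) (q , ts) ≡ runFrom M k (q′ , zipWith (act M) as ts)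
      runFrom-step k q ts e rewrite e = refl

      -- A halting configuration gives its answer under every budget, so unspent time does no harm.
      -- This is what makes `weaken` sound.
      runFrom-mono : ∀ {k l} → k ≤ l → ∀ c {b} → runFrom M k c ≡ just b → runFrom M l c ≡ just b
      runFrom-mono {zero}  {l}     k≤l       (q , ts) e with δ q (heads ts)
      runFrom-mono {zero}  {l}     k≤l       (q , ts) e  | inj₁ _ = e
      runFrom-mono {zero}  {l}     k≤l       (q , ts) () | inj₂ _
      runFrom-mono {suc k} {suc l} (s≤s k≤l) (q , ts) e with δ q (heads ts)
      ... | inj₁ _ = e
      ... | inj₂ (q′ , as) = runFrom-mono k≤l (q′ , zipWith (act M) as ts) e

      -- A subprogram sits in the machine via the map κ, which sends its
      -- answers to the points where the enclosing program continues.
      Embedded : ∀ p → (Point p → State) → Set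
      Embedded p κ = ∀ s hs → δ (κ (inj₁ s)) hs ≡ inj₂ (map₁ κ (step p s hs))

      -- Continuation style avoids a notion of partial run: sequencing is one application inside
      -- another. The continuation of a subprogram is `κ` after the corresponding `from` map, and it
      -- is embedded because `step` computes that way.
      exec-sound : ∀ {p ts k b ts′} → Exec p ts k b ts′ →
                   (κ : Point p → State) → Embedded p κ → ∀ l {a} →
                   runFrom M l (κ (inj₂ b) , ts′) ≡ just a →
                   runFrom M (k + l) (κ (inj₁ (entry p)) , ts) ≡ just a
      exec-sound (op {j} {f} {ts}) κ emb l e =
        trans (runFrom-step l _ ts (emb 0F (heads ts)))
              (trans (cong (λ x → runFrom M l (κ (inj₂ (proj₁ (f (heads ts)))) , x))
                           (zipWith-only (act M) act≗apply j (proj₂ (f (heads ts))) ts))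
                     e)
      exec-sound (then′ {p} {q} {r} {k = k} {l = l} x y) κ emb o e rewrite +-assoc k l o =
        exec-sound x (κ ∘ fromTest p q r) (λ s → emb (inj₁ s)) (l + o)
          (exec-sound y (κ ∘ fromThen p q r) (λ s → emb (inj₂ (inj₁ s))) o e)
      exec-sound (else′ {p} {q} {r} {k = k} {l = l} x y) κ emb o e rewrite +-assoc k l o =
        exec-sound x (κ ∘ fromTest p q r) (λ s → emb (inj₁ s)) (l + o)
          (exec-sound y (κ ∘ fromElse p q r) (λ s → emb (inj₂ (inj₂ s))) o e)
      exec-sound (again {p} {k = k} {l = l} x y) κ emb o e rewrite +-assoc k l o =
        exec-sound x (κ ∘ fromBody p) emb (l + o) (exec-sound y κ emb o e)
      exec-sound (leave {p} x) κ emb o e = exec-sound x (κ ∘ fromBody p) emb o e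
      exec-sound (weaken {p} {ts} k≤l x) κ emb o e =
        runFrom-mono (+-monoˡ-≤ o k≤l) (κ (inj₁ (entry p)) , ts) (exec-sound x κ emb o e)

      focus≗refocus : ∀ xs ys → focus M xs ys ≡ refocus xs ys
      focus≗refocus xs []      = refl
      focus≗refocus xs (_ ∷ _) = refl

      run-sound : ∀ {w k b ts} →
                  Exec P (refocus [] (List.map just w) ∷ replicate m (tape [] nothing [])) k b ts →
                  run M k w ≡ just b
      run-sound {w} {k} {b} x =
        subst (λ l → run M l w ≡ just b) (+-identityʳ k)
          (subst (λ y → runFrom M (k + 0) (inj₁ (entry P) , y ∷ replicate m (tape [] nothing [])) ≡ just b)
                 (sym (focus≗refocus [] (List.map just w)))
                 -- The whole program is embedded by the identity, and `inj₂ b` halts at once, so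
                 -- the continuation gets budget zero.
                 (exec-sound x (λ c → c) (λ _ _ → refl) 0 refl))

-- Positions on tapes, rewinding and copying them

module Tapes where

  open import Data.Fin using (Fin; _≟_; _↑ʳ_)
  open import Data.Nat.Properties hiding (_≟_)
  open import Data.Vec using ([]; _∷_; lookup)

  open Machines

  -- Ten tapes: the input, the table, the stack, two scratch tapes and five variables, which is the
  -- nesting depth of the deepest test.
  open Programs 9 public

  W : Set
  W = List Symbol

  -- A position in a word: what precedes it, nearest symbol first, and what starts there. The length
  -- of the first component is the index of the position; a word of length `n` has `n + 1`
  -- positions, the end included.
  Zip : Set
  Zip = W × W

  word : Zip → W
  word (pre , suf) = pre ʳ++ suf

  -- The tape holding blank · word · blank, with the head on the first
  -- symbol of suf, or on the closing blank if there is none.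
  zipTape : W → W → Tape Cell
  zipTape pre suf = refocus (List.map just pre ++ [ nothing ]) (List.map just suf ++ [ nothing ])

  -- The head is on the opening blank. Explicit blanks at both ends make a walk to an end and back
  -- restore the tape literally, and not only up to trailing blanks.
  edgeTape : W → Tape Cell
  edgeTape suf = tape [] nothing (List.map just suf ++ [ nothing ])

  Same : Fin t → Tapes → Tapes → Set
  Same j ts ts′ = ∀ l → l ≢ j → lookup ts′ l ≡ lookup ts l

  on : Fin t → (Cell → Bool × Action) → Prog
  on j f = op j (λ hs → f (lookup hs j))

  via : Fin t → Fin t → (Cell → Bool × Action) → Prog
  via i j f = op j (λ hs → f (lookup hs i))

  op-run : ∀ {j f ts b a Y} → f (heads ts) ≡ (b , a) → apply a (lookup ts j) ≡ Y →
           ∃[ ts′ ] Exec (op j f) ts 1 b ts′ × lookup ts′ j ≡ Y × Same j ts ts′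
  op-run {j} {f} {ts} refl refl =
    _ , op , lookup∘updateAt j ts , λ l l≢j → lookup∘updateAt′ l j l≢j ts

  via-run : ∀ {i j f ts X Y b a Z} → lookup ts i ≡ X → lookup ts j ≡ Y →
            f (Tape.head X) ≡ (b , a) → apply a Y ≡ Z →
            ∃[ ts′ ] Exec (via i j f) ts 1 b ts′ × lookup ts′ j ≡ Z × Same j ts ts′
  via-run {i} {j} {f} {ts} refl refl e e′ = op-run (trans (cong f (lookup-map i Tape.head ts)) e) e′

  on-run : ∀ {j f ts X b a Z} → lookup ts j ≡ X → f (Tape.head X) ≡ (b , a) → apply a X ≡ Z →
           ∃[ ts′ ] Exec (on j f) ts 1 b ts′ × lookup ts′ j ≡ Z × Same j ts ts′
  on-run {j} {f} e = via-run {j} {j} {f} e e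

  test : Fin t → (Cell → Bool) → Prog
  test j q = on j (λ g → q g , (g , stay))

  pass fail : Fin t → Prog
  pass j = test j (const true)
  fail j = test j (const false)

  goLeft goRight : Fin t → Prog
  goLeft  j = on j (λ g → true , (g , left))
  goRight j = on j (λ g → true , (g , right))

  apply-stay : ∀ X → apply (Tape.head X , stay) X ≡ X
  apply-stay (tape _ _ _) = refl

  test-run : ∀ {j} q {ts X} → lookup ts j ≡ X →
             ∃[ ts′ ] Exec (test j q) ts 1 (q (Tape.head X)) ts′ × (∀ l → lookup ts′ l ≡ lookup ts l)
  test-run {j} q {ts} {X} e with on-run {j} {λ g → q g , (g , stay)} e refl (apply-stay X)
  ... | ts′ , x , e′ , same = ts′ , x , eq
    where
    eq : ∀ l → lookup ts′ l ≡ lookup ts l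
    eq l with l ≟ j
    ... | yes refl = trans e′ (sym e)
    ... | no l≢j   = same l l≢j

  left-zip : ∀ c pre suf → apply (Tape.head (zipTape (c ∷ pre) suf) , left) (zipTape (c ∷ pre) suf) ≡ zipTape pre (c ∷ suf)
  left-zip c pre []      = refl
  left-zip c pre (_ ∷ _) = refl

  left-edge : ∀ suf → apply (Tape.head (zipTape [] suf) , left) (zipTape [] suf) ≡ edgeTape suf
  left-edge []      = refl
  left-edge (_ ∷ _) = refl

  -- Moves the head of a zip tape back to the start, executing the body after
  -- each step onto a symbol.
  walk : Fin t → Prog → Prog
  walk j body = ite (loop (ite (goLeft j) (ite (test j is-just) body (fail j)) (fail j)))
                    (fail j) (goRight j)

  module _ {j : Fin t} {body : Prog} {cb : ℕ} (Φ : W → W → Tapes → Set)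
    (stable : ∀ {pre suf} ts ts′ → Same j ts ts′ → Φ pre suf ts → Φ pre suf ts′)
    (body-run : ∀ c pre suf ts → lookup ts j ≡ zipTape pre (c ∷ suf) → Φ (c ∷ pre) suf ts →
                ∃[ ts′ ] Exec body ts cb true ts′ × lookup ts′ j ≡ zipTape pre (c ∷ suf) × Φ pre (c ∷ suf) ts′)
    where

    -- The invariant `Φ` follows the split of the word at the head and may speak about every tape
    -- other than `j`; `stable` carries it over the moves of `j`. Each symbol costs a move, a test
    -- and the body. The last `4` is the move onto the opening blank, its test, the failure that
    -- ends the loop, and the move back.
    walk-run : ∀ pre suf ts → lookup ts j ≡ zipTape pre suf → Φ pre suf ts →
               ∃[ ts′ ] Exec (walk j body) ts (length pre * (2 + cb) + 4) true ts′
                        × lookup ts′ j ≡ zipTape [] (pre ʳ++ suf) × Φ [] (pre ʳ++ suf) ts′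
    walk-run pre suf ts e φ =
      case steps pre suf ts e φ of λ { (ts₁ , x , e₁ , φ₁) →
      case on-run {j} {λ g → true , (g , right)} e₁ refl refl of λ { (ts₂ , y , e₂ , same) →
      ts₂ , weaken (≤-reflexive (+-assoc (length pre * (2 + cb)) 3 1)) (else′ x y) , e₂ , stable ts₁ ts₂ same φ₁ } }
      where
      steps : ∀ pre suf ts → lookup ts j ≡ zipTape pre suf → Φ pre suf ts →
              ∃[ ts′ ] Exec (loop (ite (goLeft j) (ite (test j is-just) body (fail j)) (fail j)))
                            ts (length pre * (2 + cb) + 3) false ts′
                       × lookup ts′ j ≡ edgeTape (pre ʳ++ suf) × Φ [] (pre ʳ++ suf) ts′
      steps [] suf ts e φ =
        case on-run {j} {λ g → true , (g , left)} e refl (left-edge suf) of λ { (ts₁ , x , e₁ , same) →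
        case test-run {j} is-just e₁ of λ { (ts₂ , y , same₂) →
        case test-run {j} (const false) (trans (same₂ j) e₁) of λ { (ts₃ , z , same₃) →
        ts₃ , leave (then′ x (else′ y z)) , trans (same₃ j) (trans (same₂ j) e₁) ,
           stable ts₂ ts₃ (λ l _ → same₃ l) (stable ts₁ ts₂ (λ l _ → same₂ l) (stable ts ts₁ same φ)) } } }
      steps (c ∷ pre) suf ts e φ =
        case on-run {j} {λ g → true , (g , left)} e refl (left-zip c pre suf) of λ { (ts₁ , x , e₁ , same) →
        case test-run {j} is-just e₁ of λ { (ts₂ , y , same₂) →
        case body-run c pre suf ts₂ (trans (same₂ j) e₁)
                                  (stable ts₁ ts₂ (λ l _ → same₂ l) (stable ts ts₁ same φ)) of λ { (ts₃ , z , e₃ , φ₃) →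
        case steps pre (c ∷ suf) ts₃ e₃ φ₃ of λ { (ts₄ , r , e₄ , φ₄) →
        ts₄ , weaken (≤-reflexive (sym (+-assoc (2 + cb) (length pre * (2 + cb)) 3)))
                        (again (then′ x (then′ y z)) r) , e₄ , φ₄ } } } }

  home : Fin t → Prog
  home j = walk j (pass j)

  home-run : ∀ {j pre suf ts} → lookup ts j ≡ zipTape pre suf →
             ∃[ ts′ ] Exec (home j) ts (length pre * 3 + 4) true ts′
                      × lookup ts′ j ≡ zipTape [] (pre ʳ++ suf) × Same j ts ts′
  home-run {j} {pre} {suf} {ts} e =
    walk-run {j} {pass j} {1} (λ _ _ ts′ → Same j ts ts′) (λ _ _ s r l l≢j → trans (s l l≢j) (r l l≢j))
      (λ c pre suf ts₁ e₁ same →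
        case test-run {j} (const true) e₁ of λ { (ts₂ , x , same₂) →
        ts₂ , x , trans (same₂ j) e₁ , λ l l≢j → trans (same₂ l) (same l l≢j) })
      pre suf ts e (λ _ _ → refl)

  tableTape stackTape : Fin t
  tableTape = 1F
  stackTape = 2F

  data Place : Set where
    scratch₁ scratch₂ : Place
    var               : Fin 5 → Place

  at : Place → Fin t
  at scratch₁ = 3F
  at scratch₂ = 4F
  at (var i)  = 5 ↑ʳ i

  at-injective : ∀ {x y} → at x ≡ at y → x ≡ y
  at-injective {scratch₁} {scratch₁} _ = refl
  at-injective {scratch₂} {scratch₂} _ = refl
  at-injective {var i}    {var .i} refl = refl

  at≢table : ∀ x → at x ≢ tableTape
  at≢table scratch₁ ()
  at≢table scratch₂ ()
  at≢table (var i)  ()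

  at≢stack : ∀ x → at x ≢ stackTape
  at≢stack scratch₁ ()
  at≢stack scratch₂ ()
  at≢stack (var i)  ()

  -- The stack counts the steps by which the position of x is transferred to y.
  copy : Place → Place → Prog
  copy y x = ite (home (at y))
                 (ite (walk (at x) (on stackTape (λ _ → true , (just one , right))))
                      (walk stackTape (ite (goRight (at x)) (goRight (at y)) (fail (at x))))
                      (fail (at x)))
                 (fail (at x))

  -- Marks from earlier uses of the stack may lie to the right of the head and get overwritten,
  -- hence the existential suffix: the stack is only the number of marks before the head.
  push-zip : ∀ pre suf → ∃[ suf′ ] apply (just one , right) (zipTape pre suf) ≡ zipTape (one ∷ pre) suf′
  push-zip pre []        = [] , refl
  push-zip pre (c ∷ suf) = suf , refl

  reverse-ʳ++ : (xs ys : W) → reverse xs ++ ys ≡ xs ʳ++ ys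
  reverse-ʳ++ xs ys = sym (ʳ++-defn xs)

  pre≤word : ∀ {n} (pre suf : W) → length (pre ʳ++ suf) ≡ n → length pre ≤ n
  pre≤word pre suf refl rewrite length-ʳ++ pre {suf} = m≤m+n (length pre) (length suf)

  suf≤word : ∀ {n} (pre suf : W) → length (pre ʳ++ suf) ≡ n → length suf ≤ n
  suf≤word pre suf refl rewrite length-ʳ++ pre {suf} = m≤n+m (length suf) (length pre)

  -- Three walks: `y` is rewound, then `x` with a push at each step, then the stack while `x` and
  -- `y` move right together. In the second, the height of the stack plus the remaining prefix of
  -- `x` is constant (`Φ`); in the third, `x` and `y` stay at the same position (`Ψ`). Bodies of
  -- cost 1, 1 and 2 give `(3n + 4) + (3n + 4) + (4n + 4)`.
  copy-run : ∀ {x y w} → y ≢ x → ∀ {pre suf pre′ suf′ s ts} →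
             lookup ts (at x) ≡ zipTape pre suf → pre ʳ++ suf ≡ w →
             lookup ts (at y) ≡ zipTape pre′ suf′ → pre′ ʳ++ suf′ ≡ w →
             lookup ts stackTape ≡ zipTape [] s →
             ∃[ ts′ ] Exec (copy y x) ts (length w * 10 + 12) true ts′
                      × lookup ts′ (at y) ≡ zipTape pre suf
                      × (∃[ s′ ] lookup ts′ stackTape ≡ zipTape [] s′)
                      × (∀ l → l ≢ at y → l ≢ stackTape → lookup ts′ l ≡ lookup ts l)
  copy-run {x} {y} {w} y≢x {pre} {suf} {pre′} {suf′} {s} {ts} ax refl ay wy es =
    case home-run {at y} {pre′} {suf′} ay of λ { (ts₁ , p₁ , ay₁ , same₁) →
    case walk-run {at x} {on stackTape (λ _ → true , (just one , right))} {1} Φ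
            (λ { _ _ same (σ , s , e , p , ay , o) →
                 σ , s , trans (same _ (λ q → at≢stack x (sym q))) e , p , trans (same _ ay≢ax) ay ,
                 λ l a b c → trans (same l a) (o l a b c) })
            (λ { c p q ts′ e (σ , s , es , eq , ay , o) →
                 case push-zip σ s of λ { (s′ , pz) →
                 case on-run {stackTape} {λ _ → true , (just one , right)} es refl pz of λ { (ts″ , z , e″ , sm) →
                 ts″ , z , trans (sm _ (at≢stack x)) e ,
                    (one ∷ σ) , s′ , e″ , trans (sym (+-suc (length σ) (length p))) eq ,
                    trans (sm _ (at≢stack y)) ay ,
                    λ l a b c → trans (sm l c) (o l a b c) } }})
            pre suf ts₁ (trans (same₁ _ ax≢ay) ax)
            ([] , s , trans (same₁ _ (λ q → at≢stack y (sym q))) es , refl ,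
             trans ay₁ (cong (zipTape []) wy) ,
             λ l a b c → same₁ l b) of λ { (ts₂ , p₂ , ax₂ , σ , s₂ , es₂ , σ+ , ay₂ , same₂) →
    case walk-run {stackTape} {ite (goRight (at x)) (goRight (at y)) (fail (at x))} {2} Ψ
            (λ { _ _ same (q , l , e , ql , ax , ay , o) →
                 q , l , e , ql , trans (same _ (at≢stack x)) ax , trans (same _ (at≢stack y)) ay ,
                 λ l a b c → trans (same l c) (o l a b c) })
            (λ { c p r ts′ e (q , [] , () , ql , ax , ay , o)
               ; c p r ts′ e (q , d ∷ l , el , ql , ax , ay , o) →
                 case on-run {at x} {λ g → true , (g , right)} ax refl refl of λ { (ts″ , z , e″ , sm) →
                 case on-run {at y} {λ g → true , (g , right)} (trans (sm _ ay≢ax) ay) refl refl of λ { (ts‴ , z′ , e‴ , sm′) →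
                 ts‴ , then′ z z′ ,
                    trans (sm′ _ (λ q → at≢stack y (sym q))) (trans (sm _ (λ q → at≢stack x (sym q))) e) ,
                    (d ∷ q) , l , suc-injective el , ql ,
                    trans (sm′ _ ax≢ay) e″ , e‴ ,
                    λ l a b c → trans (sm′ l b) (trans (sm l a) (o l a b c)) } }})
            σ s₂ ts₂ es₂
            ([] , reverse pre , trans (length-reverse pre) (sym (trans (sym (+-identityʳ _)) σ+)) , reverse-involutive pre ,
             trans ax₂ (cong (zipTape []) (sym (reverse-ʳ++ pre suf))) ,
             trans ay₂ (cong (zipTape []) (sym (reverse-ʳ++ pre suf))) ,
             same₂) of λ { (ts₃ , p₃ , es₃ , (q , l , el , ql , ax₃ , ay₃ , same₃)) →
    let q≡pre = trans (cong (_ʳ++ q) (sym (length≡0 l el))) ql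
        l++≡  = cong (_++ suf) (length≡0 l el)
        fin : ∀ {X} → X ≡ zipTape q (l ++ suf) → X ≡ zipTape pre suf
        fin e = trans e (cong₂ zipTape q≡pre l++≡) in
    ts₃ , weaken (bound pre′ σ (pre≤word pre′ suf′ (cong length wy)) (pre≤word pre suf refl)
                            (≤-trans (≤-reflexive (trans (sym (+-identityʳ _)) σ+)) (pre≤word pre suf refl)))
                    (then′ p₁ (then′ p₂ p₃)) ,
       fin ay₃ , (_ , es₃) , λ k a b → other ts₃ k a b (fin ax₃) same₃ } } }
    where
    ax≢ay : at x ≢ at y
    ax≢ay q = y≢x (at-injective (sym q))
    ay≢ax : at y ≢ at x
    ay≢ax q = y≢x (at-injective q)
    length≡0 : (l : W) → length l ≡ 0 → l ≡ []
    length≡0 [] _ = refl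
    Φ : W → W → Tapes → Set
    Φ p _ ts′ = ∃[ σ ] ∃[ s′ ] lookup ts′ stackTape ≡ zipTape σ s′
                  × length σ + length p ≡ length pre
                  × lookup ts′ (at y) ≡ zipTape [] w
                  × (∀ l → l ≢ at x → l ≢ at y → l ≢ stackTape → lookup ts′ l ≡ lookup ts l)
    Ψ : W → W → Tapes → Set
    Ψ p _ ts′ = ∃[ q ] ∃[ l ] length l ≡ length p × l ʳ++ q ≡ pre
                  × lookup ts′ (at x) ≡ zipTape q (l ++ suf)
                  × lookup ts′ (at y) ≡ zipTape q (l ++ suf)
                  × (∀ l → l ≢ at x → l ≢ at y → l ≢ stackTape → lookup ts′ l ≡ lookup ts l)
    other : ∀ ts₃ k → k ≢ at y → k ≢ stackTape → lookup ts₃ (at x) ≡ zipTape pre suf →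
            (∀ l → l ≢ at x → l ≢ at y → l ≢ stackTape → lookup ts₃ l ≡ lookup ts l) →
            lookup ts₃ k ≡ lookup ts k
    other ts₃ k a b e o with k ≟ at x
    ... | yes refl = trans e (sym ax)
    ... | no k≢x   = o k k≢x a b
    bound : ∀ (a σ : W) {n} → length a ≤ n → length pre ≤ n → length σ ≤ n →
            length a * 3 + 4 + (length pre * 3 + 4 + (length σ * 4 + 4)) ≤ n * 10 + 12
    bound a σ {n} a≤ p≤ σ≤ = ≤-trans
      (+-mono-≤ (+-monoˡ-≤ 4 (*-monoˡ-≤ 3 a≤)) (+-mono-≤ (+-monoˡ-≤ 4 (*-monoˡ-≤ 3 p≤)) (+-monoˡ-≤ 4 (*-monoˡ-≤ 4 σ≤))))
      (≤-reflexive (arith n))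
      where
      arith : ∀ n → n * 3 + 4 + (n * 3 + 4 + (n * 4 + 4)) ≡ n * 10 + 12
      arith = solve-∀

-- Costs, position terms, and elementary tests

module Computations where

  open import Data.Fin using (Fin; suc; _≟_; toℕ)
  open import Data.Nat.Properties hiding (_≟_)
  open import Data.Vec using ([]; _∷_; lookup)

  open Machines
  open Tapes

  infixl 6 _⊞_
  infixl 7 _⊠_

  -- Time bounds are kept as syntax so that the coefficients of a polynomial can be computed from
  -- them.
  data Cost : Set where
    con     : ℕ → Cost
    size    : Cost
    _⊞_ _⊠_ : Cost → Cost → Cost

  eval : Cost → ℕ → ℕ
  eval (con k) n = k
  eval size    n = n
  eval (c ⊞ d) n = eval c n + eval d n
  eval (c ⊠ d) n = eval c n * eval d n

  -- There are `n + 1` rows, one for each position of the input, and each has `n + 1` entries and a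
  -- closing `endName`.
  tableSize : Cost
  tableSize = (con 1 ⊞ size) ⊠ (con 2 ⊞ size)

  seekFrom : (Symbol → Bool) → W → W → Zip
  seekFrom q pre []        = pre , []
  seekFrom q pre (c ∷ suf) = if q c then (pre , c ∷ suf) else seekFrom q (c ∷ pre) suf

  seek : (Symbol → Bool) → Zip → Zip
  seek q (pre , suf) = seekFrom q pre suf

  next : Zip → Zip
  next (pre , [])      = pre , []
  next (pre , c ∷ suf) = c ∷ pre , suf

  word-seek : ∀ q pre suf → word (seek q (pre , suf)) ≡ pre ʳ++ suf
  word-seek q pre []        = refl
  word-seek q pre (c ∷ suf) with q c
  ... | true  = refl
  ... | false = word-seek q (c ∷ pre) suf

  word-next : ∀ z → word (next z) ≡ word z
  word-next (pre , [])    = refl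
  word-next (pre , _ ∷ _) = refl

  tapeOf : Zip → Tape Cell
  tapeOf (pre , suf) = zipTape pre suf

  seekStep : (Symbol → Bool) → Cell → Bool × Action
  seekStep q nothing  = false , (nothing , stay)
  seekStep q (just c) = if q c then (false , (just c , stay)) else (true , (just c , right))

  seekP : Fin t → (Symbol → Bool) → Prog
  seekP j q = ite (loop (on j (seekStep q))) (fail j) (pass j)

  advanceStep : Cell → Bool × Action
  advanceStep nothing  = true , (nothing , stay)
  advanceStep (just c) = true , (just c , right)

  advance : Fin t → Prog
  advance j = on j advanceStep

  advance-run : ∀ {j} z {ts} → lookup ts j ≡ tapeOf z →
                ∃[ ts′ ] Exec (advance j) ts 1 true ts′ × lookup ts′ j ≡ tapeOf (next z) × Same j ts ts′
  advance-run {j} (pre , [])      e = on-run {j} {advanceStep} e refl refl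
  advance-run {j} (pre , c ∷ suf) e = on-run {j} {advanceStep} e refl refl

  seek-run : ∀ {j} q pre suf {ts} → lookup ts j ≡ zipTape pre suf →
             ∃[ ts′ ] Exec (seekP j q) ts (length suf + 2) true ts′
                      × lookup ts′ j ≡ tapeOf (seek q (pre , suf)) × Same j ts ts′
  seek-run {j} q pre suf {ts} e =
    case steps pre suf ts e of λ { (ts₁ , x , e₁ , same) →
    case test-run {j} (const true) e₁ of λ { (ts₂ , y , same₂) →
    ts₂ , weaken (≤-reflexive (+-assoc (length suf) 1 1)) (else′ x y) , trans (same₂ j) e₁ ,
       λ l a → trans (same₂ l) (same l a) } }
    where
    steps : ∀ pre suf ts → lookup ts j ≡ zipTape pre suf →
            ∃[ ts′ ] Exec (loop (on j (seekStep q))) ts (length suf + 1) false ts′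
                     × lookup ts′ j ≡ tapeOf (seek q (pre , suf)) × Same j ts ts′
    steps pre [] ts e =
      case on-run {j} {seekStep q} e refl refl of λ { (ts₁ , x , e₁ , same) →
      ts₁ , leave x , e₁ , same }
    steps pre (c ∷ suf) ts e with q c in eq
    ... | true  =
      case on-run {j} {seekStep q} e (cong (if_then (false , (just c , stay)) else (true , (just c , right))) eq) refl of λ { (ts₁ , x , e₁ , same) →
      ts₁ , weaken (s≤s z≤n) (leave x) , e₁ , same }
    ... | false =
      case on-run {j} {seekStep q} e (cong (if_then (false , (just c , stay)) else (true , (just c , right))) eq) refl of λ { (ts₁ , x , e₁ , same) →
      case steps (c ∷ pre) suf ts₁ e₁ of λ { (ts₂ , y , e₂ , same₂) →
      ts₂ , again x y , e₂ , λ l a → trans (same₂ l a) (same l a) } }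

  isDigit : Symbol → Bool
  isDigit one = true
  isDigit two = true
  isDigit _   = false

  -- The names after a tag are addressed by paths of moves starting at the tag, instead of by
  -- variables of their own; this keeps the number of tapes small.
  data Mv : Set where
    nxt fnd : Mv

  move : Mv → Zip → Zip
  move nxt = next
  move fnd = seek (not ∘ isDigit)

  nav : List Mv → Zip → Zip
  nav []       z = z
  nav (m ∷ ms) z = nav ms (move m z)

  word-move : ∀ m z → word (move m z) ≡ word z
  word-move nxt z           = word-next z
  word-move fnd (pre , suf) = word-seek _ pre suf

  word-nav : ∀ ms z → word (nav ms z) ≡ word z
  word-nav []       z = refl
  word-nav (m ∷ ms) z = trans (word-nav ms (move m z)) (word-move m z)

  moveP : Fin t → Mv → Prog
  moveP j nxt = advance j
  moveP j fnd = seekP j (not ∘ isDigit)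

  move-run : ∀ {j w} m z {ts} → lookup ts j ≡ tapeOf z → word z ≡ w →
             ∃[ ts′ ] Exec (moveP j m) ts (length w + 2) true ts′
                      × lookup ts′ j ≡ tapeOf (move m z) × Same j ts ts′
  move-run nxt z e _ =
    case advance-run z e of λ { (ts₁ , x , r) →
    ts₁ , weaken (≤-trans (s≤s z≤n) (m≤n+m 2 _)) x , r }
  move-run fnd (pre , suf) e refl =
    case seek-run _ pre suf e of λ { (ts₁ , x , r) →
    ts₁ , weaken (+-monoˡ-≤ 2 (suf≤word pre suf refl)) x , r }

  navP : Fin t → List Mv → Prog
  navP j []       = pass j
  navP j (m ∷ ms) = ite (moveP j m) (navP j ms) (fail j)

  navCost : List Mv → Cost
  navCost []       = con 1
  navCost (_ ∷ ms) = (size ⊞ con 2) ⊞ navCost ms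

  nav-run : ∀ {j w} ms z {ts} → lookup ts j ≡ tapeOf z → word z ≡ w →
            ∃[ ts′ ] Exec (navP j ms) ts (eval (navCost ms) (length w)) true ts′
                     × lookup ts′ j ≡ tapeOf (nav ms z) × Same j ts ts′
  nav-run {j} [] z e _ =
    case test-run {j} (const true) e of λ { (ts₁ , x , same) →
    ts₁ , x , trans (same j) e , λ l _ → same l }
  nav-run (m ∷ ms) z e wz =
    case move-run m z e wz of λ { (ts₁ , x , e₁ , same₁) →
    case nav-run ms (move m z) e₁ (trans (word-move m z) wz) of λ { (ts₂ , y , e₂ , same₂) →
    ts₂ , then′ x y , e₂ , λ l a → trans (same₂ l a) (same₁ l a) } }

  Env : Set
  Env = Fin 5 → Zip

  infixl 5 _[_↦_]

  _[_↦_] : Env → Fin 5 → Zip → Env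
  (env [ j ↦ z ]) i = if does (i ≟ j) then z else env i

  infix 4 _·_

  data Term (k : ℕ) : Set where
    _·_ : (i : Fin 5) {_ : True (suc (toℕ i) ≤? k)} → List Mv → Term k

  value : ∀ {k} → Term k → Env → Zip
  value (i · ms) env = nav ms (env i)

  -- What holds between subprograms. Every place, even a scratch one, carries the input at some
  -- position, so that it can be rewound and reused. The component `small` bounds every walk over
  -- the table.
  record Inv (w tw : W) (ts : Tapes) : Set where
    constructor inv-of
    field
      places : ∀ x → ∃[ z ] word z ≡ w × lookup ts (at x) ≡ tapeOf z
      table  : lookup ts tableTape ≡ zipTape [] tw
      stack  : ∃[ s ] lookup ts stackTape ≡ zipTape [] s
      small  : length tw ≤ eval tableSize (length w)

  open Inv

  record Rep (k : ℕ) (w : W) (env : Env) (ts : Tapes) : Set where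
    constructor rep-of
    field
      entry-word : ∀ i → toℕ i < k → word (env i) ≡ w
      entry-tape : ∀ i → toℕ i < k → lookup ts (at (var i)) ≡ tapeOf (env i)

  open Rep

  record Kept (k : ℕ) (ts ts′ : Tapes) : Set where
    constructor kept-of
    field
      entry-kept : ∀ i → toℕ i < k → lookup ts′ (at (var i)) ≡ lookup ts (at (var i))

  open Kept

  Kept-trans : ∀ {k ts ts′ ts″} → Kept k ts ts′ → Kept k ts′ ts″ → Kept k ts ts″
  Kept-trans p q = kept-of λ i i<k → trans (entry-kept q i i<k) (entry-kept p i i<k)

  Rep-kept : ∀ {k w env ts ts′} → Rep k w env ts → Kept k ts ts′ → Rep k w env ts′
  Rep-kept rep kept = rep-of (entry-word rep) λ i i<k → trans (entry-kept kept i i<k) (entry-tape rep i i<k)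

  record SameBut (x : Place) (ts ts′ : Tapes) : Set where
    constructor same-but
    field
      same : ∀ l → l ≢ at x → l ≢ stackTape → lookup ts′ l ≡ lookup ts l

  open SameBut

  Inv-place : ∀ {w tw ts ts′} x z → Inv w tw ts → lookup ts′ (at x) ≡ tapeOf z → word z ≡ w →
              ∃[ s ] lookup ts′ stackTape ≡ zipTape [] s → SameBut x ts ts′ → Inv w tw ts′
  Inv-place {w} {tw} {ts} {ts′} x z I e wz stk (same-but same) = record
    { places = pl
    ; table  = trans (same _ (λ q → at≢table x (sym q)) (λ ())) (table I)
    ; stack  = stk
    ; small  = small I }
    where
    pl : ∀ y → ∃[ z ] word z ≡ w × lookup ts′ (at y) ≡ tapeOf z
    pl y with at y ≟ at x
    ... | yes q = z , wz , trans (cong (lookup ts′) q) e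
    ... | no q  = case places I y of λ { (z′ , wz′ , e′) →
                  z′ , wz′ , trans (same _ q (at≢stack y)) e′ }

  Inv-same : ∀ {w tw} ts ts′ x z → Inv w tw ts → lookup ts′ (at x) ≡ tapeOf z → word z ≡ w →
             Same (at x) ts ts′ → Inv w tw ts′
  Inv-same ts ts′ x z I e wz same =
    Inv-place x z I e wz (proj₁ (stack I) , trans (same _ (λ q → at≢stack x (sym q))) (proj₂ (stack I)))
              (same-but λ l a _ → same l a)

  Inv-all : ∀ {w tw} ts ts′ → Inv w tw ts → (∀ l → lookup ts′ l ≡ lookup ts l) → Inv w tw ts′
  Inv-all ts ts′ I same = record
    { places = λ x → case places I x of λ { (z , wz , e) →
                     z , wz , trans (same _) e }
    ; table  = trans (same _) (table I)
    ; stack  = proj₁ (stack I) , trans (same _) (proj₂ (stack I))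
    ; small  = small I }

  Fresh : ℕ → Place → Set
  Fresh k x = ∀ i → toℕ i < k → x ≢ var i

  kept-but : ∀ {k} x {ts ts′} → Fresh k x → SameBut x ts ts′ → Kept k ts ts′
  kept-but x fr s = kept-of λ i i<k → same s _ (λ q → fr i i<k (sym (at-injective q))) (at≢stack (var i))

  load : ∀ {k} → Place → Term k → Prog
  load x (i · ms) = ite (copy x (var i)) (navP (at x) ms) (fail (at x))

  loadCost : ∀ {k} → Term k → Cost
  loadCost (i · ms) = (size ⊠ con 10 ⊞ con 12) ⊞ navCost ms

  word-value : ∀ {k w env ts} (u : Term k) → Rep k w env ts → word (value u env) ≡ w
  word-value (_·_ i {p} ms) rep = trans (word-nav ms _) (entry-word rep i (toWitness p))

  load-run : ∀ {k x w tw env ts} (u : Term k) → Fresh k x → Inv w tw ts → Rep k w env ts →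
             ∃[ ts′ ] Exec (load x u) ts (eval (loadCost u) (length w)) true ts′
                      × Inv w tw ts′ × lookup ts′ (at x) ≡ tapeOf (value u env) × SameBut x ts ts′
  load-run {k} {x} {w} {tw} {env} {ts} u@(_·_ i {p} ms) fr I rep =
    let wi = entry-word rep i (toWitness p) in
    case places I x of λ { (z , wz , e) →
    case copy-run {var i} {x} (fr i (toWitness p)) (entry-tape rep i (toWitness p)) wi e wz (proj₂ (stack I)) of λ { (ts₁ , c₁ , e₁ , stk , same₁) →
    case nav-run {at x} ms (env i) e₁ wi of λ { (ts₂ , c₂ , e₂ , same₂) →
    let same : SameBut x ts ts₂
        same = same-but λ l a b → trans (same₂ l a) (same₁ l a b) in
    ts₂ , then′ c₁ c₂ ,
       Inv-place x (value u env) I e₂ (word-value u rep)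
         (proj₁ stk , trans (same₂ _ (λ q → at≢stack x (sym q))) (proj₂ stk)) same ,
       e₂ , same } } }

  -- A program for f, which may change the table; the variables below k keep
  -- their positions.
  record Comp (k : ℕ) (f : Env → W → Bool × W) : Set where
    field
      prog : Prog
      cost : Cost
      spec : ∀ {w tw env ts} → Inv w tw ts → Rep k w env ts →
             ∃[ ts′ ] Exec prog ts (eval cost (length w)) (proj₁ (f env tw)) ts′
                      × Inv w (proj₂ (f env tw)) ts′ × Kept k ts ts′

  open Comp

  Test : ℕ → (Env → W → Bool) → Set
  Test k p = Comp k (λ env tw → p env tw , tw)

  reindex : ∀ {k f g} → (∀ env tw → f env tw ≡ g env tw) → Comp k f → Comp k g
  reindex {k} {f} {g} f≗g c = record
    { prog = prog c ; cost = cost c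
    ; spec = λ {w} {tw} {env} {ts} I rep →
        subst (λ r → ∃[ ts′ ] Exec (prog c) ts (eval (cost c) (length w)) (proj₁ r) ts′
                              × Inv w (proj₂ r) ts′ × Kept k ts ts′)
              (f≗g env tw) (spec c I rep) }

  fresh₁ : ∀ {k} → Fresh k scratch₁
  fresh₁ _ _ ()

  fresh₂ : ∀ {k} → Fresh k scratch₂
  fresh₂ _ _ ()

  peek : (Symbol → Bool) → Bool → Zip → Bool
  peek q d (_ , [])    = d
  peek q d (_ , c ∷ _) = q c

  peekCell : (Symbol → Bool) → Bool → Cell → Bool
  peekCell q d nothing  = d
  peekCell q d (just c) = q c

  peekCell-head : ∀ q d z → peekCell q d (Tape.head (tapeOf z)) ≡ peek q d z
  peekCell-head q d (_ , [])    = refl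
  peekCell-head q d (_ , _ ∷ _) = refl

  label : ∀ {k} (q : Symbol → Bool) (d : Bool) (u : Term k) → Test k (λ env _ → peek q d (value u env))
  label q d u = record
    { prog = ite (load scratch₁ u) (test (at scratch₁) (peekCell q d)) (fail (at scratch₁))
    ; cost = loadCost u ⊞ con 1
    ; spec = λ {_} {_} {env} I rep →
        case load-run u fresh₁ I rep of λ { (ts₁ , c₁ , I₁ , e₁ , same₁) →
        case test-run {at scratch₁} (peekCell q d) e₁ of λ { (ts₂ , c₂ , same₂) →
        ts₂ , then′ c₁ (subst (λ b → Exec (test (at scratch₁) (peekCell q d)) ts₁ 1 b ts₂) (peekCell-head q d (value u env)) c₂) ,
           Inv-all ts₁ ts₂ I₁ same₂ , Kept-trans (kept-but scratch₁ fresh₁ same₁) (kept-of λ _ _ → same₂ _) } }}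

  bothDigit bothEnd : Symbol → Symbol → Bool
  bothDigit one one = true
  bothDigit two two = true
  bothDigit _   _   = false
  bothEnd endName endName = true
  bothEnd _       _       = false

  sameName : W → W → Bool
  sameName (c ∷ s) (d ∷ s′) = if bothDigit c d then sameName s s′ else bothEnd c d
  sameName _       _        = false

  cellBoth : (Symbol → Symbol → Bool) → Cell → Cell → Bool
  cellBoth q (just c) (just d) = q c d
  cellBoth q _        _        = false

  digitStep : Cell → Cell → Bool × Action
  digitStep g h = if cellBoth bothDigit g h then (true , (g , right)) else (false , (g , stay))

  endStep : Cell → Cell → Bool × Action
  endStep g h = cellBoth bothEnd g h , (g , stay)

  pairOp : (Cell → Cell → Bool × Action) → Prog
  pairOp f = op (at scratch₁) (λ hs → f (lookup hs (at scratch₁)) (lookup hs (at scratch₂)))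

  pairOp-run : ∀ f {ts X Y b a Z} → lookup ts (at scratch₁) ≡ X → lookup ts (at scratch₂) ≡ Y →
               f (Tape.head X) (Tape.head Y) ≡ (b , a) → apply a X ≡ Z →
               ∃[ ts′ ] Exec (pairOp f) ts 1 b ts′ × lookup ts′ (at scratch₁) ≡ Z × Same (at scratch₁) ts ts′
  pairOp-run f {ts} refl refl e e′ =
    op-run {at scratch₁} {λ hs → f (lookup hs (at scratch₁)) (lookup hs (at scratch₂))} {ts}
      (trans (cong₂ f (lookup-map (at scratch₁) Tape.head ts) (lookup-map (at scratch₂) Tape.head ts)) e) e′

  compareLoop compare : Prog
  compareLoop = loop (ite (pairOp digitStep) (goRight (at scratch₂)) (fail (at scratch₁)))
  compare     = ite compareLoop (fail (at scratch₁)) (pairOp endStep)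

  Compared : W → W → Tapes → Prog → ℕ → Bool → Set
  Compared w tw ts p k b =
    ∃[ ts′ ] Exec p ts k b ts′ × Inv w tw ts′
             × (∀ l → l ≢ at scratch₁ → l ≢ at scratch₂ → lookup ts′ l ≡ lookup ts l)

  -- An induction over the rounds speaks about the loop together with what follows it, while a
  -- further round has to be inserted inside the loop. Inverting the execution makes room for it.
  prepend : ∀ {p q r ts ts′ ts″ n b m} → Exec p ts m true ts′ →
            Exec (ite (loop p) q r) ts′ n b ts″ → Exec (ite (loop p) q r) ts (m + n) b ts″
  prepend {m = m} x (then′ {k = k} {l = l} y z) = weaken (≤-reflexive (+-assoc m k l)) (then′ (again x y) z)
  prepend {m = m} x (else′ {k = k} {l = l} y z) = weaken (≤-reflexive (+-assoc m k l)) (else′ (again x y) z)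
  prepend {m = m} x (weaken k≤l y) = weaken (+-monoʳ-≤ m k≤l) (prepend x y)

  compare-stop : ∀ {w tw ts} pre suf pre′ suf′ → Inv w tw ts →
    lookup ts (at scratch₁) ≡ zipTape pre suf → pre ʳ++ suf ≡ w →
    lookup ts (at scratch₂) ≡ zipTape pre′ suf′ → ∀ {r} →
    cellBoth bothDigit (Tape.head (zipTape pre suf)) (Tape.head (zipTape pre′ suf′)) ≡ false →
    cellBoth bothEnd (Tape.head (zipTape pre suf)) (Tape.head (zipTape pre′ suf′)) ≡ r →
    Compared w tw ts compare 3 r
  compare-stop {w} {tw} {ts} pre suf pre′ suf′ I e wz e′ {r} d≡ b≡ =
    let g = Tape.head (zipTape pre suf) in
    case pairOp-run digitStep e e′
          (cong (if_then (true , (g , right)) else (false , (g , stay))) d≡) (apply-stay (zipTape pre suf)) of λ { (ts₁ , x , e₁ , same₁) →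
    let I₁ = Inv-same ts ts₁ scratch₁ (pre , suf) I e₁ wz same₁ in
    case test-run {at scratch₁} (const false) e₁ of λ { (ts₂ , y , same₂) →
    let e₂ = trans (same₂ (at scratch₁)) e₁
        e₂′ = trans (same₂ (at scratch₂)) (trans (same₁ (at scratch₂) (λ ())) e′) in
    case pairOp-run endStep e₂ e₂′ (cong (_, (g , stay)) b≡) (apply-stay (zipTape pre suf)) of λ { (ts₃ , z , e₃ , same₃) →
    ts₃ , else′ (leave (else′ x y)) z ,
       Inv-same ts₂ ts₃ scratch₁ (pre , suf) (Inv-all ts₁ ts₂ I₁ same₂) e₃ wz same₃ ,
       λ l a b → trans (same₃ l a) (trans (same₂ l) (same₁ l a)) } } }

  -- A common digit costs one step on each scratch tape. The final `3` is the failed comparison of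
  -- digits, the failure that leaves the loop, and the comparison with `endName`. The heads may rest
  -- where they stop, as `Inv` admits any position.
  compare-run : ∀ {w tw} pre suf pre′ suf′ {ts} → Inv w tw ts →
    lookup ts (at scratch₁) ≡ zipTape pre suf → pre ʳ++ suf ≡ w →
    lookup ts (at scratch₂) ≡ zipTape pre′ suf′ → pre′ ʳ++ suf′ ≡ w →
    Compared w tw ts compare (length suf * 2 + 3) (sameName suf suf′)
  compare-run pre []      pre′ suf′   I e wz e′ wz′ = compare-stop pre [] pre′ suf′ I e wz e′ refl refl
  compare-run pre (c ∷ s) pre′ []     I e wz e′ wz′ =
    case compare-stop pre (c ∷ s) pre′ [] I e wz e′ refl refl of λ { (ts′ , x , r) →
    ts′ , weaken (m≤n+m 3 (length (c ∷ s) * 2)) x , r }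
  compare-run pre (c ∷ s) pre′ (d ∷ s′) {ts} I e wz e′ wz′ with bothDigit c d in eq
  ... | false =
    case compare-stop pre (c ∷ s) pre′ (d ∷ s′) I e wz e′ eq refl of λ { (ts′ , x , r) →
    ts′ , weaken (m≤n+m 3 (length (c ∷ s) * 2)) x , r }
  ... | true =
    case pairOp-run digitStep e e′
          (cong (if_then (true , (just c , right)) else (false , (just c , stay))) eq) refl of λ { (ts₁ , x , e₁ , same₁) →
    let I₁ = Inv-same ts ts₁ scratch₁ (c ∷ pre , s) I e₁ wz same₁ in
    case on-run {at scratch₂} {λ g → true , (g , right)}
                                      (trans (same₁ (at scratch₂) (λ ())) e′) refl refl of λ { (ts₂ , y , e₂ , same₂) →
    let I₂ = Inv-same ts₁ ts₂ scratch₂ (d ∷ pre′ , s′) I₁ e₂ wz′ same₂ in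
    case compare-run (c ∷ pre) s (d ∷ pre′) s′ I₂
                                 (trans (same₂ (at scratch₁) (λ ())) e₁) wz e₂ wz′ of λ { (ts₃ , z , I₃ , same₃) →
    ts₃ , prepend (then′ x y) z , I₃ ,
       λ l a b → trans (same₃ l a b) (trans (same₂ l b) (same₁ l a)) } } }

  eqName : ∀ {k} (u v : Term k) → Test k (λ env _ → sameName (proj₂ (value u env)) (proj₂ (value v env)))
  eqName u v = record
    { prog = ite (load scratch₁ u) (ite (load scratch₂ v) compare (fail (at scratch₁))) (fail (at scratch₁))
    ; cost = loadCost u ⊞ (loadCost v ⊞ (size ⊠ con 2 ⊞ con 3))
    ; spec = λ {w} {_} {env} I rep →
        case load-run u fresh₁ I rep of λ { (ts₁ , c₁ , I₁ , e₁ , same₁) →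
        let kept₁ = kept-but scratch₁ fresh₁ same₁ in
        case load-run v fresh₂ I₁ (Rep-kept rep kept₁) of λ { (ts₂ , c₂ , I₂ , e₂ , same₂) →
        let kept₂ = kept-but scratch₂ fresh₂ same₂
            (pre , suf) = value u env in
        case compare-run pre suf (proj₁ (value v env)) (proj₂ (value v env)) I₂
                  (trans (same same₂ _ (λ ()) (λ ())) e₁) (word-value u rep) e₂ (word-value v rep) of λ { (ts₃ , c₃ , I₃ , same₃) →
        ts₃ , then′ c₁ (then′ c₂ (weaken (+-monoˡ-≤ 3 (*-monoˡ-≤ 2 (suf≤word pre suf (cong length (word-value u rep))))) c₃)) ,
           I₃ , Kept-trans kept₁ (Kept-trans kept₂ (kept-of λ _ _ → same₃ _ (λ ()) (λ ()))) } } }}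

-- Access to the table, branching, and bounded search

module Searching where

  open import Data.Fin using (Fin; zero; suc; _≟_; toℕ)
  open import Data.Nat.Properties hiding (_≟_)
  open import Data.Vec using ([]; _∷_; lookup)

  open Machines
  open Tapes
  open Computations

  open Inv
  open Rep
  open Kept
  open SameBut
  open Comp

  isEnd isTwo : Symbol → Bool
  isEnd endName = true
  isEnd _       = false
  isTwo two = true
  isTwo _   = false

  iter : (Zip → Zip) → ℕ → Zip → Zip
  iter f zero    z = z
  iter f (suc k) z = iter f k (f z)

  word-iter : ∀ f → (∀ z → word (f z) ≡ word z) → ∀ k z → word (iter f k z) ≡ word z
  word-iter f h zero    z = refl
  word-iter f h (suc k) z = trans (word-iter f h k (f z)) (h z)

  rowSkip : Zip → Zip
  rowSkip z = next (seek isEnd z)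

  word-rowSkip : ∀ z → word (rowSkip z) ≡ word z
  word-rowSkip (pre , suf) = trans (word-next (seek isEnd (pre , suf))) (word-seek isEnd pre suf)

  rowSkipP : Prog
  rowSkipP = ite (seekP tableTape isEnd) (advance tableTape) (fail tableTape)

  rowSkip-run : ∀ {n} z {ts} → lookup ts tableTape ≡ tapeOf z → length (word z) ≤ n →
                ∃[ ts′ ] Exec rowSkipP ts (n + 3) true ts′
                         × lookup ts′ tableTape ≡ tapeOf (rowSkip z) × Same tableTape ts ts′
  rowSkip-run {n} (pre , suf) e b =
    case seek-run isEnd pre suf e of λ { (ts₁ , x , e₁ , same₁) →
    case advance-run (seek isEnd (pre , suf)) e₁ of λ { (ts₂ , y , e₂ , same₂) →
    ts₂ , weaken (≤-trans (≤-reflexive (+-assoc (length suf) 2 1)) (+-monoˡ-≤ 3 (≤-trans (suf≤word pre suf refl) b)))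
                    (then′ x y) ,
       e₂ , λ l a → trans (same₂ l a) (same₁ l a) } }

  module _ (f : Zip → Zip) (body : Prog) (cb n : ℕ) (word-f : ∀ z → word (f z) ≡ word z)
    (f-run : ∀ z {ts} → lookup ts tableTape ≡ tapeOf z → length (word z) ≤ n →
             ∃[ ts′ ] Exec body ts cb true ts′ × lookup ts′ tableTape ≡ tapeOf (f z) × Same tableTape ts ts′)
    where

    -- Rewinding `x` serves as a unary counter: its body runs once per symbol before the position,
    -- so the table head makes as many `f`-moves as the index of the position.
    steer-run : ∀ x {pre suf z ts} → lookup ts (at x) ≡ zipTape pre suf →
                lookup ts tableTape ≡ tapeOf z → length (word z) ≤ n →
                ∃[ ts′ ] Exec (walk (at x) body) ts (length pre * (2 + cb) + 4) true ts′
                         × lookup ts′ (at x) ≡ zipTape [] (pre ʳ++ suf)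
                         × lookup ts′ tableTape ≡ tapeOf (iter f (length pre) z)
                         × (∀ l → l ≢ at x → l ≢ tableTape → lookup ts′ l ≡ lookup ts l)
    steer-run x {pre} {suf} {z} {ts} e et b =
      case walk-run {at x} {body} {cb} Φ
              (λ { _ _ same (z′ , et′ , i , b′ , o) →
                   z′ , trans (same _ (λ q → at≢table x (sym q))) et′ , i , b′ ,
                   λ l a b → trans (same l a) (o l a b) })
              (λ { c p s ts₁ e₁ (z′ , et′ , i , b′ , o) →
                   case f-run z′ et′ b′ of λ { (ts₂ , q , e₂ , same) →
                   ts₂ , q , trans (same _ (at≢table x)) e₁ ,
                      f z′ , e₂ , i , ≤-trans (≤-reflexive (cong length (word-f z′))) b′ ,
                      λ l a b → trans (same l b) (o l a b) }})
              pre suf ts e (z , et , refl , b , λ _ _ _ → refl) of λ { (ts′ , p , e′ , (z′ , et′ , i , b′ , o)) →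
      ts′ , p , e′ , trans et′ (cong tapeOf i) , o }
      where
      Φ : W → W → Tapes → Set
      Φ p _ ts′ = ∃[ z′ ] lookup ts′ tableTape ≡ tapeOf z′ × iter f (length p) z′ ≡ iter f (length pre) z
                    × length (word z′) ≤ n
                    × (∀ l → l ≢ at x → l ≢ tableTape → lookup ts′ l ≡ lookup ts l)

  -- The table is a sequence of rows, each closed by endName; the rows and the
  -- entries of a row are indexed by positions in the input.
  locate : Zip → Zip → W → Zip
  locate x y tw = iter next (length (proj₁ y)) (iter rowSkip (length (proj₁ x)) ([] , tw))

  word-locate : ∀ x y tw → word (locate x y tw) ≡ tw
  word-locate x y tw =
    trans (word-iter next word-next (length (proj₁ y)) _) (word-iter rowSkip word-rowSkip (length (proj₁ x)) _)

  locateP : ∀ {k} → Term k → Term k → Prog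
  locateP u v = ite (load scratch₁ u)
                    (ite (load scratch₂ v)
                         (ite (walk (at scratch₁) rowSkipP) (walk (at scratch₂) (advance tableTape)) (fail tableTape))
                         (fail tableTape))
                    (fail tableTape)

  locateCost : ∀ {k} → Term k → Term k → Cost
  -- A symbol of a walk costs 2 besides its body; the bodies cost `tableSize + 3` for skipping a row
  -- and 1 for skipping an entry.
  locateCost u v = loadCost u ⊞ (loadCost v ⊞ ((size ⊠ (con 5 ⊞ tableSize) ⊞ con 4) ⊞ (size ⊠ con 3 ⊞ con 4)))

  -- The variant of `Inv` in which the table head is parked on an entry; `return-run` leads back to
  -- `Inv`.
  record Located (k : ℕ) (w : W) (z : Zip) (ts ts′ : Tapes) : Set where
    field
      places : ∀ x → ∃[ z ] word z ≡ w × lookup ts′ (at x) ≡ tapeOf z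
      stack  : ∃[ s ] lookup ts′ stackTape ≡ zipTape [] s
      table  : lookup ts′ tableTape ≡ tapeOf z
      small  : length (word z) ≤ eval tableSize (length w)
      kept   : Kept k ts ts′

  locate-run : ∀ {k w tw env ts} (u v : Term k) → Inv w tw ts → Rep k w env ts →
               ∃[ ts′ ] Exec (locateP u v) ts (eval (locateCost u v) (length w)) true ts′
                        × Located k w (locate (value u env) (value v env) tw) ts ts′
  locate-run {k} {w} {tw} {env} {ts} u v I rep =
    case load-run u fresh₁ I rep of λ { (ts₁ , c₁ , I₁ , e₁ , same₁) →
    let kept₁ = kept-but scratch₁ fresh₁ same₁ in
    case load-run v fresh₂ I₁ (Rep-kept rep kept₁) of λ { (ts₂ , c₂ , I₂ , e₂ , same₂) →
    let kept₂ = kept-but scratch₂ fresh₂ same₂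
        (pre , suf) = value u env
        (pre′ , suf′) = value v env
        N = eval tableSize (length w)
        z₁ = iter rowSkip (length pre) ([] , tw)
        wz₁ : word z₁ ≡ tw
        wz₁ = word-iter rowSkip word-rowSkip (length pre) _ in
    case steer-run rowSkip rowSkipP (N + 3) N word-rowSkip rowSkip-run scratch₁ {pre} {suf} {[] , tw} {ts₂}
            (trans (same same₂ (at scratch₁) (λ ()) (λ ())) e₁) (table I₂) (small I₂) of λ { (ts₃ , c₃ , e₃ , et₃ , same₃) →
    let e₂′ = trans (same₃ (at scratch₂) (λ ()) (λ ())) e₂ in
    case steer-run next (advance tableTape) 1 N word-next (λ z e _ → advance-run z e)
            scratch₂ {pre′} {suf′} {z₁} {ts₃} e₂′ et₃ (≤-trans (≤-reflexive (cong length wz₁)) (small I₂)) of λ { (ts₄ , c₄ , e₄ , et₄ , same₄) →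
    let wu = word-value u rep
        wv = word-value v rep
        pl : ∀ x → ∃[ z ] word z ≡ w × lookup ts₄ (at x) ≡ tapeOf z
        pl = λ { scratch₁ → ([] , pre ʳ++ suf) , wu , trans (same₄ (at scratch₁) (λ ()) (λ ())) e₃
               ; scratch₂ → ([] , pre′ ʳ++ suf′) , wv , e₄
               ; (var i)  → case places I₂ (var i) of λ { (z , wz , e) →
                            z , wz , trans (same₄ (at (var i)) (λ ()) (λ ())) (trans (same₃ (at (var i)) (λ ()) (λ ())) e) }} in
    ts₄ ,
       then′ c₁ (then′ c₂ (then′
         (weaken (+-monoˡ-≤ 4 (*-mono-≤ (pre≤word pre suf (cong length wu)) (≤-reflexive (arith N)))) c₃)
         (weaken (+-monoˡ-≤ 4 (*-monoˡ-≤ 3 (pre≤word pre′ suf′ (cong length wv)))) c₄))) ,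
       record
         { places = pl
         ; stack  = proj₁ (stack I₂) , trans (same₄ stackTape (λ ()) (λ ())) (trans (same₃ stackTape (λ ()) (λ ())) (proj₂ (stack I₂)))
         ; table  = et₄
         ; small  = ≤-trans (≤-reflexive (cong length (word-locate (value u env) (value v env) tw))) (small I₂)
         ; kept   = Kept-trans kept₁ (Kept-trans kept₂ (kept-of λ i _ →
                      trans (same₄ (at (var i)) (λ ()) (λ ())) (same₃ (at (var i)) (λ ()) (λ ())))) } } } } }
    where
    arith : ∀ N → 2 + (N + 3) ≡ 5 + N
    arith = solve-∀

  Located-table : ∀ {k w z ts ts′ ts″ z′} → Located k w z ts ts′ → lookup ts″ tableTape ≡ tapeOf z′ →
                  length (word z′) ≡ length (word z) → Same tableTape ts′ ts″ → Located k w z′ ts ts″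
  Located-table L e lz same = record
    { places = λ x → case Located.places L x of λ { (z , wz , e′) →
                     z , wz , trans (same (at x) (at≢table x)) e′ }
    ; stack  = proj₁ (Located.stack L) , trans (same stackTape (λ ())) (proj₂ (Located.stack L))
    ; table  = e
    ; small  = ≤-trans (≤-reflexive lz) (Located.small L)
    ; kept   = Kept-trans (Located.kept L) (kept-of λ i _ → same (at (var i)) (at≢table (var i))) }

  homeCost : Cost
  homeCost = tableSize ⊠ con 3 ⊞ con 4

  return-run : ∀ {k w z ts ts′} → Located k w z ts ts′ →
               ∃[ ts″ ] Exec (home tableTape) ts′ (eval homeCost (length w)) true ts″
                        × Inv w (word z) ts″ × Kept k ts ts″
  return-run {k} {w} {pre , suf} {ts} {ts′} L =
    case home-run {tableTape} {pre} {suf} (Located.table L) of λ { (ts″ , x , e , same) →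
    let L′ = Located-table {z′ = [] , pre ʳ++ suf} L e refl same in
    ts″ , weaken (+-monoˡ-≤ 4 (*-monoˡ-≤ 3 (≤-trans (pre≤word pre suf refl) (Located.small L)))) x ,
       inv-of (Located.places L′) (Located.table L′) (Located.stack L′) (Located.small L′) , Located.kept L′ }

  getEntry : Zip → Zip → W → Bool
  getEntry x y tw = peek isTwo false (locate x y tw)

  mark : Zip → Zip
  mark (pre , [])      = pre , []
  mark (pre , _ ∷ suf) = pre , one ∷ suf

  clearEntry : Zip → Zip → W → W
  clearEntry x y tw = word (mark (locate x y tw))

  length-mark : ∀ z → length (word (mark z)) ≡ length (word z)
  length-mark (pre , [])      = refl
  length-mark (pre , c ∷ suf) = trans (length-ʳ++ pre) (sym (length-ʳ++ pre))

  -- The answer of the test has to survive the rewinding of the table, and only the control can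
  -- remember it; hence one copy of `home` for each answer.
  lookupEntryP : ∀ {k} → Term k → Term k → Prog
  lookupEntryP u v =
    ite (locateP u v)
        (ite (test tableTape (peekCell isTwo false))
             (ite (home tableTape) (pass tableTape) (pass tableTape))
             (ite (home tableTape) (fail tableTape) (fail tableTape)))
        (fail tableTape)

  lookupEntryCost : ∀ {k} → Term k → Term k → Cost
  lookupEntryCost u v = locateCost u v ⊞ (con 1 ⊞ (homeCost ⊞ con 1))

  lookupEntry-run : ∀ {k w tw env ts} (u v : Term k) → Inv w tw ts → Rep k w env ts →
    ∃[ ts′ ] Exec (lookupEntryP u v) ts (eval (lookupEntryCost u v) (length w)) (getEntry (value u env) (value v env) tw) ts′
             × Inv w tw ts′ × Kept k ts ts′
  lookupEntry-run {k} {w} {tw} {env} {ts} u v I rep =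
    case locate-run u v I rep of λ { (ts₁ , c₁ , L) →
    case test-run {tableTape} (peekCell isTwo false) (Located.table L) of λ { (ts₂ , c₂ , same₂) →
    case return-run (Located-table {z′ = z} L (trans (same₂ tableTape) (Located.table L)) refl (λ l _ → same₂ l)) of λ { (ts₃ , c₃ , I₃ , kept₃) →
    finish (getEntry (value u env) (value v env) tw) c₁
           (subst (λ b → Exec (test tableTape (peekCell isTwo false)) ts₁ 1 b ts₂) (peekCell-head isTwo false z) c₂) c₃
           (subst (λ x → Inv w x ts₃) (word-locate (value u env) (value v env) tw) I₃) kept₃ } } }
    where
    z : Zip
    z = locate (value u env) (value v env) tw
    finish : ∀ {ts₁ ts₂ ts₃} b → Exec (locateP u v) ts (eval (locateCost u v) (length w)) true ts₁ →
             Exec (test tableTape (peekCell isTwo false)) ts₁ 1 b ts₂ →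
             Exec (home tableTape) ts₂ (eval homeCost (length w)) true ts₃ →
             Inv w tw ts₃ → Kept k ts ts₃ →
             ∃[ ts′ ] Exec (lookupEntryP u v) ts (eval (lookupEntryCost u v) (length w)) b ts′ × Inv w tw ts′ × Kept k ts ts′
    finish {ts₃ = ts₃} true c₁ c₂ c₃ I₃ kept₃ =
      case test-run {tableTape} (const true) (table I₃) of λ { (ts₄ , c₄ , same₄) →
      ts₄ , then′ c₁ (then′ c₂ (then′ c₃ c₄)) , Inv-all ts₃ ts₄ I₃ same₄ ,
      Kept-trans kept₃ (kept-of λ _ _ → same₄ _) }
    finish {ts₃ = ts₃} false c₁ c₂ c₃ I₃ kept₃ =
      case test-run {tableTape} (const false) (table I₃) of λ { (ts₄ , c₄ , same₄) →
      ts₄ , then′ c₁ (else′ c₂ (then′ c₃ c₄)) , Inv-all ts₃ ts₄ I₃ same₄ ,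
      Kept-trans kept₃ (kept-of λ _ _ → same₄ _) }

  lookupEntry : ∀ {k} (u v : Term k) → Test k (λ env tw → getEntry (value u env) (value v env) tw)
  lookupEntry u v = record
    { prog = lookupEntryP u v
    ; cost = lookupEntryCost u v
    ; spec = lookupEntry-run u v }

  markStep : Cell → Bool × Action
  markStep nothing  = true , (nothing , stay)
  markStep (just _) = true , (just one , stay)

  mark-run : ∀ z {ts} → lookup ts tableTape ≡ tapeOf z →
             ∃[ ts′ ] Exec (on tableTape markStep) ts 1 true ts′
                      × lookup ts′ tableTape ≡ tapeOf (mark z) × Same tableTape ts ts′
  mark-run (pre , [])    e = on-run {tableTape} {markStep} e refl refl
  mark-run (pre , _ ∷ _) e = on-run {tableTape} {markStep} e refl refl

  clear : ∀ {k} (u v : Term k) → Comp k (λ env tw → true , clearEntry (value u env) (value v env) tw)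
  clear {k} u v = record
    { prog = ite (locateP u v) (ite (on tableTape markStep) (home tableTape) (fail tableTape)) (fail tableTape)
    ; cost = locateCost u v ⊞ (con 1 ⊞ homeCost)
    ; spec = λ {w} {tw} {env} I rep →
        case locate-run u v I rep of λ { (ts₁ , c₁ , L) →
        let z = locate (value u env) (value v env) tw in
        case mark-run z (Located.table L) of λ { (ts₂ , c₂ , e₂ , same₂) →
        case return-run (Located-table {z′ = mark z} L e₂ (length-mark z) same₂) of λ { (ts₃ , c₃ , I₃ , kept₃) →
        ts₃ , then′ c₁ (then′ c₂ c₃) , I₃ , kept₃ } } }}

  -- Adding the costs of both branches bounds either of them and avoids maxima in `Cost`.
  branch : ∀ {k f g h} → Comp k f → Comp k g → Comp k h →
           Comp k (λ env tw → if proj₁ (f env tw) then g env (proj₂ (f env tw)) else h env (proj₂ (f env tw)))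
  branch {k} {f} {g} {h} a b c = record
    { prog = ite (prog a) (prog b) (prog c)
    ; cost = cost a ⊞ (cost b ⊞ cost c)
    ; spec = λ {w} {tw} {env} {ts} I rep →
        case spec a {w} {tw} {env} {ts} I rep of λ { (ts₁ , x , I₁ , kept₁) →
        go I₁ (Rep-kept rep kept₁) kept₁ x }}
    where
    go : ∀ {w tw env ts ts₁} → Inv w (proj₂ (f env tw)) ts₁ → Rep k w env ts₁ → Kept k ts ts₁ →
         Exec (prog a) ts (eval (cost a) (length w)) (proj₁ (f env tw)) ts₁ →
         let r = if proj₁ (f env tw) then g env (proj₂ (f env tw)) else h env (proj₂ (f env tw)) in
         ∃[ ts′ ] Exec (ite (prog a) (prog b) (prog c)) ts (eval (cost a ⊞ (cost b ⊞ cost c)) (length w)) (proj₁ r) ts′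
                  × Inv w (proj₂ r) ts′ × Kept k ts ts′
    go {w} {tw} {env} I rep kept x with f env tw
    ... | true , tw′ =
      case spec b I rep of λ { (ts₂ , y , I₂ , kept₂) →
      ts₂ , then′ x (weaken (m≤m+n _ _) y) , I₂ , Kept-trans kept kept₂ }
    ... | false , tw′ =
      case spec c I rep of λ { (ts₂ , y , I₂ , kept₂) →
      ts₂ , else′ x (weaken (m≤n+m _ (eval (cost b) (length w))) y) , I₂ , Kept-trans kept kept₂ }

  answer : ∀ {k} b → Test k (λ _ _ → b)
  answer b = record
    { prog = test tableTape (const b)
    ; cost = con 1
    ; spec = λ {w} {tw} {env} {ts} I rep →
        case test-run {tableTape} (const b) (table I) of λ { (ts₁ , x , same) →
        ts₁ , x , Inv-all ts ts₁ I same , kept-of λ _ _ → same _ }}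

  -- The table is threaded through because the refinement modifies it in the body; pure tests are
  -- the special case `search-pure`.
  searchFrom : (Symbol → Bool) → W → W → (Zip → W → Bool × W) → W → Bool × W
  searchFrom q pre []        g tw = false , tw
  searchFrom q pre (c ∷ suf) g tw =
    if q c then (false , tw)
    else (if proj₁ (g (pre , c ∷ suf) tw) then (true , proj₂ (g (pre , c ∷ suf) tw))
          else searchFrom q (c ∷ pre) suf g (proj₂ (g (pre , c ∷ suf) tw)))

  search : (Symbol → Bool) → Zip → (Zip → W → Bool × W) → W → Bool × W
  search q (pre , suf) = searchFrom q pre suf

  fresh-var : ∀ j → Fresh (toℕ j) (var j)
  fresh-var j i i<j refl = <-irrefl refl i<j

  Rep-extend : ∀ {w env ts} j z → Rep (toℕ j) w env ts → lookup ts (at (var j)) ≡ tapeOf z → word z ≡ w →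
               Rep (suc (toℕ j)) w (env [ j ↦ z ]) ts
  Rep-extend {w} {env} {ts} j z rep e wz = rep-of (λ i p → proj₁ (both i p)) (λ i p → proj₂ (both i p))
    where
    both : ∀ i → toℕ i < suc (toℕ j) →
           word ((env [ j ↦ z ]) i) ≡ w × lookup ts (at (var i)) ≡ tapeOf ((env [ j ↦ z ]) i)
    both i (s≤s i≤j) with i ≟ j
    ... | yes refl = wz , e
    ... | no i≢j   = let i<j = ≤∧≢⇒< i≤j (i≢j ∘ toℕ-injective) in entry-word rep i i<j , entry-tape rep i i<j

  Kept-pred : ∀ {k ts ts′} → Kept (suc k) ts ts′ → Kept k ts ts′
  Kept-pred kept = kept-of λ i i<k → entry-kept kept i (m<n⇒m<1+n i<k)

  Kept-place : ∀ {ts ts′} j → Same (at (var j)) ts ts′ → Kept (toℕ j) ts ts′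
  Kept-place j same = kept-of λ i i<j → same _ λ q → fresh-var j i i<j (sym (at-injective q))

  module _ (q : Symbol → Bool) (j : Fin 5) {f : Env → W → Bool × W} (body : Comp (suc (toℕ j)) f) where
    private
      x = at (var j)
      k = toℕ j
      go? : Cell → Bool
      go? = peekCell (not ∘ q) false
      round : Prog
      round = ite (test x go?) (ite (prog body) (fail x) (goRight x)) (fail x)
      -- A loop always ends with the answer false, so the outcome is recovered from the tape: the
      -- head rests on a symbol that does not stop the search exactly when a candidate has
      -- succeeded.
      finish : Prog
      finish = ite (loop round) (fail x) (test x go?)

      cB : ℕ → ℕ
      cB n = eval (cost body) n

      Found : W → Env → Tapes → ℕ → Bool × W → Set
      Found w env ts c r = ∃[ ts′ ] Exec finish ts c (proj₁ r) ts′ × Inv w (proj₂ r) ts′ × Kept k ts ts′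

      stop : ∀ {w tw env ts} pre suf → Inv w tw ts → Rep k w env ts →
             lookup ts x ≡ zipTape pre suf → go? (Tape.head (zipTape pre suf)) ≡ false →
             Found w env ts 3 (false , tw)
      stop {w} {tw} {env} {ts} pre suf I rep e h =
        case test-run {x} go? e of λ { (ts₁ , c₁ , same₁) →
        case test-run {x} (const false) (trans (same₁ x) e) of λ { (ts₂ , c₂ , same₂) →
        case test-run {x} go? (trans (same₂ x) (trans (same₁ x) e)) of λ { (ts₃ , c₃ , same₃) →
        let same = λ l → trans (same₃ l) (trans (same₂ l) (same₁ l)) in
        ts₃ , else′ (leave (else′ (subst (λ b → Exec _ ts 1 b ts₁) h c₁) c₂)) (subst (λ b → Exec _ ts₂ 1 b ts₃) h c₃) ,
           Inv-all ts ts₃ I same , kept-of λ _ _ → same _ } } }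

      -- A failing candidate costs its body, the test before it and the move after it. The extra
      -- `cB + 3` pays for a successful candidate: test, body, leaving the loop, final test.
      rounds : ∀ {w tw env ts} pre suf → Inv w tw ts → Rep k w env ts →
               lookup ts x ≡ zipTape pre suf → pre ʳ++ suf ≡ w →
               Found w env ts (length suf * (2 + cB (length w)) + (cB (length w) + 3))
                     (searchFrom q pre suf (λ z → f (env [ j ↦ z ])) tw)
      rounds {w} pre [] I rep e wz =
        case stop pre [] I rep e refl of λ { (ts′ , c , r) →
        ts′ , weaken (m≤n+m 3 _) c , r }
      rounds {w} {tw} {env} {ts} pre (c ∷ suf) I rep e wz with q c in eq
      ... | true =
        case stop pre (c ∷ suf) I rep e (cong not eq) of λ { (ts′ , c′ , r) →
        ts′ , weaken (≤-trans (m≤n+m 3 (cB (length w))) (m≤n+m _ (length (c ∷ suf) * (2 + cB (length w))))) c′ , r }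
      ... | false with test-run {x} go? e
      ...   | ts₁ , c₁ , same₁ with spec body {w} {tw} {env [ j ↦ (pre , c ∷ suf) ]} {ts₁} (Inv-all ts ts₁ I same₁)
                                     (Rep-extend j (pre , c ∷ suf) (Rep-kept rep (kept-of λ _ _ → same₁ _)) (trans (same₁ x) e) wz)
      ...   | ts₂ , c₂ , I₂ , kept₂ = case₂ (f (env [ j ↦ (pre , c ∷ suf) ]) tw) c₂ I₂
        where
        c₁′ : Exec (test x go?) ts 1 true ts₁
        c₁′ = subst (λ b → Exec (test x go?) ts 1 b ts₁) (cong not eq) c₁
        e₂ : lookup ts₂ x ≡ zipTape pre (c ∷ suf)
        e₂ = trans (entry-kept kept₂ j ≤-refl) (trans (same₁ x) e)
        kept₀₂ : Kept k ts ts₂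
        kept₀₂ = Kept-trans (kept-of λ _ _ → same₁ _) (Kept-pred kept₂)
        n = cB (length w)
        case₂ : ∀ r → Exec (prog body) ts₁ n (proj₁ r) ts₂ → Inv w (proj₂ r) ts₂ →
                Found w env ts (length (c ∷ suf) * (2 + n) + (n + 3))
                  (if proj₁ r then (true , proj₂ r)
                   else searchFrom q (c ∷ pre) suf (λ z → f (env [ j ↦ z ])) (proj₂ r))
        case₂ (true , tw′) c₂ I₂ =
          case test-run {x} (const false) e₂ of λ { (ts₃ , c₃ , same₃) →
          case test-run {x} go? (trans (same₃ x) e₂) of λ { (ts₄ , c₄ , same₄) →
          let same = λ l → trans (same₄ l) (same₃ l) in
          ts₄ , weaken (≤-trans (≤-reflexive (arith n)) (m≤n+m (n + 3) (length (c ∷ suf) * (2 + n))))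
                          (else′ (leave (then′ c₁′ (then′ c₂ c₃)))
                                 (subst (λ b → Exec (test x go?) ts₃ 1 b ts₄) (cong not eq) c₄)) ,
             Inv-all ts₂ ts₄ I₂ same , Kept-trans kept₀₂ (kept-of λ _ _ → same _) } }
          where
          arith : ∀ n → 1 + (n + 1) + 1 ≡ n + 3
          arith = solve-∀
        case₂ (false , tw′) c₂ I₂ =
          case on-run {x} {λ g → true , (g , right)} e₂ refl refl of λ { (ts₃ , c₃ , e₃ , same₃) →
          let kept₀₃ = Kept-trans kept₀₂ (Kept-place j same₃) in
          case rounds (c ∷ pre) suf (Inv-same ts₂ ts₃ (var j) (c ∷ pre , suf) I₂ e₃ wz same₃)
                                             (Rep-kept rep kept₀₃) e₃ wz of λ { (ts₄ , c₄ , I₄ , kept₄) →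
          ts₄ , weaken (≤-reflexive (arith n (length suf * (2 + n)))) (prepend (then′ c₁′ (else′ c₂ c₃)) c₄) ,
             I₄ , Kept-trans kept₀₃ kept₄ } }
          where
          arith : ∀ n m → 1 + (n + 1) + (m + (n + 3)) ≡ 2 + n + m + (n + 3)
          arith = solve-∀

    searching : (u : Term (toℕ j)) → Comp (toℕ j) (λ env tw → search q (value u env) (λ z → f (env [ j ↦ z ])) tw)
    searching u = record
      { prog = ite (load (var j) u) finish (fail x)
      ; cost = loadCost u ⊞ (size ⊠ (con 2 ⊞ cost body) ⊞ (cost body ⊞ con 3))
      ; spec = λ {w} {tw} {env} {ts} I rep →
          case load-run u (fresh-var j) I rep of λ { (ts₁ , c₁ , I₁ , e₁ , same₁) →
          let kept₁ = kept-but (var j) (fresh-var j) same₁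
              (pre , suf) = value u env in
          case rounds pre suf I₁ (Rep-kept rep kept₁) e₁ (word-value u rep) of λ { (ts₂ , c₂ , I₂ , kept₂) →
          ts₂ , then′ c₁ (weaken (+-monoˡ-≤ _ (*-monoˡ-≤ (2 + cB (length w)) (suf≤word pre suf (cong length (word-value u rep))))) c₂) ,
             I₂ , Kept-trans kept₁ kept₂ } }}

-- Polynomial bounds and iteration up to a fixpoint

module Deciding where

  open import Data.Fin using (Fin; zero; suc; _≟_)
  open import Data.List.Relation.Unary.Unique.DecPropositional {A = Fin 10} _≟_ using (unique?)
  open import Data.List.Relation.Unary.Unique.Propositional using (Unique)
  open import Data.Nat.Properties hiding (_≟_)
  open import Data.Vec using ([]; _∷_; lookup; replicate)

  open Machines
  open Tapes
  open Computations
  open Searching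

  open Inv
  open Rep
  open Kept
  open SameBut
  open Comp

  plus : List ℕ → List ℕ → List ℕ
  plus []       ds       = ds
  plus (c ∷ cs) []       = c ∷ cs
  plus (c ∷ cs) (d ∷ ds) = c + d ∷ plus cs ds

  scale : ℕ → List ℕ → List ℕ
  scale k = List.map (k *_)

  times : List ℕ → List ℕ → List ℕ
  times []       ds = []
  times (c ∷ cs) ds = plus (scale c ds) (0 ∷ times cs ds)

  plus-eval : ∀ cs ds n → polynomial (plus cs ds) n ≡ polynomial cs n + polynomial ds n
  plus-eval []       ds       n = refl
  plus-eval (c ∷ cs) []       n = sym (+-identityʳ _)
  plus-eval (c ∷ cs) (d ∷ ds) n rewrite plus-eval cs ds n = arith c d n (polynomial cs n) (polynomial ds n)
    where
    arith : ∀ c d n x y → c + d + n * (x + y) ≡ c + n * x + (d + n * y)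
    arith = solve-∀

  scale-eval : ∀ k ds n → polynomial (scale k ds) n ≡ k * polynomial ds n
  scale-eval k []       n = sym (*-zeroʳ k)
  scale-eval k (d ∷ ds) n rewrite scale-eval k ds n = arith k d n (polynomial ds n)
    where
    arith : ∀ k d n x → k * d + n * (k * x) ≡ k * (d + n * x)
    arith = solve-∀

  times-eval : ∀ cs ds n → polynomial (times cs ds) n ≡ polynomial cs n * polynomial ds n
  times-eval []       ds n = refl
  times-eval (c ∷ cs) ds n
    rewrite plus-eval (scale c ds) (0 ∷ times cs ds) n | scale-eval c ds n | times-eval cs ds n =
    arith c n (polynomial cs n) (polynomial ds n)
    where
    arith : ∀ c n x y → c * y + n * (x * y) ≡ (c + n * x) * y
    arith = solve-∀

  coefficients : Cost → List ℕ
  coefficients (con k) = k ∷ []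
  coefficients size    = 0 ∷ 1 ∷ []
  coefficients (c ⊞ d) = plus (coefficients c) (coefficients d)
  coefficients (c ⊠ d) = times (coefficients c) (coefficients d)

  coefficients-eval : ∀ c n → polynomial (coefficients c) n ≡ eval c n
  coefficients-eval (con k) n = trans (cong (k +_) (*-zeroʳ n)) (+-identityʳ k)
  coefficients-eval size    n = arith n
    where
    arith : ∀ n → n * (1 + n * 0) ≡ n
    arith = solve-∀
  coefficients-eval (c ⊞ d) n =
    trans (plus-eval (coefficients c) (coefficients d) n) (cong₂ _+_ (coefficients-eval c n) (coefficients-eval d n))
  coefficients-eval (c ⊠ d) n =
    trans (times-eval (coefficients c) (coefficients d) n) (cong₂ _*_ (coefficients-eval c n) (coefficients-eval d n))

  module _ {k f} (c : Comp k f) (env : Env) (G : W → Set) (μ : W → ℕ)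
    (decrease : ∀ {tw tw′} → G tw → f env tw ≡ (true , tw′) → G tw′ × μ tw′ < μ tw) where

    private
      Repeated : W → W → Tapes → ℕ → Set
      Repeated w tw ts m =
        ∃[ tw* ] ∃[ tw′ ] G tw* × f env tw* ≡ (false , tw′) ×
        (∃[ ts′ ] Exec (loop (prog c)) ts (suc m * eval (cost c) (length w)) false ts′
                  × Inv w tw′ ts′ × Kept k ts ts′)

    -- Since `μ` drops in every successful round, at most `m` rounds answer true, and one more
    -- answers false. The table `tw*` is the one before that last round, so both `G` and the failure
    -- of `f` are known for it.
    repeat-run : ∀ {w tw ts} m → μ tw ≤ m → Inv w tw ts → Rep k w env ts → G tw → Repeated w tw ts m
    continue : ∀ {w tw ts} m r → μ tw ≤ m → Rep k w env ts → G tw → f env tw ≡ r →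
               (∃[ ts′ ] Exec (prog c) ts (eval (cost c) (length w)) (proj₁ r) ts′ × Inv w (proj₂ r) ts′ × Kept k ts ts′) →
               Repeated w tw ts m

    repeat-run {w} {tw} {ts} m μ≤ I rep g = continue m (f env tw) μ≤ rep g refl (spec c I rep)

    continue {w} {tw} m (false , tw′) μ≤ rep g e (ts₁ , x , I₁ , kept₁) =
      tw , tw′ , g , e , ts₁ , weaken (m≤m+n _ (m * eval (cost c) (length w))) (leave x) , I₁ , kept₁
    continue zero (true , tw′) μ≤ rep g e _ = contradiction (≤-trans (proj₂ (decrease g e)) μ≤) λ ()
    continue (suc m) (true , tw′) μ≤ rep g e (ts₁ , x , I₁ , kept₁) =
      case decrease g e of λ { (g′ , μ<) →
      case repeat-run m (≤-pred (≤-trans μ< μ≤)) I₁ (Rep-kept rep kept₁) g′ of λ { (tw* , tw″ , g* , e* , ts₂ , y , I₂ , kept₂) →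
      tw* , tw″ , g* , e* , ts₂ , again x y , I₂ , Kept-trans kept₁ kept₂ } }

  -- Initialisation of the tapes and the complete decider

  blankTape : Tape Cell
  blankTape = tape [] nothing []

  copyStep : Cell → Bool × Action
  copyStep nothing  = false , (nothing , stay)
  copyStep (just c) = true , (just c , right)

  transfer : Fin t → Fin t → Prog
  transfer i j = ite (loop (ite (via i j copyStep) (goRight i) (fail j))) (fail j) (pass j)

  -- The source may or may not have explicit blanks around its word.
  transfer-run : ∀ {i j es es′} → i ≢ j →
    (∀ p → Tape.head (refocus (List.map just p ++ es) es′) ≡ nothing) →
    ∀ p s q {ts} → lookup ts i ≡ refocus (List.map just p ++ es) (List.map just s ++ es′) →
    lookup ts j ≡ zipTape q [] →
    ∃[ ts′ ] Exec (transfer i j) ts (length s * 2 + 3) true ts′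
             × lookup ts′ i ≡ refocus (List.map just (s ʳ++ p) ++ es) es′
             × lookup ts′ j ≡ zipTape (s ʳ++ q) []
             × (∀ l → l ≢ i → l ≢ j → lookup ts′ l ≡ lookup ts l)
  transfer-run {i} {j} {es} {es′} i≢j blank-head p s q {ts} ei ej =
    case steps p s q ts ei ej of λ { (ts₁ , x , ei₁ , ej₁ , o) →
    case test-run {j} (const true) ej₁ of λ { (ts₂ , y , same) →
    ts₂ , weaken (≤-reflexive (+-assoc (length s * 2) 2 1)) (else′ x y) ,
       trans (same i) ei₁ , trans (same j) ej₁ , λ l a b → trans (same l) (o l a b) } }
    where
    steps : ∀ p s q ts → lookup ts i ≡ refocus (List.map just p ++ es) (List.map just s ++ es′) →
      lookup ts j ≡ zipTape q [] →
      ∃[ ts′ ] Exec (loop (ite (via i j copyStep) (goRight i) (fail j))) ts (length s * 2 + 2) false ts′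
               × lookup ts′ i ≡ refocus (List.map just (s ʳ++ p) ++ es) es′
               × lookup ts′ j ≡ zipTape (s ʳ++ q) []
               × (∀ l → l ≢ i → l ≢ j → lookup ts′ l ≡ lookup ts l)
    steps p [] q ts ei ej =
      case via-run {i} {j} {copyStep} {ts} ei ej (cong copyStep (blank-head p)) refl of λ { (ts₁ , x , ej₁ , same₁) →
      case test-run {j} (const false) ej₁ of λ { (ts₂ , y , same₂) →
      ts₂ , leave (else′ x y) , trans (same₂ i) (trans (same₁ i i≢j) ei) , trans (same₂ j) ej₁ ,
         λ l a b → trans (same₂ l) (same₁ l b) } }
    steps p (c ∷ s) q ts ei ej =
      case via-run {i} {j} {copyStep} {ts} ei ej refl refl of λ { (ts₁ , x , ej₁ , same₁) →
      case on-run {i} {λ g → true , (g , right)} (trans (same₁ i i≢j) ei) refl refl of λ { (ts₂ , y , ei₂ , same₂) →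
      case steps (c ∷ p) s (c ∷ q) ts₂ ei₂ (trans (same₂ j (λ e → i≢j (sym e))) ej₁) of λ { (ts₃ , z , ei₃ , ej₃ , o) →
      ts₃ , again (then′ x y) z , ei₃ , ej₃ ,
         λ l a b → trans (o l a b) (trans (same₂ l a) (same₁ l b)) } } }

  fence : Fin t → Prog
  fence j = on j (λ _ → true , (nothing , right))

  fence-run : ∀ {j ts} → lookup ts j ≡ blankTape →
              ∃[ ts′ ] Exec (fence j) ts 1 true ts′ × lookup ts′ j ≡ zipTape [] [] × Same j ts ts′
  fence-run {j} e = on-run {j} {λ _ → true , (nothing , right)} e refl refl

  rev² : (v : W) → (v ʳ++ []) ʳ++ [] ≡ v
  rev² v = reverse-involutive v

  reversed-length : (v : W) → length (v ʳ++ []) ≡ length v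
  reversed-length v = length-reverse v

  input : Fin t
  input = 0F

  -- The input tape lacks the explicit blanks, so its word is transferred once to `scratch₁`, and
  -- all other places are filled from there.
  fillFirst : Prog
  fillFirst = ite (fence (at scratch₁))
                  (ite (transfer input (at scratch₁)) (home (at scratch₁)) (fail input)) (fail input)

  fillFirst-run : ∀ {w ts} → lookup ts input ≡ refocus [] (List.map just w) → lookup ts (at scratch₁) ≡ blankTape →
    ∃[ ts′ ] Exec fillFirst ts (length w * 5 + 8) true ts′ × lookup ts′ (at scratch₁) ≡ zipTape [] w
             × (∀ l → l ≢ input → l ≢ at scratch₁ → lookup ts′ l ≡ lookup ts l)
  fillFirst-run {w} {ts} e e′ =
    case fence-run e′ of λ { (ts₁ , x , e₁ , same₁) →
    case transfer-run {input} {at scratch₁} {[]} {[]} (λ ()) (λ _ → refl) [] w []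
          (trans (same₁ input (λ ())) (trans e (cong (refocus []) (sym (++-identityʳ _))))) e₁ of λ { (ts₂ , y , ei₂ , e₂ , o₂) →
    case home-run {at scratch₁} {w ʳ++ []} {[]} e₂ of λ { (ts₃ , z , e₃ , same₃) →
    ts₃ , weaken (≤-reflexive (trans (cong (λ k → 1 + (length w * 2 + 3 + (k * 3 + 4))) (reversed-length w)) (arith (length w))))
                    (then′ x (then′ y z)) ,
       trans e₃ (cong (zipTape []) (rev² w)) ,
       λ l a b → trans (same₃ l b) (trans (o₂ l a b) (same₁ l b)) } } }
    where
    arith : ∀ n → 1 + (n * 2 + 3 + (n * 3 + 4)) ≡ n * 5 + 8
    arith = solve-∀

  fill : Fin t → Prog
  fill j = ite (fence j)
               (ite (transfer (at scratch₁) j) (ite (home (at scratch₁)) (home j) (fail j)) (fail j)) (fail j)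

  fill-run : ∀ {w j ts} → at scratch₁ ≢ j → lookup ts (at scratch₁) ≡ zipTape [] w → lookup ts j ≡ blankTape →
    ∃[ ts′ ] Exec (fill j) ts (length w * 8 + 12) true ts′ × lookup ts′ (at scratch₁) ≡ zipTape [] w
             × lookup ts′ j ≡ zipTape [] w × (∀ l → l ≢ j → lookup ts′ l ≡ lookup ts l)
  fill-run {w} {j} {ts} i≢j e e′ =
    case fence-run e′ of λ { (ts₁ , x , e₁ , same₁) →
    case transfer-run {at scratch₁} {j} {[ nothing ]} {[ nothing ]} i≢j (λ _ → refl) [] w []
          (trans (same₁ _ i≢j) e) e₁ of λ { (ts₂ , y , ei₂ , e₂ , o₂) →
    case home-run {at scratch₁} {w ʳ++ []} {[]} ei₂ of λ { (ts₃ , z , e₃ , same₃) →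
    case home-run {j} {w ʳ++ []} {[]} (trans (same₃ j (λ q → i≢j (sym q))) e₂) of λ { (ts₄ , z′ , e₄ , same₄) →
    let ei₄ = trans (same₄ _ i≢j) (trans e₃ (cong (zipTape []) (rev² w))) in
    ts₄ , weaken (≤-reflexive (trans (cong (λ k → 1 + (length w * 2 + 3 + (k * 3 + 4 + (k * 3 + 4)))) (reversed-length w)) (arith (length w))))
                    (then′ x (then′ y (then′ z z′))) ,
       ei₄ , trans e₄ (cong (zipTape []) (rev² w)) ,
       λ l a → other ts₄ l a (trans ei₄ (sym e))
         (λ b → trans (same₄ l a) (trans (same₃ l b) (trans (o₂ l b a) (same₁ l a)))) } } } }
    where
    arith : ∀ n → 1 + (n * 2 + 3 + (n * 3 + 4 + (n * 3 + 4))) ≡ n * 8 + 12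
    arith = solve-∀
    other : ∀ ts₄ l → l ≢ j → lookup ts₄ (at scratch₁) ≡ lookup ts (at scratch₁) →
            (l ≢ at scratch₁ → lookup ts₄ l ≡ lookup ts l) → lookup ts₄ l ≡ lookup ts l
    other ts₄ l a e o with l ≟ at scratch₁
    ... | yes refl = e
    ... | no b     = o b

  fills : List (Fin t) → Prog
  fills []       = pass input
  fills (j ∷ js) = ite (fill j) (fills js) (fail j)

  fills-run : ∀ {w} js {ts} → Unique (at scratch₁ ∷ js) → lookup ts (at scratch₁) ≡ zipTape [] w →
    All (λ j → lookup ts j ≡ blankTape) js →
    ∃[ ts′ ] Exec (fills js) ts (length js * (length w * 8 + 12) + 1) true ts′
             × lookup ts′ (at scratch₁) ≡ zipTape [] w
             × All (λ j → lookup ts′ j ≡ zipTape [] w) js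
             × (∀ l → All (l ≢_) js → lookup ts′ l ≡ lookup ts l)
  fills-run [] {ts} _ e _ =
    case test-run {input} (const true) {ts} refl of λ { (ts₁ , x , same) →
    ts₁ , x , trans (same _) e , [] , λ l _ → same l }
  fills-run {w} (j ∷ js) {ts} ((i≢j ∷ i∉js) ∷ (j∉js ∷ u)) e (ej ∷ ejs) =
    case fill-run i≢j e ej of λ { (ts₁ , x , e₁ , ej₁ , same₁) →
    case fills-run js (i∉js ∷ u) e₁
          (All.zipWith (λ { (ne , b) → trans (same₁ _ (λ q → ne (sym q))) b }) (j∉js , ejs)) of λ { (ts₂ , y , e₂ , ejs₂ , same₂) →
    ts₂ , weaken (≤-reflexive (sym (+-assoc (length w * 8 + 12) (length js * (length w * 8 + 12)) 1))) (then′ x y) ,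
       e₂ , trans (same₂ j j∉js) ej₁ ∷ ejs₂ ,
       λ { l (a ∷ as) → trans (same₂ l as) (same₁ l a) } } }

  row : ℕ → W
  row n = List.replicate n two ++ [ endName ]

  rows : ℕ → ℕ → W
  rows zero    n = []
  rows (suc k) n = row n ++ rows k n

  fullTable : W → W
  fullTable w = rows (suc (length w)) (suc (length w))

  append : Symbol → Prog
  append c = on tableTape (λ _ → true , (just c , right))

  append-run : ∀ c p {ts} → lookup ts tableTape ≡ zipTape p [] →
               ∃[ ts′ ] Exec (append c) ts 1 true ts′ × lookup ts′ tableTape ≡ zipTape (c ∷ p) [] × Same tableTape ts ts′
  append-run c p e = on-run {tableTape} {λ _ → true , (just c , right)} e refl refl

  proceed : Fin t → Prog
  proceed j = on j copyStep

  -- The body precedes the attempt to move on, and so runs at the closing blank too: once for each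
  -- of the `n + 1` positions. Accordingly `outputs v n` has `n + 1` copies of `v`.
  forEach : Fin t → Prog → Prog
  forEach j body = ite (loop (ite body (proceed j) (fail j))) (fail j) (home j)

  outputs : W → ℕ → W
  outputs v zero    = v
  outputs v (suc k) = v ++ outputs v k

  module _ {j : Fin t} {body : Prog} {cb : ℕ} {w v : W} (j≢table : j ≢ tableTape) (P : Tapes → Set)
    (stable : ∀ ts ts′ → Same j ts ts′ → P ts → P ts′)
    (body-run : ∀ {q ts} → P ts → lookup ts tableTape ≡ zipTape q [] →
                ∃[ ts′ ] Exec body ts cb true ts′ × lookup ts′ tableTape ≡ zipTape (v ʳ++ q) [] × P ts′
                         × lookup ts′ j ≡ lookup ts j) where

    forEach-run : ∀ {q ts} → P ts → lookup ts j ≡ zipTape [] w → lookup ts tableTape ≡ zipTape q [] →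
      ∃[ ts′ ] Exec (forEach j body) ts (length w * (cb + 4) + (cb + 6)) true ts′
               × lookup ts′ j ≡ zipTape [] w
               × lookup ts′ tableTape ≡ zipTape (outputs v (length w) ʳ++ q) [] × P ts′
    forEach-run {q} {ts} pt e et =
      case steps [] w q ts pt e et of λ { (ts₁ , x , e₁ , et₁ , p₁) →
      case home-run {j} {w ʳ++ []} {[]} e₁ of λ { (ts₂ , y , e₂ , same) →
      ts₂ , weaken (≤-reflexive (trans (cong (λ k → length w * (cb + 1) + (cb + 2) + (k * 3 + 4)) (reversed-length w)) (arith (length w) cb)))
                      (else′ x y) ,
         trans e₂ (cong (zipTape []) (rev² w)) , trans (same _ (λ r → j≢table (sym r))) et₁ , stable ts₁ ts₂ same p₁ } }
      where
      arith : ∀ n c → n * (c + 1) + (c + 2) + (n * 3 + 4) ≡ n * (c + 4) + (c + 6)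
      arith = solve-∀
      steps : ∀ p s q ts → P ts → lookup ts j ≡ zipTape p s → lookup ts tableTape ≡ zipTape q [] →
        ∃[ ts′ ] Exec (loop (ite body (proceed j) (fail j))) ts (length s * (cb + 1) + (cb + 2)) false ts′
                 × lookup ts′ j ≡ zipTape (s ʳ++ p) []
                 × lookup ts′ tableTape ≡ zipTape (outputs v (length s) ʳ++ q) [] × P ts′
      steps p [] q ts pt e et =
        case body-run pt et of λ { (ts₁ , x , et₁ , p₁ , ej₁) →
        case on-run {j} {copyStep} (trans ej₁ e) refl refl of λ { (ts₂ , y , e₂ , same) →
        ts₂ , weaken (+-monoʳ-≤ cb (s≤s z≤n)) (leave (then′ x y)) , e₂ ,
           trans (same _ (λ r → j≢table (sym r))) et₁ , stable ts₁ ts₂ same p₁ } }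
      steps p (c ∷ s) q ts pt e et =
        case body-run pt et of λ { (ts₁ , x , et₁ , p₁ , ej₁) →
        case on-run {j} {copyStep} (trans ej₁ e) refl refl of λ { (ts₂ , y , e₂ , same) →
        case steps (c ∷ p) s (v ʳ++ q) ts₂ (stable ts₁ ts₂ same p₁) e₂
                                        (trans (same _ (λ r → j≢table (sym r))) et₁) of λ { (ts₃ , z , e₃ , et₃ , p₃) →
        ts₃ , weaken (≤-reflexive (sym (+-assoc (cb + 1) (length s * (cb + 1)) (cb + 2)))) (again (then′ x y) z) , e₃ ,
           trans et₃ (cong (λ r → zipTape r []) (sym (++-ʳ++ v))) , p₃ } } }

  outputs-two : ∀ k → outputs [ two ] k ++ [ endName ] ≡ row (suc k)
  outputs-two zero    = refl
  outputs-two (suc k) = cong (two ∷_) (outputs-two k)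

  outputs-rows : ∀ n k → outputs (row n) k ≡ rows (suc k) n
  outputs-rows n zero    = sym (++-identityʳ (row n))
  outputs-rows n (suc k) = cong (row n ++_) (outputs-rows n k)

  fillRow : Prog
  fillRow = ite (forEach (at scratch₂) (append two)) (append endName) (fail input)

  fillRow-run : ∀ {w q ts} → lookup ts (at scratch₂) ≡ zipTape [] w → lookup ts tableTape ≡ zipTape q [] →
    ∃[ ts′ ] Exec fillRow ts (length w * 5 + 8) true ts′
             × lookup ts′ tableTape ≡ zipTape (row (suc (length w)) ʳ++ q) []
             × lookup ts′ (at scratch₂) ≡ zipTape [] w
             × (∀ l → l ≢ at scratch₂ → l ≢ tableTape → lookup ts′ l ≡ lookup ts l)
  fillRow-run {w} {q} {ts} e et =
    case forEach-run {at scratch₂} {append two} {1} {w} {[ two ]} (λ ())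
            (λ ts′ → ∀ l → l ≢ at scratch₂ → l ≢ tableTape → lookup ts′ l ≡ lookup ts l)
            (λ _ _ same o l a b → trans (same l a) (o l a b))
            (λ {q′} o et → case append-run two q′ et of λ { (ts″ , y , et″ , same) →
                           ts″ , y , et″ , (λ l a b → trans (same l b) (o l a b)) , same _ (λ ()) })
            (λ _ _ _ → refl) e et of λ { (ts₁ , x , e₁ , et₁ , o₁) →
    case append-run endName (outputs [ two ] (length w) ʳ++ q) et₁ of λ { (ts₂ , y , et₂ , same₂) →
    ts₂ , weaken (≤-reflexive (+-assoc (length w * 5) 7 1)) (then′ x y) ,
       trans et₂ (cong (λ r → zipTape r [])
         (trans (sym (++-ʳ++ (outputs [ two ] (length w)))) (cong (_ʳ++ q) (outputs-two (length w))))) ,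
       trans (same₂ _ (λ ())) e₁ , λ l a b → trans (same₂ l b) (o₁ l a b) } }

  fillTable : Prog
  fillTable = ite (fence tableTape) (ite (forEach (at scratch₁) fillRow) (home tableTape) (fail input)) (fail input)

  length-row : ∀ n → length (row n) ≡ suc n
  length-row zero    = refl
  length-row (suc n) = cong suc (length-row n)

  length-rows : ∀ k n → length (rows k n) ≡ k * suc n
  length-rows zero    n = refl
  length-rows (suc k) n =
    trans (length-++ (row n)) (cong₂ _+_ (length-row n) (length-rows k n))

  fillTable-run : ∀ {w ts} → lookup ts (at scratch₁) ≡ zipTape [] w → lookup ts (at scratch₂) ≡ zipTape [] w →
    lookup ts tableTape ≡ blankTape →
    ∃[ ts′ ] Exec fillTable ts (1 + (length w * (length w * 5 + 8 + 4) + (length w * 5 + 8 + 6)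
                                     + (suc (length w) * suc (suc (length w)) * 3 + 4))) true ts′
             × lookup ts′ tableTape ≡ zipTape [] (fullTable w)
             × lookup ts′ (at scratch₁) ≡ zipTape [] w
             × lookup ts′ (at scratch₂) ≡ zipTape [] w
             × (∀ l → l ≢ at scratch₁ → l ≢ at scratch₂ → l ≢ tableTape → lookup ts′ l ≡ lookup ts l)
  fillTable-run {w} {ts} e₁ e₂ et =
    let n = length w in
    case fence-run et of λ { (ts₁ , x , et₁ , same₁) →
    case forEach-run {at scratch₁} {fillRow} {n * 5 + 8} {w} {row (suc n)} (λ ())
            (λ ts′ → lookup ts′ (at scratch₂) ≡ zipTape [] w ×
                     (∀ l → l ≢ at scratch₁ → l ≢ at scratch₂ → l ≢ tableTape → lookup ts′ l ≡ lookup ts l))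
            (λ { _ _ same (e , o) → trans (same _ (λ ())) e , λ l a b c → trans (same l a) (o l a b c) })
            (λ { (e , o) et →
                 case fillRow-run {w} e et of λ { (ts″ , z , et″ , e″ , o″) →
                 ts″ , z , et″ , (e″ , λ l a b c → trans (o″ l b c) (o l a b c)) , o″ _ (λ ()) (λ ()) }})
            (trans (same₁ _ (λ ())) e₂ , λ l _ _ c → same₁ l c)
            (trans (same₁ _ (λ ())) e₁) et₁ of λ { (ts₂ , y , e₁₂ , et₂ , e₂₂ , o) →
    let v = outputs (row (suc n)) n in
    case home-run {tableTape} {v ʳ++ []} {[]} et₂ of λ { (ts₃ , z , et₃ , same₃) →
    let v≡ : v ≡ fullTable w
        v≡ = outputs-rows (suc n) n in
    ts₃ , then′ x (weaken (≤-reflexive (cong (λ k → n * (n * 5 + 8 + 4) + (n * 5 + 8 + 6) + (k * 3 + 4))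
                         (trans (reversed-length v) (trans (cong length v≡) (length-rows (suc n) (suc n))))))
                       (then′ y z)) ,
       trans et₃ (cong (zipTape []) (trans (rev² v) v≡)) ,
       trans (same₃ _ (λ ())) e₁₂ , trans (same₃ _ (λ ())) e₂₂ ,
       λ l a b c → trans (same₃ l c) (o l a b c) } } }

  otherPlaces : List (Fin t)
  otherPlaces = 4F ∷ 5F ∷ 6F ∷ 7F ∷ 8F ∷ 9F ∷ []

  setup : Prog
  setup = ite fillFirst (ite (fills otherPlaces) (ite (fence stackTape) fillTable (fail input)) (fail input)) (fail input)

  setupCost : Cost
  setupCost = (size ⊠ con 5 ⊞ con 8) ⊞ ((con 6 ⊠ (size ⊠ con 8 ⊞ con 12) ⊞ con 1) ⊞ (con 1 ⊞ (con 1 ⊞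
    (size ⊠ (size ⊠ con 5 ⊞ con 8 ⊞ con 4) ⊞ (size ⊠ con 5 ⊞ con 8 ⊞ con 6) ⊞ (tableSize ⊠ con 3 ⊞ con 4)))))

  startTapes : W → Tapes
  startTapes w = refocus [] (List.map just w) ∷ replicate 9 blankTape

  setup-run : ∀ w → ∃[ ts ] Exec setup (startTapes w) (eval setupCost (length w)) true ts
                            × Inv w (fullTable w) ts × Rep 1 w (λ _ → [] , w) ts
  setup-run w =
    case fillFirst-run {w} {startTapes w} refl refl of λ { (ts₁ , x₁ , e₁ , o₁) →
    case fills-run {w} otherPlaces {ts₁} (from-yes (unique? (at scratch₁ ∷ otherPlaces))) e₁
          (o₁ _ (λ ()) (λ ()) ∷ o₁ _ (λ ()) (λ ()) ∷ o₁ _ (λ ()) (λ ()) ∷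
           o₁ _ (λ ()) (λ ()) ∷ o₁ _ (λ ()) (λ ()) ∷ o₁ _ (λ ()) (λ ()) ∷ []) of λ { (ts₂ , x₂ , e₂ , es₂ , o₂) →
    case fence-run {stackTape} {ts₂}
          (trans (o₂ stackTape ((λ ()) ∷ (λ ()) ∷ (λ ()) ∷ (λ ()) ∷ (λ ()) ∷ (λ ()) ∷ [])) (o₁ _ (λ ()) (λ ()))) of λ { (ts₃ , x₃ , e₃ , o₃) →
    case fillTable-run {w} {ts₃} (trans (o₃ _ (λ ())) e₂)
          (trans (o₃ _ (λ ())) (All.head es₂))
          (trans (o₃ _ (λ ())) (trans (o₂ tableTape ((λ ()) ∷ (λ ()) ∷ (λ ()) ∷ (λ ()) ∷ (λ ()) ∷ (λ ()) ∷ [])) (o₁ _ (λ ()) (λ ())))) of λ { (ts₄ , x₄ , et₄ , s₁ , s₂ , o₄) →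
    let vars : ∀ i → lookup ts₄ (at (var i)) ≡ zipTape [] w
        vars = λ i → trans (o₄ (at (var i)) (λ ()) (λ ()) (λ ())) (trans (o₃ (at (var i)) (λ ())) (filled ts₂ es₂ i)) in
    ts₄ , then′ x₁ (then′ x₂ (then′ x₃ x₄)) ,
       inv-of (λ { scratch₁ → ([] , w) , refl , s₁
                 ; scratch₂ → ([] , w) , refl , s₂
                 ; (var i)  → ([] , w) , refl , vars i })
              et₄
              ([] , trans (o₄ stackTape (λ ()) (λ ()) (λ ())) e₃)
              (≤-reflexive (length-rows (suc (length w)) (suc (length w)))) ,
       rep-of (λ _ _ → refl) (λ i _ → vars i) } } } }
    where
    filled : ∀ ts → All (λ j → lookup ts j ≡ zipTape [] w) otherPlaces → ∀ i → lookup ts (at (var i)) ≡ zipTape [] w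
    filled _ (_ ∷ a ∷ _) 0F = a
    filled _ (_ ∷ _ ∷ a ∷ _) 1F = a
    filled _ (_ ∷ _ ∷ _ ∷ a ∷ _) 2F = a
    filled _ (_ ∷ _ ∷ _ ∷ _ ∷ a ∷ _) 3F = a
    filled _ (_ ∷ _ ∷ _ ∷ _ ∷ _ ∷ a ∷ _) 4F = a

  origin : W → Env
  origin w _ = [] , w

  module _ {v g : Env → W → Bool} {f : Env → W → Bool × W}
           (admissible : Test 1 v) (refine : Comp 1 f) (verdict : Test 1 g) where

    decider : Prog
    decider = ite setup (ite (prog admissible)
                             -- A loop ends with the answer false, so its continuation stands in the
                             -- else branch.
                             (ite (loop (prog refine)) (fail input) (prog verdict))
                             (fail input)) (fail input)

    -- The refinement gets `1 + tableSize` rounds: the measure is at most the length of the full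
    -- table, and a last round finds nothing. The final `con 1` pays for rejecting an inadmissible
    -- word.
    deciderCost : Cost
    deciderCost = setupCost ⊞ (cost admissible ⊞ ((con 1 ⊞ tableSize) ⊠ cost refine ⊞ cost verdict ⊞ con 1))

    decider-rejects : ∀ {w} → v (origin w) (fullTable w) ≡ false →
      run (machine decider) (polynomial (coefficients deciderCost) (length w)) w ≡ just false
    decider-rejects {w} e =
      let n = length w in
      case setup-run w of λ { (ts₁ , x₁ , I₁ , rep₁) →
      case spec admissible {w} {fullTable w} {origin w} I₁ rep₁ of λ { (ts₂ , x₂ , I₂ , kept₂) →
      case test-run {input} (const false) {ts₂} refl of λ { (ts₃ , x₃ , same₃) →
      subst (λ k → run (machine decider) k w ≡ just false) (sym (coefficients-eval deciderCost n))
           (run-sound decider (then′ x₁ (else′ (subst (λ b → Exec _ ts₁ _ b ts₂) e x₂)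
             (weaken (m≤n+m 1 (eval ((con 1 ⊞ tableSize) ⊠ cost refine ⊞ cost verdict) n)) x₃)))) } } }

    decider-answers : ∀ {w} (G : W → Set) (μ : W → ℕ) →
      v (origin w) (fullTable w) ≡ true → G (fullTable w) →
      μ (fullTable w) ≤ length (fullTable w) →
      (∀ {tw tw′} → G tw → f (origin w) tw ≡ (true , tw′) → G tw′ × μ tw′ < μ tw) →
      ∃[ tw ] ∃[ tw′ ] G tw × f (origin w) tw ≡ (false , tw′) ×
        run (machine decider) (polynomial (coefficients deciderCost) (length w)) w ≡ just (g (origin w) tw′)
    decider-answers {w} G μ e G₀ μ≤ decrease =
      let n = length w in
      case setup-run w of λ { (ts₁ , x₁ , I₁ , rep₁) →
      case spec admissible {w} {fullTable w} {origin w} I₁ rep₁ of λ { (ts₂ , x₂ , I₂ , kept₂) →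
      let rep₂ = Rep-kept rep₁ kept₂ in
      case repeat-run refine (origin w) G μ decrease (length (fullTable w)) μ≤ I₂ rep₂ G₀ of λ { (tw , tw′ , G* , e* , ts₃ , x₃ , I₃ , kept₃) →
      let rep₃ = Rep-kept rep₂ kept₃ in
      case spec verdict I₃ rep₃ of λ { (ts₄ , x₄ , I₄ , _) →
      let N≡ : suc (length (fullTable w)) * eval (cost refine) n ≡ eval ((con 1 ⊞ tableSize) ⊠ cost refine) n
          N≡ = cong (λ k → suc k * eval (cost refine) n) (length-rows (suc n) (suc n)) in
      tw , tw′ , G* , e* ,
         subst (λ k → run (machine decider) k w ≡ just _) (sym (coefficients-eval deciderCost n))
           (run-sound decider (then′ x₁ (then′ (subst (λ b → Exec _ ts₁ _ b ts₂) e x₂)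
             (weaken (≤-trans (+-monoˡ-≤ _ (≤-reflexive N≡)) (m≤m+n _ 1)) (else′ x₃ x₄))))) } } } }

  -- Kept abstract, so that type checking never runs the machine.
  record Decider (v g : Env → W → Bool) (f : Env → W → Bool × W) : Set₁ where
    field
      turing  : TuringMachine Symbol
      time    : List ℕ
      rejects : ∀ {w} → v (origin w) (fullTable w) ≡ false → run turing (polynomial time (length w)) w ≡ just false
      answers : ∀ {w} (G : W → Set) (μ : W → ℕ) → v (origin w) (fullTable w) ≡ true → G (fullTable w) →
                μ (fullTable w) ≤ length (fullTable w) →
                (∀ {tw tw′} → G tw → f (origin w) tw ≡ (true , tw′) → G tw′ × μ tw′ < μ tw) →
                ∃[ tw ] ∃[ tw′ ] G tw × f (origin w) tw ≡ (false , tw′) ×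
                  run turing (polynomial time (length w)) w ≡ just (g (origin w) tw′)

  abstract
    makeDecider : ∀ {v g f} → Test 1 v → Comp 1 f → Test 1 g → Decider v g f
    makeDecider a r v = record
      { turing  = machine (decider a r v)
      ; time    = coefficients (deciderCost a r v)
      ; rejects = decider-rejects a r v
      ; answers = decider-answers a r v }

-- The tests on the input and the refinement step

module Algorithm where

  open import Data.Fin using (Fin; suc; toℕ)
  open import Data.Nat.Properties hiding (_≟_)
  open import Data.Vec using ([]; _∷_)

  open Machines
  open Tapes
  open Computations
  open Searching

  open Comp

  test-if : ∀ {k p q r} → Test k p → Test k q → Test k r → Test k (λ env tw → if p env tw then q env tw else r env tw)
  test-if {k} {p} {q} {r} a b c = reindex (λ env tw → distrib (p env tw)) (branch a b c)
    where
    distrib : ∀ b {x y : Bool} {tw : W} → (if b then (x , tw) else (y , tw)) ≡ ((if b then x else y) , tw)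
    distrib true  = refl
    distrib false = refl

  test-not : ∀ {k p} → Test k p → Test k (λ env tw → not (p env tw))
  test-not {k} {p} a = reindex (λ env tw → eq (p env tw)) (test-if a (answer false) (answer true))
    where
    eq : ∀ b {tw : W} → ((if b then false else true) , tw) ≡ (not b , tw)
    eq true  = refl
    eq false = refl

  test-and : ∀ {k p q} → Test k p → Test k q → Test k (λ env tw → p env tw ∧ q env tw)
  test-and {k} {p} a b = reindex (λ env tw → eq (p env tw)) (test-if a b (answer false))
    where
    eq : ∀ b {c} {tw : W} → ((if b then c else false) , tw) ≡ (b ∧ c , tw)
    eq true  = refl
    eq false = refl

  test-or : ∀ {k p q} → Test k p → Test k q → Test k (λ env tw → p env tw ∨ q env tw)
  test-or {k} {p} a b = reindex (λ env tw → eq (p env tw)) (test-if a (answer true) b)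
    where
    eq : ∀ b {c} {tw : W} → ((if b then true else c) , tw) ≡ (b ∨ c , tw)
    eq true  = refl
    eq false = refl

  someFrom : (Symbol → Bool) → W → W → (Zip → Bool) → Bool
  someFrom q pre []        p = false
  someFrom q pre (c ∷ suf) p =
    if q c then false else (if p (pre , c ∷ suf) then true else someFrom q (c ∷ pre) suf p)

  some : (Symbol → Bool) → Zip → (Zip → Bool) → Bool
  some q (pre , suf) p = someFrom q pre suf p

  search-pure : ∀ q pre suf (p : Zip → W → Bool) tw → searchFrom q pre suf (λ z tw → p z tw , tw) tw ≡ (someFrom q pre suf (λ z → p z tw) , tw)
  search-pure q pre []        p tw = refl
  search-pure q pre (c ∷ suf) p tw with q c
  ... | true  = refl
  ... | false with p (pre , c ∷ suf) tw
  ...   | true  = refl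
  ...   | false = search-pure q (c ∷ pre) suf p tw

  exists : ∀ q (j : Fin 5) (u : Term (toℕ j)) {p} → Test (suc (toℕ j)) p →
           Test (toℕ j) (λ env tw → some q (value u env) (λ z → p (env [ j ↦ z ]) tw))
  exists q j u {p} c =
    reindex (λ env tw → search-pure q (proj₁ (value u env)) (proj₂ (value u env)) (λ z tw → p (env [ j ↦ z ]) tw) tw)
            (searching q j c u)

  never isPositive isNegative isBlock isConcept isRole isAssertion isTag : Symbol → Bool
  never _ = false
  isPositive positiveTag = true
  isPositive _           = false
  isNegative negativeTag = true
  isNegative _           = false
  isBlock c = isPositive c ∨ isNegative c
  isConcept conceptTag = true
  isConcept _          = false
  isRole roleTag = true
  isRole _       = false
  isAssertion c = isConcept c ∨ isRole c
  isTag c = isBlock c ∨ isAssertion c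

  -- From the tag of an assertion to the first, second and third name after it.
  path₁ path₂ path₃ : List Mv
  path₁ = nxt ∷ []
  path₂ = nxt ∷ fnd ∷ nxt ∷ []
  path₃ = nxt ∷ fnd ∷ nxt ∷ fnd ∷ nxt ∷ []

  -- A local condition which, imposed at all positions, characterises encodings up to the first
  -- symbol and disjointness. A block starts with a fact because ABoxes are nonempty; no positive
  -- block comes after a negative one because `encode` writes the positives first; a fact has its
  -- full number of names, followed by a tag or the end. Positions inside names pass, being checked
  -- from their tag.
  wellFormed : Zip → Bool
  wellFormed z =
    if peek isBlock false z
    then peek isAssertion false (next z)
         ∧ not (peek isNegative false z ∧ some never (next z) (peek isPositive false))
    else if peek isConcept false z
    then peek isEnd false (nav (nxt ∷ fnd ∷ []) z)
         ∧ (peek isEnd false (nav (nxt ∷ fnd ∷ nxt ∷ fnd ∷ []) z) ∧ peek isTag true (nav path₃ z))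
    else if peek isRole false z
    then peek isEnd false (nav (nxt ∷ fnd ∷ []) z)
         ∧ (peek isEnd false (nav (nxt ∷ fnd ∷ nxt ∷ fnd ∷ []) z)
         ∧ (peek isEnd false (nav (nxt ∷ fnd ∷ nxt ∷ fnd ∷ nxt ∷ fnd ∷ []) z)
         ∧ peek isTag true (nav (nxt ∷ fnd ∷ nxt ∷ fnd ∷ nxt ∷ fnd ∷ nxt ∷ []) z)))
    else true

  valid : Zip → Bool
  valid z₀ = peek isBlock true z₀ ∧ not (some never z₀ (λ z → not (wellFormed z)))

  wellFormed-test : Test 2 (λ env _ → wellFormed (env 1F))
  wellFormed-test =
    test-if (label isBlock false (1F · []))
      (test-and (label isAssertion false (1F · nxt ∷ []))
                (test-not (test-and (label isNegative false (1F · []))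
                                    (exists never 2F (1F · nxt ∷ []) (label isPositive false (2F · []))))))
    (test-if (label isConcept false (1F · []))
      (test-and (label isEnd false (1F · nxt ∷ fnd ∷ []))
      (test-and (label isEnd false (1F · nxt ∷ fnd ∷ nxt ∷ fnd ∷ []))
                (label isTag true (1F · path₃))))
    (test-if (label isRole false (1F · []))
      (test-and (label isEnd false (1F · nxt ∷ fnd ∷ []))
      (test-and (label isEnd false (1F · nxt ∷ fnd ∷ nxt ∷ fnd ∷ []))
      (test-and (label isEnd false (1F · nxt ∷ fnd ∷ nxt ∷ fnd ∷ nxt ∷ fnd ∷ []))
                (label isTag true (1F · nxt ∷ fnd ∷ nxt ∷ fnd ∷ nxt ∷ fnd ∷ nxt ∷ [])))))
    (answer true)))

  valid-test : Test 1 (λ env _ → valid (env 0F))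
  valid-test = test-and (label isBlock true (0F · []))
                        (test-not (exists never 1F (0F · []) (test-not wellFormed-test)))

  someIndividual : Zip → (Zip → Bool) → Bool
  someIndividual z p =
    if peek isConcept false z then p (nav path₂ z)
    else if peek isRole false z then p (nav path₂ z) ∨ p (nav path₃ z)
    else false

  -- An individual is reached from variable `i` along a path, and is not the value of a variable;
  -- the inner test is therefore supplied once for every path.
  individual-test : ∀ {k} i {i<k : True (suc (toℕ i) ≤? k)} (p : Env → W → Zip → Bool) →
                    (∀ ms → Test k (λ env tw → p env tw (nav ms (env i)))) →
                    Test k (λ env tw → someIndividual (env i) (p env tw))
  individual-test i {i<k} p c =
    test-if (label isConcept false (_·_ i {i<k} [])) (c path₂)
    (test-if (label isRole false (_·_ i {i<k} [])) (test-or (c path₂) (c path₃)) (answer false))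

  same : Zip → Zip → Bool
  same x y = sameName (proj₂ x) (proj₂ y)

  -- Two facts belong to different boxes when a block tag lies between them. Looking only to the
  -- right is enough, as one of the two occurrences comes first.
  sharedIn sharedAfter : Zip → Zip → Bool
  sharedIn a z    = some never z λ z′ → someIndividual z′ (same a)
  sharedAfter z a = some never z λ z′ → peek isBlock false z′ ∧ sharedIn a z′

  shared : Zip → Bool
  shared z₀ = some never z₀ λ z → someIndividual z (sharedAfter z)

  shared-test : Test 1 (λ env _ → shared (env 0F))
  shared-test =
    exists never 1F (0F · []) (individual-test 1F
      (λ env _ a → sharedAfter (env 1F) a) λ ms →
    exists never 2F (1F · []) (test-and (label isBlock false (2F · []))
    (exists never 3F (2F · []) (individual-test 3F
      (λ env _ b → same (nav ms (env 1F)) b) λ ms′ →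
    eqName (1F · ms) (3F · ms′)))))

  conceptViolation : Zip → Zip → Zip → Bool
  conceptViolation z₀ x y =
    some never z₀ λ z → peek isConcept false z ∧ (same (nav path₂ z) x ∧
    not (some never z₀ λ z′ → peek isConcept false z′ ∧ (same (nav path₁ z) (nav path₁ z′) ∧ same (nav path₂ z′) y)))

  -- The paths say which end of an edge is compared with `x` and `y` and which end is looked up in
  -- the table. Exchanging them gives the condition for inverse roles.
  roleViolation : List Mv → List Mv → Zip → Zip → Zip → W → Bool
  roleViolation from to z₀ x y tw =
    some never z₀ λ z → peek isRole false z ∧ (same (nav from z) x ∧
    not (some never z₀ λ z′ → peek isRole false z′ ∧ (same (nav path₁ z) (nav path₁ z′) ∧
         (same (nav from z′) y ∧ getEntry (nav to z) (nav to z′) tw))))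

  backwardViolation : DL → Zip → Zip → Zip → W → Bool
  backwardViolation EL⊥  z₀ x y tw = false
  backwardViolation ELI⊥ z₀ x y tw = roleViolation path₃ path₂ z₀ x y tw

  violation : DL → Zip → Zip → Zip → W → Bool
  violation 𝓛 z₀ x y tw =
    getEntry x y tw ∧ (conceptViolation z₀ x y ∨
                       (roleViolation path₂ path₃ z₀ x y tw ∨ backwardViolation 𝓛 z₀ x y tw))

  conceptViolation-test : Test 3 (λ env _ → conceptViolation (env 0F) (env 1F) (env 2F))
  conceptViolation-test =
    exists never 3F (0F · []) (test-and (label isConcept false (3F · []))
    (test-and (eqName (3F · path₂) (1F · []))
    (test-not (exists never 4F (0F · []) (test-and (label isConcept false (4F · []))
      (test-and (eqName (3F · path₁) (4F · path₁)) (eqName (4F · path₂) (2F · []))))))))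

  roleViolation-test : ∀ from to → Test 3 (λ env tw → roleViolation from to (env 0F) (env 1F) (env 2F) tw)
  roleViolation-test from to =
    exists never 3F (0F · []) (test-and (label isRole false (3F · []))
    (test-and (eqName (3F · from) (1F · []))
    (test-not (exists never 4F (0F · []) (test-and (label isRole false (4F · []))
      (test-and (eqName (3F · path₁) (4F · path₁))
      (test-and (eqName (4F · from) (2F · [])) (lookupEntry (3F · to) (4F · to)))))))))

  backwardViolation-test : ∀ 𝓛 → Test 3 (λ env tw → backwardViolation 𝓛 (env 0F) (env 1F) (env 2F) tw)
  backwardViolation-test EL⊥  = answer false
  backwardViolation-test ELI⊥ = roleViolation-test path₃ path₂

  violation-test : ∀ 𝓛 → Test 3 (λ env tw → violation 𝓛 (env 0F) (env 1F) (env 2F) tw)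
  violation-test 𝓛 =
    test-and (lookupEntry (1F · []) (2F · []))
    (test-or conceptViolation-test (test-or (roleViolation-test path₂ path₃) (backwardViolation-test 𝓛)))

  repair : DL → Zip → Zip → Zip → W → Bool × W
  repair 𝓛 z₀ x y tw = if violation 𝓛 z₀ x y tw then (true , clearEntry x y tw) else (false , tw)

  -- A successful `repair` ends both searches, so the table is inspected afresh after each single
  -- change, and an unsuccessful call certifies one and the same table at all pairs of positions.
  refine : DL → Zip → W → Bool × W
  refine 𝓛 z₀ = search never z₀ λ x → search never z₀ λ y → repair 𝓛 z₀ x y

  abstract
    refine-comp : ∀ 𝓛 → Comp 1 (λ env tw → refine 𝓛 (env 0F) tw)
    refine-comp 𝓛 = searching never 1F (searching never 2F
      (branch (violation-test 𝓛) (clear (1F · []) (2F · [])) (answer false)) (0F · [])) (0F · [])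

  simulated : Zip → W → Zip → Bool
  simulated z₀ tw b =
    some never z₀ λ s → peek isPositive false s ∧ some isBlock (next s) λ z → someIndividual z λ a → getEntry b a tw

  verdict : Zip → W → Bool
  verdict z₀ tw =
    not (some never z₀ λ s → peek isNegative false s ∧
         not (some isBlock (next s) λ z → someIndividual z λ b → not (simulated z₀ tw b)))

  abstract
    verdict-test : Test 1 (λ env tw → verdict (env 0F) tw)
    verdict-test =
      test-not (exists never 1F (0F · []) (test-and (label isNegative false (1F · []))
      (test-not (exists isBlock 2F (1F · nxt ∷ []) (individual-test 2F
        (λ env tw b → not (simulated (env 0F) tw b)) λ ms →
      test-not (exists never 3F (0F · []) (test-and (label isPositive false (3F · []))
      (exists isBlock 4F (3F · nxt ∷ []) (individual-test 4F
        (λ env tw a → getEntry (nav ms (env 2F)) a tw) λ ms′ →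
      lookupEntry (2F · ms) (4F · ms′))))))))))

  admissible : Zip → Bool
  admissible z₀ = valid z₀ ∧ not (shared z₀)

  abstract
    admissible-test : Test 1 (λ env _ → admissible (env 0F))
    admissible-test = test-and valid-test (test-not shared-test)

-- From failed simulations to ontologies

module Simulations where

  open import Data.List.Relation.Binary.Disjoint.Propositional using (Disjoint)
  open import Data.Nat using (_≟_)

  concatMap-∈ : ∀ {A B : Set} (f : A → List B) {x y xs} → x ∈ xs → y ∈ f x → y ∈ concatMap f xs
  concatMap-∈ f x∈ y∈ = ∈-concatMap⁺ f (lose x∈ y∈)

  ∈-concatMap : ∀ {A B : Set} (f : A → List B) {y} xs → y ∈ concatMap f xs → ∃[ x ] x ∈ xs × y ∈ f x
  ∈-concatMap f xs y∈ = find (∈-concatMap⁻ f {xs = xs} y∈)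

  individual-∈ : ∀ {𝒜 α a} → α ∈ toList 𝒜 → a ∈ individualsOf α → a ∈ individuals 𝒜
  individual-∈ = concatMap-∈ individualsOf

  someIndividualOf : ∀ α → ∃[ a ] a ∈ individualsOf α
  someIndividualOf (conceptA _ a) = a , here refl
  someIndividualOf (roleA _ a _)  = a , here refl

  module Collection (all : List ABox)
    (disjoint : AllPairs (λ 𝒜 ℬ → Disjoint (individuals 𝒜) (individuals ℬ)) all) where

    pool : List Assertion
    pool = concatMap toList all

    same-box : ∀ {xs 𝒜 ℬ a} → AllPairs (λ 𝒜 ℬ → Disjoint (individuals 𝒜) (individuals ℬ)) xs →
               𝒜 ∈ xs → ℬ ∈ xs → a ∈ individuals 𝒜 → a ∈ individuals ℬ → 𝒜 ≡ ℬ
    same-box (_ ∷ _) (here refl) (here refl) _  _  = refl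
    same-box (d ∷ _) (here refl) (there m)   a∈ b∈ = ⊥-elim (All.lookup d m (a∈ , b∈))
    same-box (d ∷ _) (there m)   (here refl) a∈ b∈ = ⊥-elim (All.lookup d m (b∈ , a∈))
    same-box (_ ∷ p) (there m)   (there m′)  a∈ b∈ = same-box p m m′ a∈ b∈

    -- Disjointness keeps the ABoxes apart inside the pool, so a simulation computed on the pool is
    -- one between single ABoxes.
    own : ∀ {𝒜 α a} → 𝒜 ∈ all → a ∈ individuals 𝒜 → α ∈ pool → a ∈ individualsOf α → α ∈ toList 𝒜
    own 𝒜∈ a∈ α∈ a∈α with ∈-concatMap toList all α∈
    ... | ℬ , ℬ∈ , α∈ℬ with same-box disjoint 𝒜∈ ℬ∈ a∈ (individual-∈ {ℬ} α∈ℬ a∈α)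
    ... | refl = α∈ℬ

    in-pool : ∀ {𝒜 α} → 𝒜 ∈ all → α ∈ toList 𝒜 → α ∈ pool
    in-pool = concatMap-∈ toList

  -- Winning strategies of the challenger in the simulation game on the pool. Being inductive, a
  -- strategy can be translated into a concept.
  data Distinguished (𝓛 : DL) (pool : List Assertion) : N-I → N-I → Set where
    by-concept  : ∀ {A b a} → conceptA A b ∈ pool → conceptA A a ∉ pool → Distinguished 𝓛 pool b a
    by-forward  : ∀ {r b b′ a} → roleA r b b′ ∈ pool →
                  (∀ a′ → roleA r a a′ ∈ pool → Distinguished 𝓛 pool b′ a′) → Distinguished 𝓛 pool b a
    by-backward : ∀ {r b b′ a} → 𝓛 ≡ ELI⊥ → roleA r b′ b ∈ pool →
                  (∀ a′ → roleA r a′ a ∈ pool → Distinguished 𝓛 pool b′ a′) → Distinguished 𝓛 pool b a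

  module _ {𝓛 : DL} {X : Set} where

    -- A conjunct may depend on the membership proof, since strategies are given only for facts
    -- known to lie in the pool.
    meets : (xs : List X) → (∀ x → x ∈ xs → Concept 𝓛) → Concept 𝓛
    meets []       f = top
    meets (x ∷ xs) f = f x (here refl) ⊓ meets xs (λ y → f y ∘ there)

    meets-intro : ∀ ℐ xs {f d} → Interpretation.Δ ℐ d → (∀ x m → conceptExt ℐ (f x m) d) → conceptExt ℐ (meets xs f) d
    meets-intro ℐ []       δ h = δ
    meets-intro ℐ (x ∷ xs) δ h = h x (here refl) , meets-intro ℐ xs δ (λ y → h y ∘ there)

    meets-elim : ∀ ℐ {xs f d x} → conceptExt ℐ (meets xs f) d → (m : x ∈ xs) → conceptExt ℐ (f x m) d
    meets-elim ℐ (h , _) (here refl) = h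
    meets-elim ℐ (_ , h) (there m)   = meets-elim ℐ h m

  named⇒Δ : ∀ {ℐ 𝒜 a} → ModelOfABox ℐ 𝒜 → a ∈ individuals 𝒜 → Interpretation.Δ ℐ (inj₁ a)
  named⇒Δ {ℐ} {𝒜} model a∈ with ∈-concatMap individualsOf (toList 𝒜) a∈
  ... | conceptA A _ , α∈ , here refl         = Interpretation.concept⊆ ℐ A (All.lookup model α∈)
  ... | roleA r _ _  , α∈ , here refl         = proj₁ (Interpretation.role⊆ ℐ r (All.lookup model α∈))
  ... | roleA r _ _  , α∈ , there (here refl) = proj₂ (Interpretation.role⊆ ℐ r (All.lookup model α∈))

  module Distinguishing {𝓛 : DL} {pool : List Assertion} where

    -- The conjunction over the successors of `a` is taken over the whole pool, with `top` for all
    -- other facts.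
    onSuccessor : ∀ r a → (∀ a′ → roleA r a a′ ∈ pool → Concept 𝓛) → ∀ α → α ∈ pool → Concept 𝓛
    onSuccessor r a f (conceptA _ _)  m = top
    onSuccessor r a f (roleA r′ x a′) m with r′ ≟ r | x ≟ a
    ... | yes refl | yes refl = f a′ m
    ... | yes refl | no _     = top
    ... | no _     | _        = top

    onPredecessor : ∀ r a → (∀ a′ → roleA r a′ a ∈ pool → Concept 𝓛) → ∀ α → α ∈ pool → Concept 𝓛
    onPredecessor r a f (conceptA _ _)  m = top
    onPredecessor r a f (roleA r′ a′ x) m with r′ ≟ r | x ≟ a
    ... | yes refl | yes refl = f a′ m
    ... | yes refl | no _     = top
    ... | no _     | _        = top

    inverse : 𝓛 ≡ ELI⊥ → N-R → Role 𝓛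
    inverse refl = inv

    conceptOf : ∀ {b a} → Distinguished 𝓛 pool b a → Concept 𝓛
    conceptOf (by-concept {A} _ _)          = atom A
    conceptOf (by-forward {r} {a = a} _ h)  = ex (name r) (meets pool (onSuccessor r a (λ a′ m → conceptOf (h a′ m))))
    conceptOf (by-backward {r} {a = a} e _ h) = ex (inverse e r) (meets pool (onPredecessor r a (λ a′ m → conceptOf (h a′ m))))

    -- The challenger moves along facts at `b`, and these stay within `B` and are true in `ℐ`, so
    -- its moves are the witnesses of the existentials. For `B` the individuals of a negative ABox
    -- are taken; they are closed under the facts of the pool by `own`.
    holds : ∀ ℐ {b a} → (B : N-I → Set) → (∀ {b} → B b → Interpretation.Δ ℐ (inj₁ b)) →
            (∀ {b α} → B b → α ∈ pool → b ∈ individualsOf α → SatisfiesAssertion ℐ α × All B (individualsOf α)) →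
            (d : Distinguished 𝓛 pool b a) → B b → conceptExt ℐ (conceptOf d) (inj₁ b)
    holds ℐ B δ sat (by-concept m _) b∈ = proj₁ (sat b∈ m (here refl))
    holds ℐ B δ sat (by-forward {r} {b} {b′} {a} m h) b∈ with sat b∈ m (here refl)
    ... | s , _ ∷ b′∈ ∷ [] = inj₁ b′ , s , meets-intro ℐ pool (δ b′∈) each
      where
      each : ∀ α m → conceptExt ℐ (onSuccessor r a (λ a′ m → conceptOf (h a′ m)) α m) (inj₁ b′)
      each (conceptA _ _)  m = δ b′∈
      each (roleA r′ x a′) m with r′ ≟ r | x ≟ a
      ... | yes refl | yes refl = holds ℐ B δ sat (h a′ m) b′∈
      ... | yes refl | no _     = δ b′∈
      ... | no _     | _        = δ b′∈
    holds ℐ B δ sat (by-backward {r} {b} {b′} {a} refl m h) b∈ with sat b∈ m (there (here refl))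
    ... | s , b′∈ ∷ _ ∷ [] = inj₁ b′ , s , meets-intro ℐ pool (δ b′∈) each
      where
      each : ∀ α m → conceptExt ℐ (onPredecessor r a (λ a′ m → conceptOf (h a′ m)) α m) (inj₁ b′)
      each (conceptA _ _)  m = δ b′∈
      each (roleA r′ a′ x) m with r′ ≟ r | x ≟ a
      ... | yes refl | yes refl = holds ℐ B δ sat (h a′ m) b′∈
      ... | yes refl | no _     = δ b′∈
      ... | no _     | _        = δ b′∈

  canonical : (as : List Assertion) → ∃[ α ] α ∈ as → Interpretation
  canonical as (α , α∈) = record
    { Other    = ⊥
    ; Δ        = λ { (inj₁ a) → a ∈ concatMap individualsOf as ; (inj₂ ()) }
    ; nonempty = let a , a∈ = someIndividualOf α in inj₁ a , concatMap-∈ individualsOf α∈ a∈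
    ; concept  = λ { A (inj₁ a) → conceptA A a ∈ as ; A (inj₂ ()) }
    ; role     = λ { r (inj₁ a) (inj₁ b) → roleA r a b ∈ as ; r (inj₁ _) (inj₂ ()) ; r (inj₂ ()) _ }
    ; concept⊆ = λ { A {inj₁ a} m → concatMap-∈ individualsOf m (here refl) ; A {inj₂ ()} _ }
    ; role⊆    = λ { r {inj₁ a} {inj₁ b} m → concatMap-∈ individualsOf m (here refl) ,
                                             concatMap-∈ individualsOf m (there (here refl))
                   ; r {inj₁ _} {inj₂ ()} _ ; r {inj₂ ()} _ } }

  module _ {𝓛 : DL} {pool as : List Assertion} (as⊆ : ∀ {α} → α ∈ as → α ∈ pool) (ne : ∃[ α ] α ∈ as) where
    open Distinguishing {𝓛} {pool}

    -- Every edge of the canonical interpretation is a fact, hence a witness `a′` is a reply that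
    -- the strategy has foreseen, and the conjunct made for this reply fails at `a′` by induction.
    fails : ∀ {b a} (d : Distinguished 𝓛 pool b a) → ¬ conceptExt (canonical as ne) (conceptOf d) (inj₁ a)
    fails (by-concept _ ∉pool) m = ∉pool (as⊆ m)
    fails (by-forward {r} {a = a} _ h) (inj₁ a′ , ra , c) =
      fails (h a′ (as⊆ ra)) (pick (meets-elim (canonical as ne) c (as⊆ ra)))
      where
      pick : conceptExt (canonical as ne) (onSuccessor r a (λ a′ m → conceptOf (h a′ m)) (roleA r a a′) (as⊆ ra)) (inj₁ a′) →
             conceptExt (canonical as ne) (conceptOf (h a′ (as⊆ ra))) (inj₁ a′)
      pick x with r ≟ r | a ≟ a
      ... | yes refl | yes refl = x
      ... | no r≢r   | _        = contradiction refl r≢r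
      ... | yes refl | no a≢a   = contradiction refl a≢a
    fails (by-backward {r} {a = a} refl _ h) (inj₁ a′ , ra , c) =
      fails (h a′ (as⊆ ra)) (pick (meets-elim (canonical as ne) c (as⊆ ra)))
      where
      pick : conceptExt (canonical as ne) (onPredecessor r a (λ a′ m → conceptOf (h a′ m)) (roleA r a′ a) (as⊆ ra)) (inj₁ a′) →
             conceptExt (canonical as ne) (conceptOf (h a′ (as⊆ ra))) (inj₁ a′)
      pick x with r ≟ r | a ≟ a
      ... | yes refl | yes refl = x
      ... | no r≢r   | _        = contradiction refl r≢r
      ... | yes refl | no a≢a   = contradiction refl a≢a

  allOf : Examples → List ABox
  allOf E = Examples.positive E ++ Examples.negative E

  module _ {𝓛 : DL} (E : Examples) where
    open Examples E
    open Collection (allOf E) disjoint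

    private
      facts : List Assertion
      facts = concatMap toList positive

      facts⊆pool : ∀ {α} → α ∈ facts → α ∈ pool
      facts⊆pool α∈ with ∈-concatMap toList positive α∈
      ... | 𝒜 , 𝒜∈ , α∈𝒜 = in-pool (∈-++⁺ˡ 𝒜∈) α∈𝒜

      -- An element in the extension lies in the domain (`Δ-of`), so it is an individual of a
      -- positive ABox and has a conjunct of its own, which it fails. The argument `ne` stands for
      -- the existence of the canonical interpretation, whose domain would be empty without positive
      -- facts.
      refute : ∀ {ℬ b} → ℬ ∈ negative → b ∈ individuals ℬ →
               (∀ {𝒜 a} → 𝒜 ∈ positive → a ∈ individuals 𝒜 → Distinguished 𝓛 pool b a) →
               ∃[ C ] ((∀ ne {d} → ¬ conceptExt (canonical facts ne) {𝓛} C d) ×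
                       (∀ ℐ → ModelOfABox ℐ ℬ → ∃[ d ] conceptExt ℐ C d))
      refute {ℬ} {b} ℬ∈ b∈ dist = meets (concatMap individualsOf facts) part , empty , inhabited
        where
        open Distinguishing {𝓛} {pool}
        dist′ : ∀ {a} → a ∈ concatMap individualsOf facts → Distinguished 𝓛 pool b a
        dist′ a∈ with ∈-concatMap individualsOf facts a∈
        ... | α , α∈ , a∈α with ∈-concatMap toList positive α∈
        ... | 𝒜 , 𝒜∈ , α∈𝒜 = dist 𝒜∈ (individual-∈ {𝒜} α∈𝒜 a∈α)
        part : ∀ a → a ∈ concatMap individualsOf facts → Concept 𝓛
        part a a∈ = conceptOf (dist′ a∈)
        Δ-of : ∀ ne C {a} → conceptExt (canonical facts ne) {𝓛} C (inj₁ a) → a ∈ concatMap individualsOf facts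
        Δ-of ne top c            = c
        Δ-of ne (atom A) c       = concatMap-∈ individualsOf c (here refl)
        Δ-of ne (C ⊓ D) (c , _)  = Δ-of ne C c
        Δ-of ne (ex (name r) C) (inj₁ _ , m , _) = concatMap-∈ individualsOf m (here refl)
        Δ-of ne (ex (inv r) C) (inj₁ _ , m , _)  = concatMap-∈ individualsOf m (there (here refl))
        empty : ∀ ne {d} → ¬ conceptExt (canonical facts ne) (meets (concatMap individualsOf facts) part) d
        empty ne {inj₁ a} c = fails facts⊆pool ne (dist′ a∈) (meets-elim (canonical facts ne) c a∈)
          where a∈ = Δ-of ne (meets (concatMap individualsOf facts) part) c
        inhabited : ∀ ℐ → ModelOfABox ℐ ℬ → ∃[ d ] conceptExt ℐ (meets (concatMap individualsOf facts) part) d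
        inhabited ℐ model = inj₁ b , meets-intro ℐ (concatMap individualsOf facts) (named⇒Δ {ℐ} {ℬ} model b∈)
          (λ a a∈ → holds ℐ (_∈ individuals ℬ) (named⇒Δ {ℐ} {ℬ} model)
            (λ {b′} {α} b′∈ α∈ b′∈α →
               let α∈ℬ = own (∈-++⁺ʳ positive ℬ∈) b′∈ α∈ b′∈α
               in All.lookup model α∈ℬ , All.tabulate (λ c∈ → individual-∈ {ℬ} α∈ℬ c∈))
            (dist′ a∈) b∈)

      gather : ∀ {ns} → All (λ ℬ → ∃[ C ] ((∀ ne {d} → ¬ conceptExt (canonical facts ne) {𝓛} C d) ×
                                     (∀ ℐ → ModelOfABox ℐ ℬ → ∃[ d ] conceptExt ℐ C d))) ns →
               ∃[ 𝒪 ] ((∀ ne → ModelOfOntology (canonical facts ne) {𝓛} 𝒪) × All (λ ℬ → ¬ Consistent {𝓛} 𝒪 ℬ) ns)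
      gather [] = [] , (λ _ → []) , []
      gather ((C , empty , inhabited) ∷ rest) with gather rest
      ... | 𝒪 , model , inconsistent =
        (C ⊑ bot) ∷ 𝒪 , (λ ne → (λ c → empty ne c) ∷ model ne) ,
        (λ { (ℐ , sat ∷ _ , m) → sat (proj₂ (inhabited ℐ m)) }) ∷
        All.map (λ { ¬c (ℐ , _ ∷ sats , m) → ¬c (ℐ , sats , m) }) inconsistent

    -- A single interpretation, made of all positive facts, serves every positive ABox and satisfies
    -- all the inclusions, so inclusions for different negative ABoxes cannot interfere.
    distinguished⇒fits :
      (∀ {ℬ} → ℬ ∈ negative → ∃[ b ] b ∈ individuals ℬ ×
         (∀ {𝒜 a} → 𝒜 ∈ positive → a ∈ individuals 𝒜 → Distinguished 𝓛 pool b a)) →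
      ∃[ 𝒪 ] Fits {𝓛} 𝒪 E
    distinguished⇒fits h
      with gather (All.tabulate (λ ℬ∈ → let b , b∈ , d = h ℬ∈ in refute ℬ∈ b∈ d))
    ... | 𝒪 , model , inconsistent = 𝒪 , All.tabulate consistent , inconsistent
      where
      consistent : ∀ {𝒜} → 𝒜 ∈ positive → Consistent 𝒪 𝒜
      consistent {𝒜@(α ∷ _)} 𝒜∈ = canonical facts ne , model ne , All.tabulate satisfied
        where
        ne : ∃[ α ] α ∈ facts
        ne = α , concatMap-∈ toList 𝒜∈ (here refl)
        satisfied : ∀ {β} → β ∈ toList 𝒜 → SatisfiesAssertion (canonical facts ne) β
        satisfied {conceptA A a} m = concatMap-∈ toList 𝒜∈ m
        satisfied {roleA r a b}  m = concatMap-∈ toList 𝒜∈ m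

  -- From simulations to models of the negative ABox: the power construction

  record Simulation (𝓛 : DL) (pool : List Assertion) (S : N-I → N-I → Set) : Set where
    field
      concepts : ∀ {A b a} → S b a → conceptA A b ∈ pool → conceptA A a ∈ pool
      forward  : ∀ {r b b′ a} → S b a → roleA r b b′ ∈ pool → ∃[ a′ ] roleA r a a′ ∈ pool × S b′ a′
      backward : 𝓛 ≡ ELI⊥ → ∀ {r b b′ a} → S b a → roleA r b′ b ∈ pool → ∃[ a′ ] roleA r a′ a ∈ pool × S b′ a′

  -- The model of ℬ consists of copies of powers of the positive models: an
  -- element over b is a choice of an element of the model of 𝒜 for every
  -- individual a of a positive 𝒜 that simulates b, and b itself acts as the
  -- choice of all these a.  Concepts are evaluated componentwise.
  module Power {𝓛 : DL} (E : Examples) (S : N-I → N-I → Set) (𝒪 : Ontology 𝓛)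
    (sim : Simulation 𝓛 (Collection.pool (allOf E) (Examples.disjoint E)) S)
    (consistent : All (Consistent 𝒪) (Examples.positive E))
    {ℬ : ABox} (ℬ∈ : ℬ ∈ Examples.negative E)
    (simulated : ∀ {b} → b ∈ individuals ℬ → ∃[ 𝒜 ] 𝒜 ∈ Examples.positive E × (∃[ a ] a ∈ individuals 𝒜 × S b a))
    where
    open Examples E
    open Collection (allOf E) disjoint
    open Simulation sim

    record Index (b : N-I) : Set where
      constructor index
      field
        {box}      : ABox
        box∈       : box ∈ positive
        {image}    : N-I
        image∈     : image ∈ individuals box
        simulation : S b image

    open Index

    model : ∀ {b} → Index b → Interpretation
    model τ = proj₁ (All.lookup consistent (box∈ τ))

    sat-𝒪 : ∀ {b} (τ : Index b) → ModelOfOntology (model τ) 𝒪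
    sat-𝒪 τ = proj₁ (proj₂ (All.lookup consistent (box∈ τ)))

    sat-box : ∀ {b} (τ : Index b) → ModelOfABox (model τ) (box τ)
    sat-box τ = proj₂ (proj₂ (All.lookup consistent (box∈ τ)))

    Choice : Set
    Choice = Σ N-I λ b → (τ : Index b) → Interpretation.Element (model τ)

    choice : N-I ⊎ Choice → Choice
    choice (inj₁ b) = b , λ τ → inj₁ (image τ)
    choice (inj₂ c) = c

    -- Pointwise edges need a common index set and hence stay over one `b`; the equations for
    -- `choice` let named elements take part in them. An edge of `ℬ` may join individuals with
    -- different index sets, so it is entered as asserted.
    data Related (r : N-R) : N-I ⊎ Choice → N-I ⊎ Choice → Set where
      pointwise : ∀ {x y b f g} → choice x ≡ (b , f) → choice y ≡ (b , g) → b ∈ individuals ℬ →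
                  (∀ τ → Interpretation.role (model τ) r (f τ) (g τ)) → Related r x y
      asserted  : ∀ {b b′} → roleA r b b′ ∈ toList ℬ → Related r (inj₁ b) (inj₁ b′)

    Everywhere : (∀ {b} (τ : Index b) → Interpretation.Element (model τ) → Set) → N-I ⊎ Choice → Set
    Everywhere P x = proj₁ (choice x) ∈ individuals ℬ × (∀ τ → P τ (proj₂ (choice x) τ))

    named-Δ : ∀ {b} → b ∈ individuals ℬ → Everywhere (λ τ → Interpretation.Δ (model τ)) (inj₁ b)
    named-Δ b∈ = b∈ , λ τ → named⇒Δ {model τ} {box τ} (sat-box τ) (image∈ τ)

    power : Interpretation
    power = record
      { Other    = Choice
      ; Δ        = Everywhere (λ τ → Interpretation.Δ (model τ))
      ; nonempty = inhabited ℬ refl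
      ; concept  = λ A → Everywhere (λ τ → Interpretation.concept (model τ) A)
      ; role     = Related
      ; concept⊆ = λ { A (b∈ , c) → b∈ , λ τ → Interpretation.concept⊆ (model τ) A (c τ) }
      ; role⊆    = related⊆ }
      where
      inhabited : ∀ 𝒜 → 𝒜 ≡ ℬ → ∃[ x ] Everywhere (λ τ → Interpretation.Δ (model τ)) x
      inhabited (α ∷ _) refl = let a , a∈ = someIndividualOf α in inj₁ a , named-Δ (individual-∈ {ℬ} (here refl) a∈)
      related⊆ : ∀ r {x y} → Related r x y →
                 Everywhere (λ τ → Interpretation.Δ (model τ)) x × Everywhere (λ τ → Interpretation.Δ (model τ)) y
      related⊆ r {x} {y} (pointwise e e′ b∈ h) =
        at x e (λ τ → proj₁ (Interpretation.role⊆ (model τ) r (h τ))) ,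
        at y e′ (λ τ → proj₂ (Interpretation.role⊆ (model τ) r (h τ)))
        where
        at : ∀ z {f} → choice z ≡ (_ , f) → (∀ τ → Interpretation.Δ (model τ) (f τ)) →
             Everywhere (λ τ → Interpretation.Δ (model τ)) z
        at z e h with choice z | e
        ... | _ | refl = b∈ , h
      related⊆ r (asserted m) =
        named-Δ (individual-∈ {ℬ} m (here refl)) , named-Δ (individual-∈ {ℬ} m (there (here refl)))

    image-∈ : ∀ {b b′ α} (τ : Index b) → α ∈ pool → image τ ∈ individualsOf α → b′ ∈ individualsOf α → b′ ∈ individuals (box τ)
    image-∈ τ α∈ m m′ = individual-∈ {box τ} (own (∈-++⁺ˡ (box∈ τ)) (image∈ τ) α∈ m) m′

    satisfied : ∀ {b α} (τ : Index b) → α ∈ pool → image τ ∈ individualsOf α → SatisfiesAssertion (model τ) α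
    satisfied τ α∈ m = All.lookup (sat-box τ) (own (∈-++⁺ˡ (box∈ τ)) (image∈ τ) α∈ m)

    ℬ-pool : ∀ {α} → α ∈ toList ℬ → α ∈ pool
    ℬ-pool = in-pool (∈-++⁺ʳ positive ℬ∈)

    componentwise : ∀ (C : Concept 𝓛) x → conceptExt power C x → Everywhere (λ τ → conceptExt (model τ) C) x
    combined      : ∀ (C : Concept 𝓛) x → Everywhere (λ τ → conceptExt (model τ) C) x → conceptExt power C x

    componentwise top      x c = c
    componentwise (atom A) x c = c
    componentwise (C ⊓ D) x (c , d) =
      proj₁ (componentwise C x c) , λ τ → proj₂ (componentwise C x c) τ , proj₂ (componentwise D x d) τ
    componentwise (ex (name r) C) x (y , pointwise e e′ b∈ h , c) with choice x | e | choice y | e′ | componentwise C y c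
    ... | _ | refl | (_ , g) | refl | _ , cs = b∈ , λ τ → g τ , h τ , cs τ
    componentwise (ex (name r) C) .(inj₁ _) (.(inj₁ _) , asserted {b} {b′} m , c) =
      individual-∈ {ℬ} m (here refl) , λ τ →
        case forward (simulation τ) (ℬ-pool m) of λ { (a′ , m′ , s) →
        inj₁ a′ , satisfied τ m′ (here refl) ,
        -- The edge at `image τ` answering the asserted one lies in the same box, so its end is an
        -- index for `b′`. Reusing `box∈ τ` makes the model at that index definitionally `model τ`.
        proj₂ (componentwise C (inj₁ b′) c) (index (box∈ τ) (image-∈ τ m′ (here refl) (there (here refl))) s) }
    componentwise (ex (inv r) C) x (y , pointwise e e′ b∈ h , c) with choice y | e | choice x | e′ | componentwise C y c
    ... | (_ , g) | refl | _ | refl | _ , cs = b∈ , λ τ → g τ , h τ , cs τ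
    componentwise (ex (inv r) C) .(inj₁ _) (.(inj₁ _) , asserted {b} {b′} m , c) =
      individual-∈ {ℬ} m (there (here refl)) , λ τ →
        case backward refl (simulation τ) (ℬ-pool m) of λ { (a′ , m′ , s) →
        inj₁ a′ , satisfied τ m′ (there (here refl)) ,
        proj₂ (componentwise C (inj₁ b) c) (index (box∈ τ) (image-∈ τ m′ (there (here refl)) (here refl)) s) }

    combined top      x c = c
    -- Over an individual without index everything would hold vacuously, `bot` included; simulation
    -- by some positive individual supplies an index.
    combined bot      x (b∈ , c) with simulated b∈
    ... | 𝒜 , 𝒜∈ , a , a∈ , s = c (index 𝒜∈ a∈ s)
    combined (atom A) x c = c
    combined (C ⊓ D) x (b∈ , c) = combined C x (b∈ , λ τ → proj₁ (c τ)) , combined D x (b∈ , λ τ → proj₂ (c τ))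
    -- The witnesses in all components form a new element over the same individual.
    combined (ex (name r) C) x (b∈ , c) =
      inj₂ (proj₁ (choice x) , λ τ → proj₁ (c τ)) ,
      pointwise refl refl b∈ (λ τ → proj₁ (proj₂ (c τ))) ,
      combined C _ (b∈ , λ τ → proj₂ (proj₂ (c τ)))
    combined (ex (inv r) C) x (b∈ , c) =
      inj₂ (proj₁ (choice x) , λ τ → proj₁ (c τ)) ,
      pointwise refl refl b∈ (λ τ → proj₁ (proj₂ (c τ))) ,
      combined C _ (b∈ , λ τ → proj₂ (proj₂ (c τ)))

    power-consistent : Consistent 𝒪 ℬ
    power-consistent = power , All.tabulate (λ {i} → inclusion i) , All.tabulate (λ {α} → assertion α)
      where
      inclusion : ∀ i → i ∈ 𝒪 → SatisfiesInclusion power i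
      inclusion (C ⊑ D) m {x} c =
        let b∈ , cs = componentwise C x c in combined D x (b∈ , λ τ → All.lookup (sat-𝒪 τ) m (cs τ))
      assertion : ∀ α → α ∈ toList ℬ → SatisfiesAssertion power α
      assertion (conceptA A b) m =
        individual-∈ {ℬ} m (here refl) , λ τ → satisfied τ (concepts (simulation τ) (ℬ-pool m)) (here refl)
      assertion (roleA r b b′) m = asserted m

  simulated⇒¬fits : ∀ {𝓛} (E : Examples) {S} → let open Examples E in
    Simulation 𝓛 (Collection.pool (allOf E) disjoint) S →
    ∀ {ℬ} → ℬ ∈ negative →
    (∀ {b} → b ∈ individuals ℬ → ∃[ 𝒜 ] 𝒜 ∈ positive × (∃[ a ] a ∈ individuals 𝒜 × S b a)) →
    ∀ 𝒪 → ¬ Fits {𝓛} 𝒪 E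
  simulated⇒¬fits E {S} sim ℬ∈ simulated 𝒪 (consistent , inconsistent) =
    All.lookup inconsistent ℬ∈ (Power.power-consistent E S 𝒪 sim consistent ℬ∈ simulated)

-- Positions in a word versus tokens of an encoding

module Tokens where

  import Data.List.Relation.Unary.All.Properties as All
  open import Data.Nat.Binary using (zero; 2[1+_]; 1+[2_]; fromℕ; toℕ)
  open import Data.Nat.Binary.Properties using (fromℕ-toℕ; fromℕ-injective)

  open Tapes using (W; Zip; word)
  open Computations
  open Algorithm
  open Simulations

  ∧-true : ∀ {a b} → a ∧ b ≡ true → a ≡ true × b ≡ true
  ∧-true {true} e = refl , e

  ∧-false : ∀ {a b} → a ∧ b ≡ false → a ≡ true → b ≡ false
  ∧-false e refl = e

  ∨-true : ∀ {a b} → a ∨ b ≡ true → a ≡ true ⊎ b ≡ true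
  ∨-true {true}  e = inj₁ refl
  ∨-true {false} e = inj₂ e

  ∨-false : ∀ {a b} → a ∨ b ≡ false → a ≡ false × b ≡ false
  ∨-false {false} e = refl , e

  not-true : ∀ {a} → not a ≡ true → a ≡ false
  not-true {false} _ = refl

  not-false : ∀ {a} → not a ≡ false → a ≡ true
  not-false {true} _ = refl

  true≢false : ∀ {b} → b ≡ true → b ≢ false
  true≢false refl ()

  record Named (z : Zip) (a : N-I) : Set where
    constructor named
    field
      {rest} : W
      start  : proj₂ z ≡ encodeName a ++ rest

  unfold-name : ∀ a r → encodeName a ++ r ≡ digits (fromℕ a) ++ endName ∷ r
  unfold-name a r = ++-assoc (digits (fromℕ a)) [ endName ] r

  -- The closing `endName` makes numerals prefix-free, so a position determines the name that begins
  -- there.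
  digits-cancel : ∀ m n {r r′} → digits m ++ endName ∷ r ≡ digits n ++ endName ∷ r′ → m ≡ n
  digits-cancel zero     zero     e = refl
  digits-cancel 1+[2 m ] 1+[2 n ] e = cong 1+[2_] (digits-cancel m n (∷-injectiveʳ e))
  digits-cancel 2[1+ m ] 2[1+ n ] e = cong 2[1+_] (digits-cancel m n (∷-injectiveʳ e))

  Named-unique : ∀ {z a b} → Named z a → Named z b → a ≡ b
  Named-unique {z} {a} {b} (named {r} e) (named {r′} e′) =
    fromℕ-injective (digits-cancel (fromℕ a) (fromℕ b)
      (trans (sym (unfold-name a r)) (trans (trans (sym e) e′) (unfold-name b r′))))

  digits-named : ∀ z n {r} → proj₂ z ≡ digits n ++ endName ∷ r → Named z (toℕ n)
  digits-named z n {r} e =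
    named (trans e (sym (trans (unfold-name (toℕ n) r) (cong (λ m → digits m ++ endName ∷ r) (fromℕ-toℕ n)))))

  bothDigit-true : ∀ c d → bothDigit c d ≡ true → c ≡ d × (c ≡ one ⊎ c ≡ two)
  bothDigit-true one one _ = refl , inj₁ refl
  bothDigit-true two two _ = refl , inj₂ refl

  bothEnd-true : ∀ c d → bothEnd c d ≡ true → c ≡ endName × d ≡ endName
  bothEnd-true endName endName _ = refl , refl

  sameName-true : ∀ s s′ → sameName s s′ ≡ true →
                  ∃[ n ] ∃[ r ] ∃[ r′ ] s ≡ digits n ++ endName ∷ r × s′ ≡ digits n ++ endName ∷ r′
  sameName-true (c ∷ s) (d ∷ s′) e with bothDigit c d in eq
  ... | false with bothEnd-true c d e
  ...   | refl , refl = zero , s , s′ , refl , refl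
  sameName-true (c ∷ s) (d ∷ s′) e | true with bothDigit-true c d eq | sameName-true s s′ e
  ... | refl , inj₁ refl | n , r , r′ , refl , refl = 1+[2 n ] , r , r′ , refl , refl
  ... | refl , inj₂ refl | n , r , r′ , refl , refl = 2[1+ n ] , r , r′ , refl , refl

  same-true : ∀ x y → same x y ≡ true → ∃[ a ] Named x a × Named y a
  same-true x y e with sameName-true (proj₂ x) (proj₂ y) e
  ... | n , r , r′ , e₁ , e₂ = toℕ n , digits-named x n e₁ , digits-named y n e₂

  sameName-digits : ∀ n r r′ → sameName (digits n ++ endName ∷ r) (digits n ++ endName ∷ r′) ≡ true
  sameName-digits zero     r r′ = refl
  sameName-digits 1+[2 n ] r r′ = sameName-digits n r r′
  sameName-digits 2[1+ n ] r r′ = sameName-digits n r r′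

  same-intro : ∀ {x y a} → Named x a → Named y a → same x y ≡ true
  same-intro {a = a} (named {r} e) (named {r′} e′) =
    trans (cong₂ sameName (trans e (unfold-name a r)) (trans e′ (unfold-name a r′))) (sameName-digits (fromℕ a) r r′)

  same-names : ∀ x y {a} → same x y ≡ true → Named x a → Named y a
  same-names x y e n with same-true x y e
  ... | b , nx , ny = subst (Named y) (Named-unique nx n) ny

  -- Positions visited by a search from the first zipper that stops at q.
  data Visible (q : Symbol → Bool) : Zip → Zip → Set where
    now   : ∀ {p c s} → q c ≡ false → Visible q (p , c ∷ s) (p , c ∷ s)
    later : ∀ {p c s z} → q c ≡ false → Visible q (c ∷ p , s) z → Visible q (p , c ∷ s) z

  visible-word : ∀ {q z z′} → Visible q z z′ → word z′ ≡ word z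
  visible-word (now _)     = refl
  visible-word (later _ v) = visible-word v

  some-true : ∀ q p s f → someFrom q p s f ≡ true → ∃[ z ] Visible q (p , s) z × f z ≡ true
  some-true q p (c ∷ s) f e with q c in qc
  ... | false with f (p , c ∷ s) in fc
  ...   | true  = _ , now qc , fc
  ...   | false with some-true q (c ∷ p) s f e
  ...     | z , v , h = z , later qc v , h

  some-intro : ∀ {q p s z} f → Visible q (p , s) z → f z ≡ true → someFrom q p s f ≡ true
  some-intro f (now qc) h rewrite qc | h = refl
  some-intro {q} {p} {c ∷ s} f (later qc v) h rewrite qc with f (p , c ∷ s)
  ... | true  = refl
  ... | false = some-intro f v h

  some-false : ∀ {q z₀ z} f → some q z₀ f ≡ false → Visible q z₀ z → f z ≡ false
  some-false {z = z} f e v with f z in h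
  ... | false = refl
  ... | true  = contradiction e (true≢false (some-intro f v h))

  -- Tags never occur inside names; cutting an encoding at its tags therefore turns searches over
  -- positions into searches over a list of tokens.
  data Token : Set where
    block : Bool → Token
    fact  : Assertion → Token

  tag : Token → Symbol
  tag (block true)          = positiveTag
  tag (block false)         = negativeTag
  tag (fact (conceptA _ _)) = conceptTag
  tag (fact (roleA _ _ _))  = roleTag

  content : Token → W
  content (block _)             = []
  content (fact (conceptA A a)) = encodeName A ++ encodeName a
  content (fact (roleA r a b))  = encodeName r ++ encodeName a ++ encodeName b

  tokens⇒word : List Token → W
  tokens⇒word []       = []
  tokens⇒word (t ∷ ts) = tag t ∷ content t ++ tokens⇒word ts

  isTag-tag : ∀ t → isTag (tag t) ≡ true
  isTag-tag (block true)          = refl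
  isTag-tag (block false)         = refl
  isTag-tag (fact (conceptA _ _)) = refl
  isTag-tag (fact (roleA _ _ _))  = refl

  Untagged : W → Set
  Untagged = All (λ c → isTag c ≡ false)

  digits-untagged : ∀ n → Untagged (digits n)
  digits-untagged zero     = []
  digits-untagged 1+[2 n ] = refl ∷ digits-untagged n
  digits-untagged 2[1+ n ] = refl ∷ digits-untagged n

  name-untagged : ∀ a → Untagged (encodeName a)
  name-untagged a = All.++⁺ (digits-untagged (fromℕ a)) (refl ∷ [])

  content-untagged : ∀ t → Untagged (content t)
  content-untagged (block _)             = []
  content-untagged (fact (conceptA A a)) = All.++⁺ (name-untagged A) (name-untagged a)
  content-untagged (fact (roleA r a b))  = All.++⁺ (name-untagged r) (All.++⁺ (name-untagged a) (name-untagged b))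

  PassesNames : (Symbol → Bool) → Set
  PassesNames q = ∀ c → isTag c ≡ false → q c ≡ false

  never-passes : PassesNames never
  never-passes _ _ = refl

  isBlock-passes : PassesNames isBlock
  isBlock-passes c e = proj₁ (∨-false {isBlock c} e)

  visible-skip : ∀ {q} → PassesNames q → ∀ {u p r z} → Untagged u → Visible q (u ʳ++ p , r) z → Visible q (p , u ++ r) z
  visible-skip pn []       v = v
  visible-skip pn (c ∷ cs) v = later (pn _ c) (visible-skip pn cs v)

  -- A position carrying a tag cannot lie in the untagged stretch.
  visible-unskip : ∀ {q u p r z} → Untagged u → Visible q (p , u ++ r) z → peek isTag false z ≡ true → Visible q (u ʳ++ p , r) z
  visible-unskip []       v           h = v
  visible-unskip (c ∷ cs) (now _)     h = contradiction c (true≢false h)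
  visible-unskip (c ∷ cs) (later _ v) h = visible-unskip cs v h

  -- The counterpart of `Visible` for tokens: the search is stopped neither before `t` nor at it.
  -- The last index is what follows `t`, so that a further search can start there.
  data Occurs (q : Symbol → Bool) : List Token → Token → List Token → Set where
    first : ∀ {t ts} → q (tag t) ≡ false → Occurs q (t ∷ ts) t ts
    after : ∀ {t u ts r} → q (tag u) ≡ false → Occurs q ts t r → Occurs q (u ∷ ts) t r

  visible⇒occurs : ∀ {q} p ts {z} → Visible q (p , tokens⇒word ts) z → peek isTag false z ≡ true →
                   ∃[ t ] ∃[ r ] Occurs q ts t r × proj₂ z ≡ tokens⇒word (t ∷ r)
  visible⇒occurs p (t ∷ ts) (now qt)     h = t , ts , first qt , refl
  visible⇒occurs p (t ∷ ts) (later qt v) h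
    with visible⇒occurs (content t ʳ++ (tag t ∷ p)) ts (visible-unskip (content-untagged t) v h) h
  ... | t′ , r , o , e = t′ , r , after qt o , e

  occurs⇒visible : ∀ {q ts t r} → PassesNames q → Occurs q ts t r → ∀ p →
                   ∃[ z ] Visible q (p , tokens⇒word ts) z × proj₂ z ≡ tokens⇒word (t ∷ r)
  occurs⇒visible pn (first qt)              p = _ , now qt , refl
  occurs⇒visible pn (after {u = u} qu o) p with occurs⇒visible pn o (content u ʳ++ (tag u ∷ p))
  ... | z , v , e = z , later qu (visible-skip pn (content-untagged u) v) , e

  seek-digits : ∀ n p r → proj₂ (seekFrom (not ∘ isDigit) p (digits n ++ endName ∷ r)) ≡ endName ∷ r
  seek-digits zero     p r = refl
  seek-digits 1+[2 n ] p r = seek-digits n (one ∷ p) r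
  seek-digits 2[1+ n ] p r = seek-digits n (two ∷ p) r

  find-end : ∀ z a {r} → proj₂ z ≡ encodeName a ++ r → proj₂ (move fnd z) ≡ endName ∷ r
  find-end (p , s) a {r} e rewrite trans e (unfold-name a r) = seek-digits (fromℕ a) p r

  next-suffix : ∀ z {c s} → proj₂ z ≡ c ∷ s → proj₂ (next z) ≡ s
  next-suffix (p , _ ∷ _) e = ∷-injectiveʳ e

  skip-name : ∀ z a {r} → proj₂ z ≡ encodeName a ++ r → proj₂ (next (move fnd z)) ≡ r
  skip-name z a e = next-suffix (move fnd z) (find-end z a e)

  names₂ : ∀ a b r → (encodeName a ++ encodeName b) ++ r ≡ encodeName a ++ (encodeName b ++ r)
  names₂ a b r = ++-assoc (encodeName a) (encodeName b) r

  names₃ : ∀ a b c r → (encodeName a ++ encodeName b ++ encodeName c) ++ r ≡ encodeName a ++ (encodeName b ++ (encodeName c ++ r))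
  names₃ a b c r = trans (++-assoc (encodeName a) _ r) (cong (encodeName a ++_) (names₂ b c r))

  At : Zip → Token → List Token → Set
  At z t r = proj₂ z ≡ tokens⇒word (t ∷ r)

  concept-suffixes : ∀ z {A a r} → At z (fact (conceptA A a)) r →
    proj₂ (nav path₁ z) ≡ encodeName A ++ (encodeName a ++ tokens⇒word r) ×
    proj₂ (nav path₂ z) ≡ encodeName a ++ tokens⇒word r
  concept-suffixes z {A} {a} {r} e = e₁ , skip-name (next z) A e₁
    where e₁ = trans (next-suffix z e) (names₂ A a (tokens⇒word r))

  concept-names : ∀ z {A a r} → At z (fact (conceptA A a)) r → Named (nav path₁ z) A × Named (nav path₂ z) a
  concept-names z {A} {a} {r} e =
    named (proj₁ (concept-suffixes z {A} {a} {r} e)) , named (proj₂ (concept-suffixes z {A} {a} {r} e))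

  role-suffixes : ∀ z {R a b r} → At z (fact (roleA R a b)) r →
    proj₂ (nav path₁ z) ≡ encodeName R ++ (encodeName a ++ (encodeName b ++ tokens⇒word r)) ×
    proj₂ (nav path₂ z) ≡ encodeName a ++ (encodeName b ++ tokens⇒word r) ×
    proj₂ (nav path₃ z) ≡ encodeName b ++ tokens⇒word r
  role-suffixes z {R} {a} {b} {r} e = e₁ , e₂ , skip-name (nav path₂ z) a e₂
    where
    e₁ = trans (next-suffix z e) (names₃ R a b (tokens⇒word r))
    e₂ = skip-name (next z) R e₁

  role-names : ∀ z {R a b r} → At z (fact (roleA R a b)) r →
               Named (nav path₁ z) R × Named (nav path₂ z) a × Named (nav path₃ z) b
  role-names z {R} {a} {b} {r} e with role-suffixes z {R} {a} {b} {r} e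
  ... | e₁ , e₂ , e₃ = named e₁ , named e₂ , named e₃

  peek-at : ∀ q d z {t r} → At z t r → peek q d z ≡ q (tag t)
  peek-at q d (p , _ ∷ _) refl = refl

  individual-true : ∀ z f {t r} → At z t r → someIndividual z f ≡ true →
    ∃[ α ] ∃[ a ] ∃[ x ] t ≡ fact α × a ∈ individualsOf α × Named x a × word x ≡ word z × f x ≡ true
  individual-true (p , _) f {block true}  refl ()
  individual-true (p , _) f {block false} refl ()
  individual-true (p , _) f {fact (conceptA A a)} {r} refl h =
    conceptA A a , a , nav path₂ z , refl , here refl , proj₂ (concept-names z {A} {a} {r} refl) , word-nav path₂ z , h
    where z = p , tokens⇒word (fact (conceptA A a) ∷ r)
  individual-true (p , _) f {fact (roleA R a b)} {r} refl h =
    case ∨-true h of λ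
      { (inj₁ h₁) → roleA R a b , a , nav path₂ z , refl , here refl , proj₁ (proj₂ names) , word-nav path₂ z , h₁
      ; (inj₂ h₂) → roleA R a b , b , nav path₃ z , refl , there (here refl) , proj₂ (proj₂ names) , word-nav path₃ z , h₂ }
    where
    z = p , tokens⇒word (fact (roleA R a b) ∷ r)
    names = role-names z {R} {a} {b} {r} refl

  individual-false : ∀ z f {α r a} → At z (fact α) r → someIndividual z f ≡ false → a ∈ individualsOf α →
                     ∃[ x ] Named x a × word x ≡ word z × f x ≡ false
  individual-false (p , _) f {conceptA A a} {r} refl h (here refl) =
    nav path₂ z , proj₂ (concept-names z {A} {a} {r} refl) , word-nav path₂ z , h
    where z = p , tokens⇒word (fact (conceptA A a) ∷ r)
  individual-false (p , _) f {roleA R a b} {r} refl h (here refl) =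
    nav path₂ z , proj₁ (proj₂ (role-names z {R} {a} {b} {r} refl)) , word-nav path₂ z , proj₁ (∨-false h)
    where z = p , tokens⇒word (fact (roleA R a b) ∷ r)
  individual-false (p , _) f {roleA R a b} {r} refl h (there (here refl)) =
    nav path₃ z , proj₂ (proj₂ (role-names z {R} {a} {b} {r} refl)) , word-nav path₃ z , proj₂ (∨-false h)
    where z = p , tokens⇒word (fact (roleA R a b) ∷ r)

  individual-tag : ∀ z f → someIndividual z f ≡ true → peek isTag false z ≡ true
  individual-tag (p , conceptTag ∷ s) f h = refl
  individual-tag (p , roleTag ∷ s)    f h = refl

  facts : List Token → List Assertion
  facts []             = []
  facts (block _ ∷ ts) = facts ts
  facts (fact α ∷ ts)  = α ∷ facts ts

  occurs⇒fact : ∀ {q ts α r} → Occurs q ts (fact α) r → α ∈ facts ts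
  occurs⇒fact (first _)                 = here refl
  occurs⇒fact (after {u = block _} _ o) = occurs⇒fact o
  occurs⇒fact (after {u = fact _} _ o)  = there (occurs⇒fact o)

  fact⇒occurs : ∀ ts {α} → α ∈ facts ts → ∃[ r ] Occurs never ts (fact α) r
  fact⇒occurs (block _ ∷ ts) m with fact⇒occurs ts m
  ... | r , o = r , after refl o
  fact⇒occurs (fact _ ∷ ts) (here refl) = ts , first refl
  fact⇒occurs (fact _ ∷ ts) (there m) with fact⇒occurs ts m
  ... | r , o = r , after refl o

  Box : Set
  Box = Bool × ABox

  boxTokens : Box → List Token
  boxTokens (b , 𝒜) = block b ∷ map fact (toList 𝒜)

  tokens : List Box → List Token
  tokens = concatMap boxTokens

  boxes : List ABox → List ABox → List Box
  boxes P N = map (true ,_) P ++ map (false ,_) N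

  tokens⇒word-++ : ∀ ts us → tokens⇒word (ts ++ us) ≡ tokens⇒word ts ++ tokens⇒word us
  tokens⇒word-++ []       us = refl
  tokens⇒word-++ (t ∷ ts) us =
    cong (tag t ∷_) (trans (cong (content t ++_) (tokens⇒word-++ ts us)) (sym (++-assoc (content t) _ _)))

  assertion-word : ∀ α → encodeAssertion α ≡ tag (fact α) ∷ content (fact α)
  assertion-word (conceptA _ _) = refl
  assertion-word (roleA _ _ _)  = refl

  assertions-word : ∀ as → concatMap encodeAssertion as ≡ tokens⇒word (map fact as)
  assertions-word []       = refl
  assertions-word (α ∷ as) = cong₂ _++_ (assertion-word α) (assertions-word as)

  positives-word : ∀ P → concatMap (λ 𝒜 → positiveTag ∷ encodeABox 𝒜) P ≡ tokens⇒word (tokens (map (true ,_) P))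
  positives-word []      = refl
  positives-word (𝒜 ∷ P) =
    trans (cong₂ (λ u v → positiveTag ∷ u ++ v) (assertions-word (toList 𝒜)) (positives-word P))
          (sym (tokens⇒word-++ (boxTokens (true , 𝒜)) (tokens (map (true ,_) P))))

  negatives-word : ∀ N → concatMap (λ 𝒜 → negativeTag ∷ encodeABox 𝒜) N ≡ tokens⇒word (tokens (map (false ,_) N))
  negatives-word []      = refl
  negatives-word (𝒜 ∷ N) =
    trans (cong₂ (λ u v → negativeTag ∷ u ++ v) (assertions-word (toList 𝒜)) (negatives-word N))
          (sym (tokens⇒word-++ (boxTokens (false , 𝒜)) (tokens (map (false ,_) N))))

  encodeLists : List ABox → List ABox → W
  encodeLists P N = concatMap (λ 𝒜 → positiveTag ∷ encodeABox 𝒜) P ++ concatMap (λ 𝒜 → negativeTag ∷ encodeABox 𝒜) N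

  encode-tokens : ∀ P N → encodeLists P N ≡ tokens⇒word (tokens (boxes P N))
  encode-tokens P N =
    trans (cong₂ _++_ (positives-word P) (negatives-word N))
          (trans (sym (tokens⇒word-++ (tokens (map (true ,_) P)) (tokens (map (false ,_) N))))
                 (cong tokens⇒word (sym (concatMap-++ boxTokens (map (true ,_) P) (map (false ,_) N)))))

  facts-++ : ∀ as ts → facts (map fact as ++ ts) ≡ as ++ facts ts
  facts-++ []       ts = refl
  facts-++ (α ∷ as) ts = cong (α ∷_) (facts-++ as ts)

  facts-tokens : ∀ bs → facts (tokens bs) ≡ concatMap (toList ∘ proj₂) bs
  facts-tokens []             = refl
  facts-tokens ((_ , 𝒜) ∷ bs) = trans (facts-++ (toList 𝒜) (tokens bs)) (cong (toList 𝒜 ++_) (facts-tokens bs))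

  occurs-past : ∀ {q t r} as {ts} → (∀ α → q (tag (fact α)) ≡ false) → Occurs q ts t r → Occurs q (map fact as ++ ts) t r
  occurs-past []       h o = o
  occurs-past (α ∷ as) h o = after (h α) (occurs-past as h o)

  occurs-in : ∀ {q α as} ts → (∀ α → q (tag (fact α)) ≡ false) → α ∈ as →
              ∃[ as′ ] Occurs q (map fact as ++ ts) (fact α) (map fact as′ ++ ts)
  occurs-in {as = α ∷ as} ts h (here refl) = as , first (h α)
  occurs-in {as = α ∷ as} ts h (there m) with occurs-in ts h m
  ... | r , o = r , after (h α) o

  occurs-block : ∀ {q b r} as {ts} → Occurs q (map fact as ++ ts) (block b) r → Occurs q ts (block b) r
  occurs-block []       o           = o
  occurs-block (_ ∷ as) (after _ o) = occurs-block as o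

  isBlock-fact : ∀ α → isBlock (tag (fact α)) ≡ false
  isBlock-fact (conceptA _ _) = refl
  isBlock-fact (roleA _ _ _)  = refl

  occurs-box : ∀ bs {b r} → Occurs never (tokens bs) (block b) r →
               ∃[ 𝒜 ] ∃[ bs′ ] (b , 𝒜) ∈ bs × r ≡ map fact (toList 𝒜) ++ tokens bs′
  occurs-box ((b , 𝒜) ∷ bs) (first _) = 𝒜 , bs , here refl , refl
  occurs-box ((b , 𝒜) ∷ bs) (after _ o) with occurs-box bs (occurs-block (toList 𝒜) o)
  ... | ℬ , bs′ , m , e = ℬ , bs′ , there m , e

  box-occurs : ∀ bs {b 𝒜} → (b , 𝒜) ∈ bs →
               ∃[ bs′ ] Occurs never (tokens bs) (block b) (map fact (toList 𝒜) ++ tokens bs′)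
  box-occurs ((b , 𝒜) ∷ bs) (here refl) = bs , first refl
  box-occurs ((b , 𝒜) ∷ bs) (there m) with box-occurs bs m
  ... | bs′ , o = bs′ , after refl (occurs-past (toList 𝒜) (λ _ → refl) o)

  -- Every later box begins with a block tag, which confines the search to the box where it started.
  occurs-until : ∀ as bs {α r} → Occurs isBlock (map fact as ++ tokens bs) (fact α) r → α ∈ as
  occurs-until []       ((true , _) ∷ _)  (after () _)
  occurs-until []       ((false , _) ∷ _) (after () _)
  occurs-until (_ ∷ as) bs                (first _)   = here refl
  occurs-until (_ ∷ as) bs                (after _ o) = there (occurs-until as bs o)

  negative-boxes : ∀ {P N 𝒜} → (false , 𝒜) ∈ boxes P N → 𝒜 ∈ N
  negative-boxes {P} m with ∈-++⁻ (map (true ,_) P) m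
  ... | inj₁ m′ with ∈-map⁻ (true ,_) m′
  ...   | _ , _ , ()
  negative-boxes {P} m | inj₂ m′ with ∈-map⁻ (false ,_) m′
  ... | _ , m″ , refl = m″

  positive-boxes : ∀ {P N 𝒜} → (true , 𝒜) ∈ boxes P N → 𝒜 ∈ P
  positive-boxes {P} m with ∈-++⁻ (map (true ,_) P) m
  ... | inj₂ m′ with ∈-map⁻ (false ,_) m′
  ...   | _ , _ , ()
  positive-boxes {P} m | inj₁ m′ with ∈-map⁻ (true ,_) m′
  ... | _ , m″ , refl = m″

  boxes-positive : ∀ {P N 𝒜} → 𝒜 ∈ P → (true , 𝒜) ∈ boxes P N
  boxes-positive m = ∈-++⁺ˡ (∈-map⁺ (true ,_) m)

  boxes-negative : ∀ {P N 𝒜} → 𝒜 ∈ N → (false , 𝒜) ∈ boxes P N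
  boxes-negative {P} m = ∈-++⁺ʳ (map (true ,_) P) (∈-map⁺ (false ,_) m)

-- Encodings are valid, and valid words can be parsed

module Parsing where

  open import Data.Nat.Binary using (zero; 2[1+_]; 1+[2_]; toℕ)
  open import Data.Nat.Induction using (<-wellFounded)
  open import Data.Nat.Properties using (m≤n+m; ≤-refl)
  open import Induction.WellFounded using (Acc; acc)

  open Tapes using (W; Zip)
  open Computations
  open Searching using (isEnd)
  open Algorithm
  open Simulations
  open Tokens

  start : List Token → Zip
  start ts = [] , tokens⇒word ts

  occurs-trans : ∀ {ts t r u s} → Occurs never ts t r → Occurs never r u s → Occurs never ts u s
  occurs-trans (first _)   o′ = after refl o′
  occurs-trans (after _ o) o′ = after refl (occurs-trans o o′)

  peek-suffix : ∀ q d z {c s} → proj₂ z ≡ c ∷ s → peek q d z ≡ q c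
  peek-suffix q d (p , _ ∷ _) refl = refl

  peek-tokens : ∀ z r → proj₂ z ≡ tokens⇒word r → peek isTag true z ≡ true
  peek-tokens (p , []) r e = refl
  peek-tokens (p , _) (t ∷ r) refl = isTag-tag t

  peek-end : ∀ z a {r} → proj₂ z ≡ encodeName a ++ r → peek isEnd false (move fnd z) ≡ true
  peek-end z a e = peek-suffix isEnd false (move fnd z) (find-end z a e)

  wellFormed-fact : ∀ p α r → wellFormed (p , tokens⇒word (fact α ∷ r)) ≡ true
  wellFormed-fact p (conceptA A a) r =
    cong₂ _∧_ (peek-end (next z) A e₁) (cong₂ _∧_ (peek-end (nav path₂ z) a e₂)
      (peek-tokens (nav path₃ z) r (skip-name (nav path₂ z) a e₂)))
    where
    z = p , tokens⇒word (fact (conceptA A a) ∷ r)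
    e₁ = proj₁ (concept-suffixes z {A} {a} {r} refl)
    e₂ = proj₂ (concept-suffixes z {A} {a} {r} refl)
  wellFormed-fact p (roleA R a b) r =
    cong₂ _∧_ (peek-end (next z) R e₁) (cong₂ _∧_ (peek-end (nav path₂ z) a e₂) (cong₂ _∧_ (peek-end (nav path₃ z) b e₃)
      (peek-tokens (next (move fnd (nav path₃ z))) r (skip-name (nav path₃ z) b e₃))))
    where
    z = p , tokens⇒word (fact (roleA R a b) ∷ r)
    e₁ = proj₁ (role-suffixes z {R} {a} {b} {r} refl)
    e₂ = proj₁ (proj₂ (role-suffixes z {R} {a} {b} {r} refl))
    e₃ = proj₂ (proj₂ (role-suffixes z {R} {a} {b} {r} refl))

  wellFormed-untagged : ∀ z → peek isTag false z ≡ false → wellFormed z ≡ true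
  wellFormed-untagged (p , [])          _ = refl
  wellFormed-untagged (p , one ∷ s)     _ = refl
  wellFormed-untagged (p , two ∷ s)     _ = refl
  wellFormed-untagged (p , endName ∷ s) _ = refl

  positive-tag : ∀ t → isPositive (tag t) ≡ true → t ≡ block true
  positive-tag (block true) _ = refl
  positive-tag (fact (conceptA _ _)) ()
  positive-tag (fact (roleA _ _ _)) ()

  negative-tag : ∀ t → isNegative (tag t) ≡ true → t ≡ block false
  negative-tag (block false) _ = refl
  negative-tag (fact (conceptA _ _)) ()
  negative-tag (fact (roleA _ _ _)) ()

  peek-isTag : ∀ q z → (∀ c → q c ≡ true → isTag c ≡ true) → peek q false z ≡ true → peek isTag false z ≡ true
  peek-isTag q (p , c ∷ s) h e = h c e

  positive⇒tag : ∀ c → isPositive c ≡ true → isTag c ≡ true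
  positive⇒tag positiveTag _ = refl

  negative⇒tag : ∀ c → isNegative c ≡ true → isTag c ≡ true
  negative⇒tag negativeTag _ = refl

  block⇒tag : ∀ c → isBlock c ≡ true → isTag c ≡ true
  block⇒tag positiveTag _ = refl
  block⇒tag negativeTag _ = refl

  concept⇒tag : ∀ c → isConcept c ≡ true → isTag c ≡ true
  concept⇒tag conceptTag _ = refl

  role⇒tag : ∀ c → isRole c ≡ true → isTag c ≡ true
  role⇒tag roleTag _ = refl

  visible-token : ∀ {q} h → (∀ c → h c ≡ true → isTag c ≡ true) → ∀ p ts {z} →
                  Visible q (p , tokens⇒word ts) z → peek h false z ≡ true →
                  ∃[ t ] ∃[ r ] Occurs q ts t r × At z t r × h (tag t) ≡ true
  visible-token h h⇒tag p ts {z} v e with visible⇒occurs p ts v (peek-isTag h z h⇒tag e)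
  ... | t , r , o , at = t , r , o , at , trans (sym (peek-at h false z {t} {r} at)) e

  positives-before : ∀ P N {r r′} → Occurs never (tokens (boxes P N)) (block false) r → ¬ Occurs never r (block true) r′
  positives-before []      N o o′ with occurs-box (map (false ,_) N) (occurs-trans o o′)
  ... | _ , _ , m , _ with ∈-map⁻ (false ,_) m
  ...   | _ , _ , ()
  positives-before (𝒜 ∷ P) N (after _ o) o′ = positives-before P N (occurs-block (toList 𝒜) o) o′

  wellFormed-block : ∀ p b r → (∀ {p} → peek isAssertion false (p , tokens⇒word r) ≡ true) →
                     (b ≡ false → ∀ {r′} → ¬ Occurs never r (block true) r′) →
                     wellFormed (p , tokens⇒word (block b ∷ r)) ≡ true
  wellFormed-block p true  r h _ = cong (_∧ true) h
  wellFormed-block p false r h none with some never (negativeTag ∷ p , tokens⇒word r) (peek isPositive false) in e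
  ... | false = cong (_∧ true) h
  ... | true with some-true never (negativeTag ∷ p) (tokens⇒word r) (peek isPositive false) e
  ...   | z , v , hz with visible-token isPositive positive⇒tag (negativeTag ∷ p) r v hz
  ...     | t , r′ , o , _ , ht with positive-tag t ht
  ...       | refl = contradiction o (none refl)

  assertion-start : ∀ 𝒜 ts {p} → peek isAssertion false (p , tokens⇒word (map fact (toList 𝒜) ++ ts)) ≡ true
  assertion-start (conceptA _ _ ∷ _) ts = refl
  assertion-start (roleA _ _ _ ∷ _)  ts = refl

  valid-encoding : ∀ P N → valid (start (tokens (boxes P N))) ≡ true
  valid-encoding P N = cong₂ _∧_ (begins P N) (cong not all)
    where
    z₀ = start (tokens (boxes P N))
    begins : ∀ P N → peek isBlock true (start (tokens (boxes P N))) ≡ true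
    begins []      []      = refl
    begins []      (_ ∷ _) = refl
    begins (_ ∷ _) N       = refl
    good : ∀ {z} → Visible never z₀ z → wellFormed z ≡ true
    good {z} v with peek isTag false z in e
    ... | false = wellFormed-untagged z e
    ... | true with visible⇒occurs [] (tokens (boxes P N)) v e
    ...   | fact α , r , o , at = subst (λ s → wellFormed (proj₁ z , s) ≡ true) (sym at) (wellFormed-fact (proj₁ z) α r)
    ...   | block b , r , o , at with occurs-box (boxes P N) o
    ...     | 𝒜 , bs , m , refl = subst (λ s → wellFormed (proj₁ z , s) ≡ true) (sym at)
              (wellFormed-block (proj₁ z) b (map fact (toList 𝒜) ++ tokens bs) (λ {p} → assertion-start 𝒜 (tokens bs) {p}) (λ { refl → positives-before P N o }))
    all : some never z₀ (λ z → not (wellFormed z)) ≡ false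
    all with some never z₀ (λ z → not (wellFormed z)) in e
    ... | false = refl
    ... | true with some-true never [] (tokens⇒word (tokens (boxes P N))) (λ z → not (wellFormed z)) e
    ...   | z , v , h = contradiction (not-true h) (true≢false (good v))

  -- The facts `as` belong to a block whose tag lies to the left of the suffix; they become its ABox
  -- when that tag is reached.
  Parsed : W → Set
  Parsed s = ∃[ as ] ∃[ P ] ∃[ N ] s ≡ tokens⇒word (map fact as ++ tokens (boxes P N))

  Good : W → W → Set
  Good p s = ∀ {z} → Visible never (p , s) z → wellFormed z ≡ true

  good-rest : ∀ u {p r} → Good p (u ++ r) → Good (u ʳ++ p) r
  good-rest []      g v = g v
  good-rest (c ∷ u) g v = good-rest u (λ v → g (later refl v)) v

  parse-name : ∀ p s → peek isEnd false (seekFrom (not ∘ isDigit) p s) ≡ true →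
               ∃[ n ] ∃[ r ] s ≡ digits n ++ endName ∷ r
  parse-name p (one ∷ s) e with parse-name (one ∷ p) s e
  ... | n , r , refl = 1+[2 n ] , r , refl
  parse-name p (two ∷ s) e with parse-name (two ∷ p) s e
  ... | n , r , refl = 2[1+ n ] , r , refl
  parse-name p (endName ∷ s) e = zero , s , refl

  parse-at : ∀ z → peek isEnd false (move fnd z) ≡ true → ∃[ a ] ∃[ r ] proj₂ z ≡ encodeName a ++ r
  parse-at z e with parse-name (proj₁ z) (proj₂ z) e
  ... | n , r , eq with digits-named z n eq
  ...   | named {r′} eq′ = toℕ n , r′ , eq′

  parse-two : ∀ z → peek isEnd false (nav (fnd ∷ []) z) ≡ true →
              peek isEnd false (nav (fnd ∷ nxt ∷ fnd ∷ []) z) ≡ true →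
              peek isTag true (nav (fnd ∷ nxt ∷ fnd ∷ nxt ∷ []) z) ≡ true →
              ∃[ a ] ∃[ b ] ∃[ r ] proj₂ z ≡ encodeName a ++ (encodeName b ++ r) × peek isTag true ([] , r) ≡ true
  parse-two z h₁ h₂ h₃ with parse-at z h₁
  ... | a , r₁ , e₁ with parse-at (next (move fnd z)) h₂
  ...   | b , r₂ , e₂ =
    a , b , r₂ , trans e₁ (cong (encodeName a ++_) (trans (sym (skip-name z a e₁)) e₂)) ,
    begins-tag (next (move fnd (next (move fnd z)))) (skip-name (next (move fnd z)) b e₂) h₃
    where
    begins-tag : ∀ z {s} → proj₂ z ≡ s → peek isTag true z ≡ true → peek isTag true ([] , s) ≡ true
    begins-tag (_ , [])    refl e = e
    begins-tag (_ , _ ∷ _) refl e = e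

  parse-content : ∀ p s c → isAssertion c ≡ true → wellFormed (p , c ∷ s) ≡ true →
                  ∃[ α ] ∃[ r ] _≡_ {A = W} (c ∷ s) (tag (fact α) ∷ content (fact α) ++ r) × peek isTag true ([] , r) ≡ true
  parse-content p s conceptTag _ h with ∧-true h
  ... | h₁ , h′ with ∧-true h′
  ...   | h₂ , h₃ with parse-two (conceptTag ∷ p , s) h₁ h₂ h₃
  ...     | A , a , r , e , hr = conceptA A a , r , cong (conceptTag ∷_) (trans e (sym (names₂ A a r))) , hr
  parse-content p s roleTag _ h with ∧-true h
  ... | h₁ , h′ with ∧-true h′ | parse-at (roleTag ∷ p , s) h₁
  ...   | h₂ , h″ | R , r₁ , e₁ with ∧-true h″
  ...     | h₃ , h₄ with parse-two (next (move fnd (roleTag ∷ p , s))) h₂ h₃ h₄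
  ...       | a , b , r , e , hr =
    roleA R a b , r ,
    cong (roleTag ∷_) (trans (trans e₁ (cong (encodeName R ++_) (trans (sym (skip-name (roleTag ∷ p , s) R e₁)) e)))
                             (sym (names₃ R a b r))) , hr

  shorter : ∀ (u r : W) → length r ≤ length (u ++ r)
  shorter u r rewrite length-++ u {r} = m≤n+m (length r) (length u)

  assertion-next : ∀ {p c s s′} → isBlock c ≡ true → wellFormed (p , c ∷ s) ≡ true → s ≡ s′ →
                   peek isAssertion false (c ∷ p , s′) ≡ true
  assertion-next {c = positiveTag} _ h refl = proj₁ (∧-true h)
  assertion-next {c = negativeTag} _ h refl = proj₁ (∧-true h)

  assertion-tagged : ∀ {p} s → peek isAssertion false (p , s) ≡ true → peek isTag true (p , s) ≡ true
  assertion-tagged (conceptTag ∷ _) _ = refl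
  assertion-tagged (roleTag ∷ _)    _ = refl

  -- What follows a fact is found by parsing its names and is shorter without being a subterm, hence
  -- the recursion on length. The prefix `p` is carried along because `Good` speaks about positions
  -- of the whole word.
  parse : ∀ p s → Acc _<_ (length s) → peek isTag true (p , s) ≡ true → Good p s → Parsed s
  parse-fact : ∀ p c s → Acc _<_ (length (c ∷ s)) → isAssertion c ≡ true → Good p (c ∷ s) → Parsed (c ∷ s)
  parse-block : ∀ p c s → Acc _<_ (length (c ∷ s)) → isBlock c ≡ true → Good p (c ∷ s) →
                ∃[ 𝒜 ] ∃[ P ] ∃[ N ] s ≡ tokens⇒word (map fact (toList 𝒜) ++ tokens (boxes P N))

  parse p [] _ _ g = [] , [] , [] , refl
  parse p (conceptTag ∷ s) a _ g = parse-fact p conceptTag s a refl g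
  parse p (roleTag ∷ s)    a _ g = parse-fact p roleTag s a refl g
  parse p (positiveTag ∷ s) a _ g with parse-block p positiveTag s a refl g
  ... | 𝒜 , P , N , refl = [] , 𝒜 ∷ P , N , refl
  parse p (negativeTag ∷ s) a _ g with parse-block p negativeTag s a refl g
  ... | 𝒜 , [] , N , refl = [] , [] , 𝒜 ∷ N , refl
  -- A positive block in the rest is visible from this negative tag, which `wellFormed` forbids.
  ... | 𝒜 , ℬ ∷ P , N , refl with ∧-true (g (now refl))
  ...   | _ , h with occurs⇒visible {never} never-passes
                        (occurs-past (toList 𝒜) (λ _ → refl) (proj₂ (box-occurs (boxes (ℬ ∷ P) N) (here refl))))
                        (negativeTag ∷ p)
  ...     | z , v , at = contradiction (peek-suffix isPositive false z at)
                           (λ h′ → true≢false h′ (some-false (peek isPositive false) (not-true h) v))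

  parse-fact p c s (acc rec) hc g with parse-content p s c hc (g (now refl))
  ... | α , r , refl , hr with parse (content (fact α) ʳ++ (tag (fact α) ∷ p)) r (rec (s≤s (shorter (content (fact α)) r)))
                                hr′ (good-rest (tag (fact α) ∷ content (fact α)) g)
    where
    hr′ : peek isTag true (content (fact α) ʳ++ (tag (fact α) ∷ p) , r) ≡ true
    hr′ = trans (moved r) hr
      where
      moved : ∀ {p p′} r → peek isTag true (p , r) ≡ peek isTag true (p′ , r)
      moved []      = refl
      moved (_ ∷ _) = refl
  ... | as , P , N , refl = α ∷ as , P , N , refl

  parse-block p c s (acc rec) hc g
    with parse (c ∷ p) s (rec ≤-refl) (assertion-tagged s (assertion-next {p} {c} {s} hc (g (now refl)) refl)) (good-rest [ c ] g)
  ... | α ∷ as , P , N , e = (α ∷ as) , P , N , e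
  -- A block without facts, whose tag would not be followed by the tag of an assertion.
  ... | [] , [] , [] , e    = case assertion-next {p} {c} {s} hc (g (now refl)) e of λ ()
  ... | [] , [] , _ ∷ _ , e = case assertion-next {p} {c} {s} hc (g (now refl)) e of λ ()
  ... | [] , _ ∷ _ , _ , e  = case assertion-next {p} {c} {s} hc (g (now refl)) e of λ ()

  valid-parse : ∀ w → valid ([] , w) ≡ true → ∃[ P ] ∃[ N ] encodeLists P N ≡ w
  valid-parse w h with ∧-true h
  ... | hb , hs with parse [] w (<-wellFounded (length w)) (tagged w hb) good
    where
    tagged : ∀ w → peek isBlock true ([] , w) ≡ true → peek isTag true ([] , w) ≡ true
    tagged []                _ = refl
    tagged (positiveTag ∷ _) _ = refl
    tagged (negativeTag ∷ _) _ = refl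
    good : Good [] w
    good v = not-false (some-false (λ z → not (wellFormed z)) (not-true hs) v)
  ... | [] , P , N , e = P , N , trans (encode-tokens P N) (sym e)
  ... | conceptA _ _ ∷ _ , _ , _ , e = case subst (λ w → peek isBlock true ([] , w) ≡ true) e hb of λ ()
  ... | roleA _ _ _ ∷ _ , _ , _ , e  = case subst (λ w → peek isBlock true ([] , w) ≡ true) e hb of λ ()

-- What the tests say about the collection of examples

module Meaning where

  open import Data.List.Relation.Binary.Disjoint.Propositional using (Disjoint)
  import Data.List.Relation.Unary.All.Properties as All

  open Tapes using (W; word)
  open Computations
  open Searching using (getEntry)
  open Algorithm
  open Simulations
  open Tokens
  open Parsing

  fact-visible : ∀ {ts α} → α ∈ facts ts → ∃[ z ] ∃[ r ] Visible never (start ts) z × At z (fact α) r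
  fact-visible {ts} m with fact⇒occurs ts m
  ... | r , o with occurs⇒visible never-passes o []
  ...   | z , v , at = z , r , v , at

  concept-tag : ∀ t → isConcept (tag t) ≡ true → ∃[ A ] ∃[ a ] t ≡ fact (conceptA A a)
  concept-tag (block true) ()
  concept-tag (block false) ()
  concept-tag (fact (conceptA A a)) _ = A , a , refl

  role-tag : ∀ t → isRole (tag t) ≡ true → ∃[ R ] ∃[ a ] ∃[ b ] t ≡ fact (roleA R a b)
  role-tag (block true) ()
  role-tag (block false) ()
  role-tag (fact (conceptA _ _)) ()
  role-tag (fact (roleA R a b)) _ = R , a , b , refl

  block-tag : ∀ t → isBlock (tag t) ≡ true → ∃[ b ] t ≡ block b
  block-tag (block b) _ = b , refl
  block-tag (fact (conceptA _ _)) ()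
  block-tag (fact (roleA _ _ _)) ()

  visible-concept : ∀ ts {z} → Visible never (start ts) z → peek isConcept false z ≡ true →
                    ∃[ A ] ∃[ a ] ∃[ r ] conceptA A a ∈ facts ts × At z (fact (conceptA A a)) r
  visible-concept ts v h with visible-token isConcept concept⇒tag [] ts v h
  ... | t , r , o , at , ht with concept-tag t ht
  ...   | A , a , refl = A , a , r , occurs⇒fact o , at

  visible-role : ∀ ts {z} → Visible never (start ts) z → peek isRole false z ≡ true →
                 ∃[ R ] ∃[ a ] ∃[ b ] ∃[ r ] roleA R a b ∈ facts ts × At z (fact (roleA R a b)) r
  visible-role ts v h with visible-token isRole role⇒tag [] ts v h
  ... | t , r , o , at , ht with role-tag t ht
  ...   | R , a , b , refl = R , a , b , r , occurs⇒fact o , at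

  conceptViolation-true : ∀ ts x y → conceptViolation (start ts) x y ≡ true →
    ∃[ A ] ∃[ b ] conceptA A b ∈ facts ts × Named x b × (∀ {a} → Named y a → conceptA A a ∉ facts ts)
  conceptViolation-true ts x y h
    with some-true never [] (tokens⇒word ts) _ h
  ... | z , v , h₁ with ∧-true {peek isConcept false z} h₁
  ...   | hz , h₂ with ∧-true {same (nav path₂ z) x} h₂ | visible-concept ts v hz
  ...     | hx , h₃ | A , b , r , m , at =
    A , b , m , same-names (nav path₂ z) x hx (proj₂ (concept-names z {A} {b} {r} at)) , absent
    where
    absent : ∀ {a} → Named y a → conceptA A a ∉ facts ts
    absent {a} ny m′ with fact-visible {ts} m′
    ... | z′ , r′ , v′ , at′ =
      true≢false (cong₂ _∧_ (peek-at isConcept false z′ {fact (conceptA A a)} {r′} at′)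
                   (cong₂ _∧_ (same-intro (proj₁ (concept-names z {A} {b} {r} at)) (proj₁ (concept-names z′ {A} {a} {r′} at′)))
                              (same-intro (proj₂ (concept-names z′ {A} {a} {r′} at′)) ny)))
                 (some-false _ (not-true h₃) v′)

  conceptViolation-false : ∀ ts x y → conceptViolation (start ts) x y ≡ false →
    ∀ {A b a} → conceptA A b ∈ facts ts → Named x b → Named y a → conceptA A a ∈ facts ts
  conceptViolation-false ts x y h {A} {b} {a} m nx ny with fact-visible {ts} m
  ... | z , r , v , at
    with some-true never [] (tokens⇒word ts) _
           (not-false (∧-false (∧-false (some-false _ h v) (peek-at isConcept false z {fact (conceptA A b)} {r} at))
                               (same-intro (proj₂ (concept-names z {A} {b} {r} at)) nx)))
  ...   | z′ , v′ , h₁ with ∧-true {peek isConcept false z′} h₁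
  ...     | hz , h₂ with ∧-true {same (nav path₁ z) (nav path₁ z′)} h₂ | visible-concept ts v′ hz
  ...       | hA , ha | A′ , a′ , r′ , m′ , at′
    with Named-unique (same-names (nav path₁ z) (nav path₁ z′) hA (proj₁ (concept-names z {A} {b} {r} at)))
                      (proj₁ (concept-names z′ {A′} {a′} {r′} at′))
       | Named-unique (same-names (nav path₂ z′) y ha (proj₂ (concept-names z′ {A′} {a′} {r′} at′))) ny
  ...         | refl | refl = m′

  -- How the two ends of a role assertion are read: as they stand for r, and
  -- exchanged for the inverse of r.
  record Reading (from to : List Mv) : Set where
    field
      edge  : N-R → N-I → N-I → Assertion
      isR   : ∀ R a b → isRole (tag (fact (edge R a b))) ≡ true
      names : ∀ z {R a b r} → At z (fact (edge R a b)) r →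
              Named (nav path₁ z) R × Named (nav from z) a × Named (nav to z) b
      every : ∀ R a b → ∃[ a′ ] ∃[ b′ ] roleA R a b ≡ edge R a′ b′

  straight : Reading path₂ path₃
  straight = record
    { edge = roleA ; isR = λ _ _ _ → refl
    ; names = λ z {R} {a} {b} {r} at → role-names z {R} {a} {b} {r} at
    ; every = λ R a b → a , b , refl }

  exchanged : Reading path₃ path₂
  exchanged = record
    { edge = λ R a b → roleA R b a ; isR = λ _ _ _ → refl
    ; names = λ z {R} {a} {b} {r} at → let n₁ , n₂ , n₃ = role-names z {R} {b} {a} {r} at in n₁ , n₃ , n₂
    ; every = λ R a b → b , a , refl }

  module _ {from to} (reading : Reading from to) where
    open Reading reading

    visible-edge : ∀ ts {z} → Visible never (start ts) z → peek isRole false z ≡ true →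
                   ∃[ R ] ∃[ a ] ∃[ b ] ∃[ r ] edge R a b ∈ facts ts × At z (fact (edge R a b)) r
    visible-edge ts {z} v h with visible-role ts v h
    ... | R , a , b , r , m , at with every R a b
    ...   | a′ , b′ , e = R , a′ , b′ , r , subst (λ α → α ∈ facts ts × At z (fact α) r) e (m , at)

    visible-pos : ∀ {ts z} ms → Visible never (start ts) z → word (nav ms z) ≡ tokens⇒word ts
    visible-pos {ts} {z} ms v = trans (word-nav ms z) (visible-word v)

    -- The table is consulted at the far ends of particular occurrences of the edges. Their
    -- positions `p` and `p′` are exposed because the justification of cleared entries is indexed by
    -- positions.
    roleViolation-true : ∀ ts x y tw → roleViolation from to (start ts) x y tw ≡ true →
      ∃[ R ] ∃[ b ] ∃[ b′ ] edge R b b′ ∈ facts ts × Named x b ×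
      (∃[ p ] Named p b′ × word p ≡ tokens⇒word ts ×
        (∀ {a a′} → Named y a → edge R a a′ ∈ facts ts →
          ∃[ p′ ] Named p′ a′ × word p′ ≡ tokens⇒word ts × getEntry p p′ tw ≡ false))
    roleViolation-true ts x y tw h
      with some-true never [] (tokens⇒word ts) _ h
    ... | z , v , h₁ with ∧-true {peek isRole false z} h₁
    ...   | hz , h₂ with ∧-true {same (nav from z) x} h₂ | visible-edge ts v hz
    ...     | hx , h₃ | R , b , b′ , r , m , at =
      R , b , b′ , m , same-names (nav from z) x hx (proj₁ (proj₂ (names z {R} {b} {b′} {r} at))) ,
      nav to z , proj₂ (proj₂ (names z {R} {b} {b′} {r} at)) , visible-pos to v , absent
      where
      absent : ∀ {a a′} → Named y a → edge R a a′ ∈ facts ts →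
               ∃[ p′ ] Named p′ a′ × word p′ ≡ tokens⇒word ts × getEntry (nav to z) p′ tw ≡ false
      absent {a} {a′} ny m′ with fact-visible {ts} m′
      ... | z′ , r′ , v′ , at′ =
        nav to z′ , proj₂ (proj₂ (names z′ {R} {a} {a′} {r′} at′)) , visible-pos to v′ ,
        ∧-false (∧-false (∧-false (some-false _ (not-true h₃) v′)
                  (trans (peek-at isRole false z′ {fact (edge R a a′)} {r′} at′) (isR R a a′)))
                  (same-intro (proj₁ (names z {R} {b} {b′} {r} at)) (proj₁ (names z′ {R} {a} {a′} {r′} at′))))
                  (same-intro (proj₁ (proj₂ (names z′ {R} {a} {a′} {r′} at′))) ny)

    roleViolation-false : ∀ ts x y tw → roleViolation from to (start ts) x y tw ≡ false →
      ∀ {R b b′ a} → edge R b b′ ∈ facts ts → Named x b → Named y a →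
      ∃[ a′ ] edge R a a′ ∈ facts ts × (∃[ p ] ∃[ p′ ] Named p b′ × Named p′ a′ ×
        word p ≡ tokens⇒word ts × word p′ ≡ tokens⇒word ts × getEntry p p′ tw ≡ true)
    roleViolation-false ts x y tw h {R} {b} {b′} {a} m nx ny with fact-visible {ts} m
    ... | z , r , v , at
      with some-true never [] (tokens⇒word ts) _
             (not-false (∧-false (∧-false (some-false _ h v)
               (trans (peek-at isRole false z {fact (edge R b b′)} {r} at) (isR R b b′)))
               (same-intro (proj₁ (proj₂ (names z {R} {b} {b′} {r} at))) nx)))
    ...   | z′ , v′ , h₁ with ∧-true {peek isRole false z′} h₁
    ...     | hz , h₂ with ∧-true {same (nav path₁ z) (nav path₁ z′)} h₂ | visible-edge ts v′ hz
    ...       | hR , h₃ | R′ , a₁ , a′ , r′ , m′ , at′ with ∧-true {same (nav from z′) y} h₃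
    ...         | ha , he
      with Named-unique (same-names (nav path₁ z) (nav path₁ z′) hR (proj₁ (names z {R} {b} {b′} {r} at)))
                        (proj₁ (names z′ {R′} {a₁} {a′} {r′} at′))
         | Named-unique (same-names (nav from z′) y ha (proj₁ (proj₂ (names z′ {R′} {a₁} {a′} {r′} at′)))) ny
    ...           | refl | refl =
      a′ , m′ , nav to z , nav to z′ , proj₂ (proj₂ (names z {R} {b} {b′} {r} at)) ,
      proj₂ (proj₂ (names z′ {R} {a} {a′} {r′} at′)) , visible-pos to v , visible-pos to v′ , he

  DisjointBoxes : List ABox → Set
  DisjointBoxes = AllPairs (λ 𝒜 ℬ → Disjoint (individuals 𝒜) (individuals ℬ))

  -- Disjointness as the machine can see it, boxes being told apart by a block tag between two
  -- facts.
  Separate : List Token → Set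
  Separate ts = ∀ {α β b a r r′ r″} → Occurs never ts (fact α) r → Occurs never r (block b) r′ →
                Occurs never r′ (fact β) r″ → a ∈ individualsOf α → a ∉ individualsOf β

  separate⇒disjoint : ∀ bs → Separate (tokens bs) → DisjointBoxes (map proj₂ bs)
  separate⇒disjoint []             _   = []
  separate⇒disjoint ((s , 𝒜) ∷ bs) sep =
    All.tabulate apart ∷
    separate⇒disjoint bs (λ o → sep (after refl (occurs-past (toList 𝒜) (λ _ → refl) o)))
    where
    apart : ∀ {ℬ} → ℬ ∈ map proj₂ bs → Disjoint (individuals 𝒜) (individuals ℬ)
    apart {ℬ} m (a∈𝒜 , a∈ℬ)
      with ∈-concatMap individualsOf (toList 𝒜) a∈𝒜 | ∈-concatMap individualsOf (toList ℬ) a∈ℬ | ∈-map⁻ proj₂ m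
    ... | α , α∈ , a∈α | β , β∈ , a∈β | (s′ , _) , m′ , refl
      with occurs-in {never} (tokens bs) (λ _ → refl) α∈ | box-occurs bs m′
    ...   | as′ , o | bs′ , o′ with occurs-in {never} (tokens bs′) (λ _ → refl) β∈
    ...     | _ , o″ = sep (after refl o) (occurs-past as′ (λ _ → refl) o′) o″ a∈α a∈β

  occurs-split : ∀ as {ts α r} → Occurs never (map fact as ++ ts) (fact α) r →
                 (α ∈ as × ∃[ as′ ] r ≡ map fact as′ ++ ts) ⊎ Occurs never ts (fact α) r
  occurs-split []       o         = inj₂ o
  occurs-split (α ∷ as) (first _) = inj₁ (here refl , as , refl)
  occurs-split (_ ∷ as) (after _ o) with occurs-split as o
  ... | inj₁ (m , e) = inj₁ (there m , e)
  ... | inj₂ o′      = inj₂ o′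

  disjoint⇒separate : ∀ bs → DisjointBoxes (map proj₂ bs) → Separate (tokens bs)
  disjoint⇒separate ((s , 𝒜) ∷ bs) (d ∷ ds) (after _ o) o′ o″ a∈ a∈′ with occurs-split (toList 𝒜) o
  ... | inj₂ o₁ = disjoint⇒separate bs ds o₁ o′ o″ a∈ a∈′
  ... | inj₁ (m , as′ , refl)
    with ∈-concatMap (toList ∘ proj₂) bs (subst (_ ∈_) (facts-tokens bs) (occurs⇒fact (occurs-trans (occurs-block as′ o′) o″)))
  ...   | (s′ , ℬ) , m′ , β∈ =
    All.lookup d (∈-map⁺ proj₂ m′) (individual-∈ {𝒜} m a∈ , individual-∈ {ℬ} β∈ a∈′)

  shared-separate : ∀ ts → shared (start ts) ≡ false → Separate ts
  shared-separate ts h {α} {β} {b} {a} {r} {r′} {r″} o o′ o″ a∈α a∈β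
    with occurs⇒visible never-passes o []
  ... | (p₁ , _) , v₁ , refl with individual-false (p₁ , tokens⇒word (fact α ∷ r)) (sharedAfter (p₁ , tokens⇒word (fact α ∷ r))) {α} {r} refl (some-false (λ z → someIndividual z (sharedAfter z)) h v₁) a∈α
  ...   | x , nx , _ , h₁ with occurs⇒visible never-passes (after {never} {u = fact α} refl o′) p₁
  ...     | (p₂ , _) , v₂ , refl with occurs⇒visible never-passes (after {never} {u = block b} refl o″) p₂
  ...       | (p₃ , _) , v₃ , refl
    with individual-false (p₃ , tokens⇒word (fact β ∷ r″)) (same x) {β} {r″} refl
           (some-false (λ z → someIndividual z (same x)) (∧-false (some-false (λ z → peek isBlock false z ∧ sharedIn x z) h₁ v₂) (isBlock-tag b)) v₃) a∈β
    where
    isBlock-tag : ∀ b → isBlock (tag (block b)) ≡ true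
    isBlock-tag true  = refl
    isBlock-tag false = refl
  ...         | y , ny , _ , h₂ = true≢false (same-intro nx ny) h₂

  separate-shared : ∀ ts → Separate ts → shared (start ts) ≡ false
  separate-shared ts sep with shared (start ts) in h
  ... | false = refl
  ... | true with some-true never [] (tokens⇒word ts) (λ z → someIndividual z (sharedAfter z)) h
  ...   | (p₁ , s₁) , v₁ , h₁ with visible⇒occurs [] ts v₁ (individual-tag (p₁ , s₁) (sharedAfter (p₁ , s₁)) h₁)
  ...     | t₁ , r₁ , o₁ , refl with individual-true (p₁ , s₁) (sharedAfter (p₁ , s₁)) {t₁} {r₁} refl h₁
  ...       | α , a , x , refl , a∈ , nx , _ , h₂ with some-true never p₁ s₁ (λ z → peek isBlock false z ∧ sharedIn x z) h₂
  ...         | (p₂ , s₂) , v₂ , h₃ with ∧-true {peek isBlock false (p₂ , s₂)} h₃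
  ...           | hb , h₄ with visible-token isBlock block⇒tag p₁ (fact α ∷ r₁) v₂ hb
  ...             | t₂ , r₂ , o₂ , refl , ht₂ with block-tag t₂ ht₂
  ...               | b , refl with some-true never p₂ s₂ (λ z → someIndividual z (same x)) h₄
  ...                 | (p₃ , s₃) , v₃ , h₅ with visible⇒occurs p₂ (block b ∷ r₂) v₃ (individual-tag (p₃ , s₃) (same x) h₅)
  ...                   | t₃ , r₃ , o₃ , refl with individual-true (p₃ , s₃) (same x) {t₃} {r₃} refl h₅
  ...                     | β , a′ , y , refl , a∈′ , ny , _ , h₆
    with Named-unique (same-names x y h₆ nx) ny
  ...                       | refl = ⊥-elim (finish o₂ o₃)
    where
    finish : Occurs never (fact α ∷ r₁) (block b) r₂ → Occurs never (block b ∷ r₂) (fact β) r₃ → ⊥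
    finish (after _ o) (after _ o′) = sep o₁ o o′ a∈ a∈′

  -- The verdict in terms of ABoxes and table entries

  module _ (P N : List ABox) (tw : W) where
    private
      bs = boxes P N
      ts = tokens bs
      z₀ = start ts
      w  = tokens⇒word ts

    visible-in-box : ∀ {z b 𝒜 bs′ f} → At z (block b) (map fact (toList 𝒜) ++ tokens bs′) →
                     ∀ {z′} → Visible isBlock (next z) z′ → someIndividual z′ f ≡ true →
                     ∃[ a ] ∃[ x ] a ∈ individuals 𝒜 × Named x a × word x ≡ word z × f x ≡ true
    visible-in-box {p , _} {b} {𝒜} {bs′} {f} refl {z′} v h
      with visible⇒occurs (tag (block b) ∷ p) (map fact (toList 𝒜) ++ tokens bs′) v (individual-tag z′ f h)
    ... | t , r , o , at with individual-true z′ f {t} {r} at h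
    ...   | α , a , x , refl , a∈ , nx , wx , hx =
      a , x , individual-∈ {𝒜} (occurs-until (toList 𝒜) bs′ o) a∈ , nx , trans wx (visible-word v) , hx

    hidden-in-box : ∀ {z b 𝒜 bs′ f} → At z (block b) (map fact (toList 𝒜) ++ tokens bs′) →
                    some isBlock (next z) (λ z′ → someIndividual z′ f) ≡ false →
                    ∀ {a} → a ∈ individuals 𝒜 → ∃[ x ] Named x a × word x ≡ word z × f x ≡ false
    hidden-in-box {p , _} {b} {𝒜} {bs′} {f} refl h a∈ with ∈-concatMap individualsOf (toList 𝒜) a∈
    ... | α , α∈ , a∈α with occurs-in {isBlock} (tokens bs′) isBlock-fact α∈
    ...   | as′ , o with occurs⇒visible isBlock-passes o (tag (block b) ∷ p)
    ...     | z′ , v , at with individual-false z′ f {α} {map fact as′ ++ tokens bs′} at (some-false _ h v) a∈α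
    ...       | x , nx , wx , hx = x , nx , trans wx (visible-word v) , hx

    visible-box : ∀ {z} h b → (∀ c → h c ≡ true → isTag c ≡ true) → (∀ t → h (tag t) ≡ true → t ≡ block b) →
                  Visible never z₀ z → peek h false z ≡ true →
                  ∃[ 𝒜 ] ∃[ bs′ ] (b , 𝒜) ∈ bs × At z (block b) (map fact (toList 𝒜) ++ tokens bs′)
    visible-box h b h⇒tag h⇒b v hz with visible-token h h⇒tag [] ts v hz
    ... | t , r , o , at , ht with h⇒b t ht
    ...   | refl with occurs-box bs o
    ...     | 𝒜 , bs′ , m , refl = 𝒜 , bs′ , m , at

    box-visible : ∀ {b 𝒜} → (b , 𝒜) ∈ bs →
                  ∃[ z ] ∃[ bs′ ] Visible never z₀ z × At z (block b) (map fact (toList 𝒜) ++ tokens bs′)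
    box-visible m with box-occurs bs m
    ... | bs′ , o with occurs⇒visible never-passes o []
    ...   | z , v , at = z , bs′ , v , at

    simulated-true : ∀ x → simulated z₀ tw x ≡ true →
                     ∃[ 𝒜 ] 𝒜 ∈ P × (∃[ a ] a ∈ individuals 𝒜 × (∃[ y ] Named y a × word y ≡ w × getEntry x y tw ≡ true))
    simulated-true x h with some-true never [] w _ h
    ... | s , v , h₁ with ∧-true {peek isPositive false s} h₁
    ...   | hs , h₂ with visible-box isPositive true positive⇒tag positive-tag v hs
    ...     | 𝒜 , bs′ , m , at with some-true isBlock (proj₁ (next s)) (proj₂ (next s)) _ h₂
    ...       | z , vz , hz with visible-in-box {s} {true} {𝒜} {bs′} at vz hz
    ...         | a , y , a∈ , ny , wy , hy =
      𝒜 , positive-boxes {P} {N} m , a , a∈ , y , ny , trans wy (visible-word v) , hy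

    simulated-false : ∀ x → simulated z₀ tw x ≡ false → ∀ {𝒜 a} → 𝒜 ∈ P → a ∈ individuals 𝒜 →
                      ∃[ y ] Named y a × word y ≡ w × getEntry x y tw ≡ false
    simulated-false x h {𝒜} m a∈ with box-visible (boxes-positive {P} {N} m)
    ... | s , bs′ , v , at with hidden-in-box {s} {true} {𝒜} {bs′} at
                                 (∧-false (some-false _ h v) (peek-at isPositive false s {block true} at)) a∈
    ...   | y , ny , wy , hy = y , ny , trans wy (visible-word v) , hy

    verdict-false : verdict z₀ tw ≡ false →
      ∃[ ℬ ] ℬ ∈ N × (∀ {b} → b ∈ individuals ℬ → ∃[ x ] Named x b × word x ≡ w × simulated z₀ tw x ≡ true)
    verdict-false h with some-true never [] w _ (not-false h)
    ... | s , v , h₁ with ∧-true {peek isNegative false s} h₁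
    ...   | hs , h₂ with visible-box isNegative false negative⇒tag negative-tag v hs
    ...     | ℬ , bs′ , m , at = ℬ , negative-boxes {P} {N} m , λ b∈ →
      case hidden-in-box {s} {false} {ℬ} {bs′} at (not-true h₂) b∈ of λ { (x , nx , wx , hx) →
      x , nx , trans wx (visible-word v) , not-false hx }

    verdict-true : verdict z₀ tw ≡ true → ∀ {ℬ} → ℬ ∈ N →
      ∃[ b ] ∃[ x ] b ∈ individuals ℬ × Named x b × word x ≡ w × simulated z₀ tw x ≡ false
    verdict-true h {ℬ} m with box-visible (boxes-negative {P} {N} m)
    ... | s , bs′ , v , at
      with some-true isBlock (proj₁ (next s)) (proj₂ (next s)) _
             (not-false (∧-false (some-false _ (not-true h) v) (peek-at isNegative false s {block false} at)))
    ...   | z , vz , hz with visible-in-box {s} {false} {ℬ} {bs′} at vz hz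
    ...     | b , x , b∈ , nx , wx , hx = b , x , b∈ , nx , trans wx (visible-word v) , not-true hx

-- The table as a grid, and the effect of one refinement

module Correctness where

  import Data.Fin as Fin
  open import Data.Fin using (Fin; zero; suc; fromℕ<; _≟_)
  open import Data.Nat.Binary using (zero; fromℕ; toℕ)
  open import Data.Nat.Properties using (≤-refl; +-mono-≤; +-monoʳ-<; suc-injective)
  open import Data.Vec using (Vec; []; _∷_; lookup; replicate; _[_]≔_)
  open import Function.Bundles using (mk⇔; _⇔_)

  open Tapes using (W; Zip; word; pre≤word)
  open Computations
  open Searching using (getEntry; clearEntry; locate; word-locate; rowSkip; iter; isTwo; mark; searchFrom; search)
  open Algorithm
  open Simulations
  open Tokens
  open Parsing
  open Meaning
  open Machines
  open Deciding

  bit : Bool → Symbol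
  bit true  = two
  bit false = one

  bits : ∀ {n} → Vec Bool n → W
  bits []      = []
  bits (b ∷ r) = bit b ∷ bits r

  Grid : ℕ → ℕ → Set
  Grid m n = Vec (Vec Bool n) m

  gridWord : ∀ {m n} → Grid m n → W
  gridWord []      = []
  gridWord (r ∷ T) = bits r ++ endName ∷ gridWord T

  rowSkip-bits : ∀ {n} (r : Vec Bool n) p s → rowSkip (p , bits r ++ endName ∷ s) ≡ (endName ∷ (bits r ʳ++ p) , s)
  rowSkip-bits []          p s = refl
  rowSkip-bits (true ∷ r)  p s = rowSkip-bits r (two ∷ p) s
  rowSkip-bits (false ∷ r) p s = rowSkip-bits r (one ∷ p) s

  -- Besides the row reached, it records that replacing this row in place amounts to an update of
  -- the grid; reading and clearing an entry both rest on it.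
  locate-row : ∀ {m n} (T : Grid m n) i p → ∃[ p′ ] ∃[ s ]
    iter rowSkip (Fin.toℕ i) (p , gridWord T) ≡ (p′ , bits (lookup T i) ++ endName ∷ s) ×
    (∀ r → p′ ʳ++ (bits r ++ endName ∷ s) ≡ p ʳ++ gridWord (T [ i ]≔ r))
  locate-row (r ∷ T) zero    p = p , gridWord T , refl , λ _ → refl
  locate-row (r ∷ T) (suc i) p with locate-row T i (endName ∷ (bits r ʳ++ p))
  ... | p′ , s , e , h =
    p′ , s , trans (cong (iter rowSkip (Fin.toℕ i)) (rowSkip-bits r p (gridWord T))) e ,
    λ r′ → trans (h r′) (ʳ++-ʳ++ (bits r))

  locate-cell : ∀ {n} (r : Vec Bool n) j p s → ∃[ p′ ] ∃[ s′ ]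
    iter next (Fin.toℕ j) (p , bits r ++ s) ≡ (p′ , bit (lookup r j) ∷ s′) ×
    (∀ b → p′ ʳ++ (bit b ∷ s′) ≡ p ʳ++ (bits (r [ j ]≔ b) ++ s))
  locate-cell (b ∷ r) zero    p s = p , bits r ++ s , refl , λ _ → refl
  locate-cell (b ∷ r) (suc j) p s with locate-cell r j (bit b ∷ p) s
  ... | p′ , s′ , e , h = p′ , s′ , e , h

  side : W → ℕ
  side w = suc (length w)

  index : ∀ {w} x → word x ≡ w → Fin (side w)
  index (p , s) e = fromℕ< (s≤s (pre≤word p s (cong length e)))

  toℕ-index : ∀ {w} x (e : word x ≡ w) → Fin.toℕ (index x e) ≡ length (proj₁ x)
  toℕ-index (p , s) e = toℕ-fromℕ< _

  locate-grid : ∀ {w} (T : Grid (side w) (side w)) x y (wx : word x ≡ w) (wy : word y ≡ w) →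
    let i = index x wx; j = index y wy in ∃[ p ] ∃[ s ]
    locate x y (gridWord T) ≡ (p , bit (lookup (lookup T i) j) ∷ s) ×
    (∀ b → p ʳ++ (bit b ∷ s) ≡ gridWord (T [ i ]≔ (lookup T i [ j ]≔ b)))
  locate-grid T x y wx wy with locate-row T (index x wx) []
  ... | p , s , e , h with locate-cell (lookup T (index x wx)) (index y wy) p (endName ∷ s)
  ...   | p′ , s′ , e′ , h′ =
    p′ , s′ ,
    trans (cong₂ (λ m n → iter next n (iter rowSkip m ([] , gridWord T))) (sym (toℕ-index x wx)) (sym (toℕ-index y wy)))
          (trans (cong (iter next (Fin.toℕ (index y wy))) e) e′) ,
    λ b → trans (h′ b) (h (lookup T (index x wx) [ index y wy ]≔ b))

  isTwo-bit : ∀ b → isTwo (bit b) ≡ b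
  isTwo-bit true  = refl
  isTwo-bit false = refl

  getEntry-grid : ∀ {w} (T : Grid (side w) (side w)) x y (wx : word x ≡ w) (wy : word y ≡ w) →
                  getEntry x y (gridWord T) ≡ lookup (lookup T (index x wx)) (index y wy)
  getEntry-grid T x y wx wy with locate-grid T x y wx wy
  ... | p , s , e , _ = trans (cong (peek isTwo false) e) (isTwo-bit _)

  clearEntry-grid : ∀ {w} (T : Grid (side w) (side w)) x y (wx : word x ≡ w) (wy : word y ≡ w) →
    clearEntry x y (gridWord T) ≡ gridWord (T [ index x wx ]≔ (lookup T (index x wx) [ index y wy ]≔ false))
  clearEntry-grid T x y wx wy with locate-grid T x y wx wy
  ... | p , s , e , h = trans (cong (word ∘ mark) e) (h false)

  full-row : ∀ n → row n ≡ bits (replicate n true) ++ [ endName ]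
  full-row zero    = refl
  full-row (suc n) = cong (two ∷_) (full-row n)

  full-rows : ∀ m n → rows m n ≡ gridWord (replicate m (replicate n true))
  full-rows zero    n = refl
  full-rows (suc m) n =
    trans (cong₂ _++_ (full-row n) (full-rows m n))
          (++-assoc (bits (replicate n true)) [ endName ] (gridWord (replicate m (replicate n true))))

  weight : Symbol → ℕ
  weight two = 1
  weight _   = 0

  -- The measure of the refinement loop: the number of entries not yet cleared.
  count : W → ℕ
  count []      = 0
  count (c ∷ s) = weight c + count s

  count≤length : ∀ s → count s ≤ length s
  count≤length []      = z≤n
  count≤length (c ∷ s) = +-mono-≤ (weight≤1 c) (count≤length s)
    where
    weight≤1 : ∀ c → weight c ≤ 1
    weight≤1 two         = ≤-refl
    weight≤1 one         = z≤n
    weight≤1 endName     = z≤n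
    weight≤1 conceptTag  = z≤n
    weight≤1 roleTag     = z≤n
    weight≤1 positiveTag = z≤n
    weight≤1 negativeTag = z≤n

  count-ʳ++ : ∀ p {s s′} → count s < count s′ → count (p ʳ++ s) < count (p ʳ++ s′)
  count-ʳ++ []      h = h
  count-ʳ++ (c ∷ p) h = count-ʳ++ p (+-monoʳ-< (weight c) h)

  count-mark : ∀ z → peek isTwo false z ≡ true → count (word (mark z)) < count (word z)
  count-mark (p , two ∷ s) _ = count-ʳ++ p ≤-refl

  count-clear : ∀ x y tw → getEntry x y tw ≡ true → count (clearEntry x y tw) < count tw
  count-clear x y tw h =
    subst (λ v → count (clearEntry x y tw) < count v) (word-locate x y tw) (count-mark (locate x y tw) h)

  zip-unique : ∀ p p′ {s s′ : W} → length p ≡ length p′ → p ʳ++ s ≡ p′ ʳ++ s′ → _≡_ {A = Zip} (p , s) (p′ , s′)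
  zip-unique []      []        _ refl = refl
  zip-unique (c ∷ p) (c′ ∷ p′) l e with zip-unique p p′ (suc-injective l) e
  ... | refl = refl

  -- The length of its prefix determines a position of a given word, so different positions never
  -- share a row or a column.
  index-injective : ∀ {w} x y (wx : word x ≡ w) (wy : word y ≡ w) → index x wx ≡ index y wy → x ≡ y
  index-injective x y wx wy e =
    zip-unique (proj₁ x) (proj₁ y)
      (trans (sym (toℕ-index x wx)) (trans (cong Fin.toℕ e) (toℕ-index y wy))) (trans wx (sym wy))

  visible-step : ∀ {z p c d s} → Visible never z (p , c ∷ d ∷ s) → Visible never z (c ∷ p , d ∷ s)
  visible-step (now _)     = later refl (now refl)
  visible-step (later _ v) = later refl (visible-step v)

  visible-anywhere : ∀ p c s → Visible never ([] , p ʳ++ (c ∷ s)) (p , c ∷ s)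
  visible-anywhere []      c s = now refl
  visible-anywhere (d ∷ p) c s = visible-step (visible-anywhere p d (c ∷ s))

  -- Searches visit only positions that carry a symbol, and an encoded name has at least its
  -- `endName`.
  named-visible : ∀ {w x a} → word x ≡ w → Named x a → Visible never ([] , w) x
  named-visible {x = p , []} {a} refl (named {r} e) with digits (fromℕ a) | unfold-name a r
  ... | []    | u = case trans e u of λ ()
  ... | _ ∷ _ | u = case trans e u of λ ()
  named-visible {x = p , c ∷ s} refl _ = visible-anywhere p c s

  -- A search that has passed failed candidates still works on the original table, so its outcome
  -- can be stated for a single `tw`.
  Unchanged : (Zip → W → Bool × W) → Set
  Unchanged g = ∀ z tw → proj₁ (g z tw) ≡ false → proj₂ (g z tw) ≡ tw

  search-true : ∀ {q g} p s {tw tw′} → Unchanged g → searchFrom q p s g tw ≡ (true , tw′) →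
                ∃[ z ] Visible q (p , s) z × g z tw ≡ (true , tw′)
  search-true {q} {g} p (c ∷ s) {tw} u e with q c in qc
  ... | false with g (p , c ∷ s) tw in gc | u (p , c ∷ s) tw
  ...   | true , tw″  | _ = (p , c ∷ s) , now qc , trans gc e
  ...   | false , tw″ | h rewrite h refl with search-true (c ∷ p) s u e
  ...     | z , v , eq = z , later qc v , eq

  search-false : ∀ {q g} p s {tw tw′} → Unchanged g → searchFrom q p s g tw ≡ (false , tw′) →
                 tw′ ≡ tw × (∀ {z} → Visible q (p , s) z → proj₁ (g z tw) ≡ false)
  search-false p [] u refl = refl , λ ()
  search-false {q} {g} p (c ∷ s) {tw} u e with q c in qc
  search-false {q} {g} p (c ∷ s) {tw} u refl | true =
    refl , λ { (now h) → contradiction qc (λ t → true≢false t h) ; (later h _) → contradiction qc (λ t → true≢false t h) }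
  ... | false with g (p , c ∷ s) tw in gc | u (p , c ∷ s) tw
  ...   | false , tw″ | h rewrite h refl with search-false (c ∷ p) s u e
  ...     | e′ , all = e′ , λ { (now _) → cong proj₁ gc ; (later _ v) → all v }

  module _ (𝓛 : DL) (z₀ : Zip) where

    repair-unchanged : ∀ x → Unchanged (λ y → repair 𝓛 z₀ x y)
    repair-unchanged x y tw h with violation 𝓛 z₀ x y tw
    ... | false = refl

    repairs-unchanged : Unchanged (λ x → search never z₀ (λ y → repair 𝓛 z₀ x y))
    repairs-unchanged x tw h with search never z₀ (λ y → repair 𝓛 z₀ x y) tw in e
    ... | false , tw′ = proj₁ (search-false (proj₁ z₀) (proj₂ z₀) (repair-unchanged x) e)

    refine-true : ∀ {tw tw′} → refine 𝓛 z₀ tw ≡ (true , tw′) →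
      ∃[ x ] ∃[ y ] Visible never z₀ x × Visible never z₀ y × violation 𝓛 z₀ x y tw ≡ true × tw′ ≡ clearEntry x y tw
    refine-true {tw} e with search-true (proj₁ z₀) (proj₂ z₀) repairs-unchanged e
    ... | x , vx , e₁ with search-true (proj₁ z₀) (proj₂ z₀) (repair-unchanged x) e₁
    ...   | y , vy , e₂ with violation 𝓛 z₀ x y tw in h
    ...     | true with e₂
    ...       | refl = x , y , vx , vy , h , refl

    refine-false : ∀ {tw tw′} → refine 𝓛 z₀ tw ≡ (false , tw′) →
      tw′ ≡ tw × (∀ {x y} → Visible never z₀ x → Visible never z₀ y → violation 𝓛 z₀ x y tw ≡ false)
    refine-false {tw} e with search-false (proj₁ z₀) (proj₂ z₀) repairs-unchanged e
    ... | refl , none = refl , λ {x} {y} vx vy → clean x y (none vx) vy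
      where
      clean : ∀ x y → proj₁ (search never z₀ (λ y → repair 𝓛 z₀ x y) tw) ≡ false → Visible never z₀ y →
              violation 𝓛 z₀ x y tw ≡ false
      clean x y h vy with search never z₀ (λ y → repair 𝓛 z₀ x y) tw in e₁
      ... | false , _ with violation 𝓛 z₀ x y tw in hv
                         | proj₂ (search-false (proj₁ z₀) (proj₂ z₀) (repair-unchanged x) e₁) vy
      ...   | false | _  = refl
      ...   | true  | ()

  -- The loop invariant and the simulation at the fixpoint

  module Table (𝓛 : DL) (ts : List Token) where

    w : W
    w = tokens⇒word ts

    z₀ : Zip
    z₀ = start ts

    -- The half of the invariant that yields the ontology. It demands nothing of entries at
    -- positions where no name begins.
    Justified : W → Set
    Justified tw = ∀ x y → word x ≡ w → word y ≡ w → getEntry x y tw ≡ false →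
                   ∀ {b a} → Named x b → Named y a → Distinguished 𝓛 (facts ts) b a

    Sound : W → Set
    Sound tw = (∃[ T ] tw ≡ gridWord {side w} {side w} T) × Justified tw

    sound-full : Sound (fullTable w)
    sound-full = (replicate (side w) (replicate (side w) true) , full-rows (side w) (side w)) ,
      λ x y wx wy h → contradiction h (true≢false (entry x y wx wy))
      where
      entry : ∀ x y → word x ≡ w → word y ≡ w → getEntry x y (fullTable w) ≡ true
      entry x y wx wy = trans (cong (getEntry x y) (full-rows (side w) (side w)))
        (trans (getEntry-grid (replicate (side w) (replicate (side w) true)) x y wx wy)
          (trans (cong (λ r → lookup r (index y wy)) (lookup-replicate (index x wx) (replicate (side w) true)))
                 (lookup-replicate (index y wy) true)))

    -- The entries that a role violation finds cleared are justified already; their derivations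
    -- become the premises of one more rule of `Distinguished`.
    justify : ∀ {tw} x y → Justified tw → violation 𝓛 z₀ x y tw ≡ true →
              ∀ {b a} → Named x b → Named y a → Distinguished 𝓛 (facts ts) b a
    justify {tw} x y J h {b} {a} nx ny =
      case ∨-true {conceptViolation z₀ x y} (proj₂ (∧-true {getEntry x y tw} h)) of λ
      { (inj₁ h₁) → case conceptViolation-true ts x y h₁ of λ { (A , b′ , m , nb , absent) →
          rename nb (by-concept m (absent ny)) }
      ; (inj₂ h₁) → case ∨-true {roleViolation path₂ path₃ z₀ x y tw} h₁ of λ
        { (inj₁ h₂) → case roleViolation-true straight ts x y tw h₂ of λ { (R , b′ , c , m , nb , p , np , wp , absent) →
            rename nb (by-forward m λ a′ m′ → case absent ny m′ of λ { (p′ , np′ , wp′ , e) → J p p′ wp wp′ e np np′ }) }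
        ; (inj₂ h₂) → backward 𝓛 refl h₂ } }
      where
      rename : ∀ {b′} → Named x b′ → Distinguished 𝓛 (facts ts) b′ a → Distinguished 𝓛 (facts ts) b a
      rename nb = subst (λ c → Distinguished 𝓛 (facts ts) c a) (Named-unique nb nx)
      backward : ∀ 𝓛′ → 𝓛 ≡ 𝓛′ → backwardViolation 𝓛′ z₀ x y tw ≡ true → Distinguished 𝓛 (facts ts) b a
      backward ELI⊥ e h₂ = case roleViolation-true exchanged ts x y tw h₂ of λ { (R , b′ , c , m , nb , p , np , wp , absent) →
        rename nb (by-backward e m λ a′ m′ → case absent ny m′ of λ { (p′ , np′ , wp′ , e) → J p p′ wp wp′ e np np′ }) }

    clear-sound : ∀ {tw} x y → Sound tw → word x ≡ w → word y ≡ w →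
                  (∀ {b a} → Named x b → Named y a → Distinguished 𝓛 (facts ts) b a) → Sound (clearEntry x y tw)
    clear-sound {tw} x y ((T , eT) , J) wx wy d = (T′ , eq) , λ x′ y′ wx′ wy′ h →
      choose x′ y′ wx′ wy′ (index x′ wx′ ≟ i) (index y′ wy′ ≟ j)
             (trans (sym (getEntry-grid T′ x′ y′ wx′ wy′)) (trans (cong (getEntry x′ y′) (sym eq)) h))
      where
      i = index x wx
      j = index y wy
      T′ : Grid (side w) (side w)
      T′ = T [ i ]≔ (lookup T i [ j ]≔ false)
      eq : clearEntry x y tw ≡ gridWord T′
      eq = trans (cong (clearEntry x y) eT) (clearEntry-grid T x y wx wy)
      -- Only the entry in row `i` and column `j` is new; in any other row, and elsewhere in row
      -- `i`, the lookup is the one in the old grid.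
      choose : ∀ x′ y′ wx′ wy′ → Dec (index x′ wx′ ≡ i) → Dec (index y′ wy′ ≡ j) →
               lookup (lookup T′ (index x′ wx′)) (index y′ wy′) ≡ false →
               ∀ {b a} → Named x′ b → Named y′ a → Distinguished 𝓛 (facts ts) b a
      choose x′ y′ wx′ wy′ (yes p) (yes q) new nx ny =
        d (subst (λ z → Named z _) (index-injective x′ x wx′ wx p) nx)
          (subst (λ z → Named z _) (index-injective y′ y wy′ wy q) ny)
      choose x′ y′ wx′ wy′ (no p) _ new =
        J x′ y′ wx′ wy′ (trans (cong (getEntry x′ y′) eT) (trans (getEntry-grid T x′ y′ wx′ wy′)
          (trans (cong (λ r → lookup r (index y′ wy′)) (sym (lookup∘updateAt′ _ i p T))) new)))
      choose x′ y′ wx′ wy′ (yes p) (no q) new =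
        J x′ y′ wx′ wy′ (trans (cong (getEntry x′ y′) eT) (trans (getEntry-grid T x′ y′ wx′ wy′)
          (trans (cong (λ k → lookup (lookup T k) (index y′ wy′)) p)
          (trans (sym (lookup∘updateAt′ _ j q (lookup T i)))
          (trans (cong (λ r → lookup r (index y′ wy′)) (sym (lookup∘updateAt i T)))
          (trans (cong (λ k → lookup (lookup T′ k) (index y′ wy′)) (sym p)) new))))))

    refine-sound : ∀ {tw tw′} → Sound tw → refine 𝓛 z₀ tw ≡ (true , tw′) → Sound tw′ × count tw′ < count tw
    refine-sound {tw} S e = case refine-true 𝓛 z₀ e of λ { (x , y , vx , vy , h , e′) →
      subst (λ v → Sound v × count v < count tw) (sym e′)
        (clear-sound x y S (visible-word vx) (visible-word vy) (justify x y (proj₂ S) h) ,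
         count-clear x y tw (proj₁ (∧-true {getEntry x y tw} h))) }

    -- Existential over occurrences: the condition at one uncleared entry leads to another uncleared
    -- entry for the successors, at whatever occurrences it may be.
    Simulates : W → N-I → N-I → Set
    Simulates tw b a = ∃[ x ] ∃[ y ] Named x b × Named y a × word x ≡ w × word y ≡ w × getEntry x y tw ≡ true

    simulation : ∀ {tw} → (∀ {x y} → Visible never z₀ x → Visible never z₀ y → violation 𝓛 z₀ x y tw ≡ false) →
                 Simulation 𝓛 (facts ts) (Simulates tw)
    simulation {tw} clean = record
      { concepts = λ { (x , y , nx , ny , wx , wy , e) m →
          conceptViolation-false ts x y (proj₁ (none x y nx ny wx wy e)) m nx ny }
      ; forward = λ { (x , y , nx , ny , wx , wy , e) m →
          case roleViolation-false straight ts x y tw (proj₁ (∨-false (proj₂ (none x y nx ny wx wy e)))) m nx ny of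
          λ { (a′ , m′ , p , p′ , np , np′ , wp , wp′ , e′) → a′ , m′ , p , p′ , np , np′ , wp , wp′ , e′ } }
      ; backward = λ { refl (x , y , nx , ny , wx , wy , e) m →
          case roleViolation-false exchanged ts x y tw
                 (proj₂ (∨-false {roleViolation path₂ path₃ z₀ x y tw} (proj₂ (none x y nx ny wx wy e)))) m nx ny of
          λ { (a′ , m′ , p , p′ , np , np′ , wp , wp′ , e′) → a′ , m′ , p , p′ , np , np′ , wp , wp′ , e′ } } }
      where
      none : ∀ x y {b a} → Named x b → Named y a → word x ≡ w → word y ≡ w → getEntry x y tw ≡ true →
             conceptViolation z₀ x y ≡ false ×
             (roleViolation path₂ path₃ z₀ x y tw ∨ backwardViolation 𝓛 z₀ x y tw) ≡ false
      none x y nx ny wx wy e =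
        ∨-false (∧-false (clean (named-visible wx nx) (named-visible wy ny)) e)

  boxes-all : ∀ P N → map proj₂ (boxes P N) ≡ P ++ N
  boxes-all P N = trans (map-++ proj₂ (map (true ,_) P) (map (false ,_) N))
    (cong₂ _++_ (trans (sym (map-∘ P)) (map-id P)) (trans (sym (map-∘ N)) (map-id N)))

  pool-facts : ∀ P N → facts (tokens (boxes P N)) ≡ concatMap toList (P ++ N)
  pool-facts P N = trans (facts-tokens (boxes P N))
    (trans (sym (concatMap-map toList proj₂ (boxes P N))) (cong (concatMap toList) (boxes-all P N)))

  module _ (𝓛 : DL) (E : Examples) where
    open Examples E
    private
      ts = tokens (boxes positive negative)
    open Table 𝓛 ts

    admissible-examples : admissible z₀ ≡ true
    admissible-examples =
      cong₂ _∧_ (valid-encoding positive negative)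
        (cong not (separate-shared ts
          (disjoint⇒separate (boxes positive negative) (subst DisjointBoxes (sym (boxes-all positive negative)) disjoint))))

    verdict-sound : ∀ {tw} → Justified tw → verdict z₀ tw ≡ true → ∃[ 𝒪 ] Fits {𝓛} 𝒪 E
    verdict-sound {tw} J h = distinguished⇒fits {𝓛} E λ {ℬ} ℬ∈ →
      case verdict-true positive negative tw h ℬ∈ of λ { (b , x , b∈ , nx , wx , hx) →
      b , b∈ , λ {𝒜} {a} 𝒜∈ a∈ →
      case simulated-false positive negative tw x hx {𝒜} {a} 𝒜∈ a∈ of λ { (y , ny , wy , hy) →
      subst (λ as → Distinguished 𝓛 as b a) (pool-facts positive negative) (J x y wx wy hy nx ny) } }

    verdict-complete : ∀ {tw} → (∀ {x y} → Visible never z₀ x → Visible never z₀ y → violation 𝓛 z₀ x y tw ≡ false) →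
                       verdict z₀ tw ≡ false → ∀ 𝒪 → ¬ Fits {𝓛} 𝒪 E
    verdict-complete {tw} clean h = case verdict-false positive negative tw h of λ { (ℬ , ℬ∈ , sim) →
      simulated⇒¬fits E {Simulates tw}
        (subst (λ as → Simulation 𝓛 as (Simulates tw)) (pool-facts positive negative) (simulation clean)) ℬ∈
        λ {b} b∈ → case sim {b} b∈ of λ { (x , nx , wx , hx) →
               case simulated-true positive negative tw x hx of λ { (𝒜 , 𝒜∈ , a , a∈ , y , ny , wy , hy) →
               𝒜 , 𝒜∈ , a , a∈ , x , y , nx , ny , wx , wy , hy } } }

  -- The machine answers correctly on every word

  module _ (𝓛 : DL) where

    fittingDecider : Decider (λ env _ → admissible (env 0F)) (λ env tw → verdict (env 0F) tw) (λ env tw → refine 𝓛 (env 0F) tw)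
    fittingDecider = makeDecider admissible-test (refine-comp 𝓛) verdict-test

    open Decider fittingDecider

    Answer : W → Set₁
    Answer w = ∃[ b ] (run turing (polynomial time (length w)) w ≡ just b × (b ≡ true ⇔ ConsistentFitting 𝓛 w))

    -- All encodings are admissible, so an inadmissible word encodes no collection.
    rejected : ∀ w → admissible ([] , w) ≡ false → Answer w
    rejected w h =
      false , rejects h ,
      mk⇔ (λ ()) λ { (E , e , _) →
        ⊥-elim (true≢false (subst (λ v → admissible ([] , v) ≡ true)
          (trans (sym (encode-tokens (Examples.positive E) (Examples.negative E))) e) (admissible-examples 𝓛 E)) h) }

    answered : ∀ E → let w = tokens⇒word (tokens (boxes (Examples.positive E) (Examples.negative E))) in
               admissible ([] , w) ≡ true → Answer w
    answered E h =
      case answers Sound count h sound-full (count≤length (fullTable w)) refine-sound of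
      λ { (tw , tw′ , (_ , J) , e , r) →
      case refine-false 𝓛 z₀ e of λ { (e′ , clean) →
      verdict z₀ tw′ , r ,
      mk⇔ (λ v → E , encode-tokens positive negative , verdict-sound 𝓛 E (subst Justified (sym e′) J) v)
          (λ { (E′ , eq , 𝒪 , fits) → complete tw tw′ e′ clean E′ eq 𝒪 fits }) } }
      where
      open Examples E
      open Table 𝓛 (tokens (boxes positive negative))
      -- Here `E′` is any collection with the same encoding as `E`. The obstruction is built for
      -- `E′` itself, after the facts about the table have been moved along the equality of words.
      complete : ∀ tw tw′ → tw′ ≡ tw →
        (∀ {x y} → Visible never z₀ x → Visible never z₀ y → violation 𝓛 z₀ x y tw ≡ false) →
        ∀ E′ → encode E′ ≡ w → ∀ 𝒪 → Fits {𝓛} 𝒪 E′ → verdict z₀ tw′ ≡ true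
      complete tw .tw refl clean E′ eq 𝒪 fits with verdict z₀ tw in v
      ... | true  = refl
      ... | false = ⊥-elim (verdict-complete 𝓛 E′ {tw}
              (λ {x} {y} → subst (λ s → ∀ {x y} → Visible never ([] , s) x → Visible never ([] , s) y → violation 𝓛 ([] , s) x y tw ≡ false) w≡ clean)
              (subst (λ s → verdict ([] , s) tw ≡ false) w≡ v) 𝒪 fits)
        where
        w≡ : w ≡ tokens⇒word (tokens (boxes (Examples.positive E′) (Examples.negative E′)))
        w≡ = trans (sym eq) (encode-tokens (Examples.positive E′) (Examples.negative E′))

    decides : DecidesInTime turing (polynomial time) (ConsistentFitting 𝓛)
    decides w with admissible ([] , w) in h
    ... | false = rejected w h
    ... | true with ∧-true {valid ([] , w)} h
    ...   | hv , hs with valid-parse w hv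
    ...     | P , N , refl = subst Answer (sym (encode-tokens P N)) (answered E (subst (λ s → admissible ([] , s) ≡ true) (encode-tokens P N) h))
      where
      E : Examples
      -- The two halves of admissibility: parsing gives the lists, and the negative answer of
      -- `shared` gives their disjointness.
      E = record { positive = P ; negative = N ; disjoint =
        subst DisjointBoxes (boxes-all P N) (separate⇒disjoint (boxes P N) (shared-separate (tokens (boxes P N))
          (subst (λ s → shared ([] , s) ≡ false) (encode-tokens P N) (not-true hs)))) }

open Correctness

theorem2 : (𝓛 : DL) → PTime (ConsistentFitting 𝓛)
theorem2 𝓛 = turing , time , decides 𝓛
  where open Deciding.Decider (fittingDecider 𝓛)
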